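{- Let $b \geq 3$ be an integer. If $b \geq 4$, then the equation $$\frac{(1 + s)\zeta_b'(s)}{\zeta_b(s)} - \log\left(\frac{\zeta_b(s)}{b}\right) = 0$$ has a unique solution $s = s_b$ over the positive real numbers. Define $\eta_3 := \log 2/\log 3$ and, for $b \geq 4$, $$\eta_b := 1 + \frac{1}{(1 + s_b)\log b}\log\left(\frac{\zeta_b(s_b)}{b}\right).$$ Then, for every integer $b \geq 3$, $$\#\mathcal{N}_b(x) < x^{\eta_b + o(1)}, \quad \text{as } x \to +\infty.$$
   Context: For an integer $b \geq 2$, every positive integer $n$ has a unique representation $n = \sum_{j=0}^{\ell} d_j b^j$ with $d_0,\dots,d_\ell \in \{0,\dots,b-1\}$ and $d_\ell \neq 0$; the $d_0,\dots,d_\ell$ are the base $b$ digits of $n$. Let $p_b(n)$ be the product of all the base $b$ digits of $n$. For real $x \geq 1$, let $\mathcal{N}_b(x) := \{n \leq x : p_b(n) \mid n\}$, where $n$ ranges over positive integers (if $n$ has a zero digit then $p_b(n)=0$ does not divide $n$). For real $s \geq 0$, let $\zeta_b(s) := \sum_{d=1}^{b-1} d^{ -s}$, and let $\zeta_b'$ be its derivative with respect to $s$. $\log$ is the natural logarithm. The notation $f(x) < x^{\eta + o(1)}$ as $x \to +\infty$ (with $b$ fixed) means that there is a function $\varepsilon(x)$ with $\varepsilon(x) \to 0$ as $x \to +\infty$ such that $f(x) < x^{\eta + \varepsilon(x)}$ for all sufficiently large $x$. -}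

module Defs where

open import Level using (0ℓ)
open import Algebra.Bundles using (CommutativeRing; Semiring)
open import Algebra.Structures using (IsCommutativeRing)
import Algebra.Definitions.RawSemiring as RawSemiringOps
open import Axiom.ExcludedMiddle using (ExcludedMiddle)
open import Data.Bool.Base using (if_then_else_)
open import Data.Digit using (toDigits)
open import Data.Fin.Base using (toℕ)
open import Data.List.Base using (List; length; map)
open import Data.List.Membership.Propositional using (_∈_)
open import Data.List.Relation.Unary.Unique.Propositional using (Unique)
open import Data.Nat.Base as ℕ using (ℕ; zero; suc; 2+; _!)
open import Data.Nat.Divisibility using () renaming (_∣_ to _∣ⁿ_)
open import Data.Nat.ListAction using (product)
open import Data.Product.Base using (∃; _×_; _,_; proj₁)
open import Data.Sum.Base using (_⊎_; inj₁; inj₂)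
open import Function.Bundles using (_⇔_)
import Relation.Binary.Construct.StrictToNonStrict as StrictToNonStrict
open import Relation.Binary.PropositionalEquality using (_≡_; _≢_; refl)
open import Relation.Binary.Structures using (IsStrictTotalOrder)
open import Relation.Nullary.Decidable using (Dec; does; yes; no)
open import Relation.Nullary.Negation using (¬_; contradiction)

-- The digits include no leading zero for n > 0: toDigits stops at the first
-- zero quotient. The bases 0 and 1 are not used, and get a dummy value.
digitProduct : ℕ → ℕ → ℕ
digitProduct zero       n = 0
digitProduct (suc zero) n = 0
digitProduct b@(2+ _)   n = product (map toℕ (proj₁ (toDigits b n)))

-- The real numbers, given by their usual axioms as a Dedekind-complete
-- ordered field; these determine the field up to unique isomorphism.
record RealNumbers : Set₁ where
  infix  8 -_
  infix  9 _⁻¹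
  infixl 7 _*_ _/_
  infixl 6 _+_ _-_
  infix  4 _<_
  field
    ℝ     : Set
    _+_   : ℝ → ℝ → ℝ
    _*_   : ℝ → ℝ → ℝ
    -_    : ℝ → ℝ
    0#    : ℝ
    1#    : ℝ
    _⁻¹   : ℝ → ℝ
    _<_   : ℝ → ℝ → Set

    isCommutativeRing  : IsCommutativeRing _≡_ _+_ _*_ -_ 0# 1#
    -- The value of 0# ⁻¹ is left unspecified.
    ⁻¹-inverse         : ∀ x → x ≢ 0# → x * x ⁻¹ ≡ 1#
    isStrictTotalOrder : IsStrictTotalOrder _≡_ _<_
    0<1                : 0# < 1#
    +-monoˡ-<          : ∀ x y z → x < y → x + z < y + z
    *-pos              : ∀ x y → 0# < x → 0# < y → 0# < x * y

  open StrictToNonStrict _≡_ _<_ public using (_≤_)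

  -- "Least" is in approximation form: no y < s is an upper bound, as
  -- witnessed by an element of P above y. Together with trichotomy this makes
  -- the logic classical (see em below).
  IsSup : (ℝ → Set) → ℝ → Set
  IsSup P s = (∀ x → P x → x ≤ s) × (∀ y → y < s → ∃ λ x → P x × y < x)

  field
    sup : ∀ (P : ℝ → Set) → ∃ P → (∃ λ u → ∀ x → P x → x ≤ u) → ∃ (IsSup P)

  open IsStrictTotalOrder isStrictTotalOrder public
    using (compare; _<?_; _≟_) renaming (irrefl to <-irrefl; trans to <-trans)

  commutativeRing : CommutativeRing 0ℓ 0ℓ
  commutativeRing = record { isCommutativeRing = isCommutativeRing }

  open RawSemiringOps (Semiring.rawSemiring (CommutativeRing.semiring commutativeRing)) public
    using (_^_; sum) renaming (_×_ to _·_)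

  _-_ : ℝ → ℝ → ℝ
  x - y = x + - y

  _/_ : ℝ → ℝ → ℝ
  x / y = x * y ⁻¹

  ∣_∣ : ℝ → ℝ
  ∣ x ∣ = if does (x <? 0#) then - x else x

  fromℕ : ℕ → ℝ
  fromℕ n = n · 1#

module Analysis (𝓡 : RealNumbers) where
  open RealNumbers 𝓡 public

  -- Compare 0 with sup ({0} ∪ {1 ∣ P}).
  em : ExcludedMiddle 0ℓ
  em {P} = decide
    where
    S : ℝ → Set
    S x = x ≡ 0# ⊎ (P × x ≡ 1#)

    S≤1 : ∀ x → S x → x ≤ 1#
    S≤1 x (inj₁ refl)       = inj₁ 0<1
    S≤1 x (inj₂ (_ , refl)) = inj₂ refl

    S-pos : ∀ x → S x → 0# < x → P
    S-pos x (inj₁ refl)    0<x = contradiction 0<x (<-irrefl refl)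
    S-pos x (inj₂ (p , _)) _   = p

    s≯0⇒¬P : ∀ {s} → IsSup S s → ¬ (0# < s) → ¬ P
    s≯0⇒¬P (ub , _) s≯0 p with ub 1# (inj₂ (p , refl))
    ... | inj₁ 1<s  = s≯0 (<-trans 0<1 1<s)
    ... | inj₂ refl = s≯0 0<1

    decide : Dec P
    decide with sup S (0# , inj₁ refl) (1# , S≤1)
    ... | s , isSup@(_ , approx) with 0# <? s
    ...   | no  s≯0 = no (s≯0⇒¬P isSup s≯0)
    ...   | yes 0<s with approx 0# 0<s
    ...     | x , x∈S , 0<x = yes (S-pos x x∈S 0<x)

  -- Hilbert choice with a default: some x satisfying P if there is one, and
  -- the default otherwise. The functions below that are defined with it take
  -- the default exactly where the object they name does not exist.
  choose : {A : Set} → A → (A → Set) → A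
  choose default P with em {∃ P}
  ... | yes (x , _) = x
  ... | no  _       = default

  Converges : (ℕ → ℝ) → ℝ → Set
  Converges u L =
    ∀ δ → 0# < δ → ∃ λ N → ∀ n → N ℕ.≤ n → ∣ u n - L ∣ < δ

  exp : ℝ → ℝ
  exp x = choose 0# (Converges λ n →
    sum {n} λ i → x ^ toℕ i / fromℕ (toℕ i !))

  -- Natural logarithm, meaningful for x > 0.
  log : ℝ → ℝ
  log x = choose 0# λ y → exp y ≡ x

  -- Real power, meaningful for x > 0.
  infixr 8 _^ʳ_
  _^ʳ_ : ℝ → ℝ → ℝ
  x ^ʳ y = exp (y * log x)

  HasDerivAt : (ℝ → ℝ) → ℝ → ℝ → Set
  HasDerivAt f x D =
    ∀ ε → 0# < ε → ∃ λ δ → 0# < δ ×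
      (∀ h → h ≢ 0# → ∣ h ∣ < δ → ∣ (f (x + h) - f x) / h - D ∣ < ε)

  deriv : (ℝ → ℝ) → ℝ → ℝ
  deriv f x = choose 0# (HasDerivAt f x)

  TendsTo0AtInfinity : (ℝ → ℝ) → Set
  TendsTo0AtInfinity ε =
    ∀ δ → 0# < δ → ∃ λ X → ∀ x → X ≤ x → ∣ ε x ∣ < δ

  -- f(x) < x^(θ + o(1)) as x → +∞.
  _<x^[_+o1] : (ℝ → ℝ) → ℝ → Set
  f <x^[ θ +o1] = ∃ λ ε → TendsTo0AtInfinity ε ×
    (∃ λ X → ∀ x → X ≤ x → f x < x ^ʳ (θ + ε x))

  HasCard : (ℕ → Set) → ℕ → Set
  HasCard A k = ∃ λ (ns : List ℕ) →
    Unique ns × (∀ n → n ∈ ns ⇔ A n) × length ns ≡ k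

  -- Cardinality of a finite set of naturals.
  # : (ℕ → Set) → ℕ
  # A = choose 0 (HasCard A)

  𝒩 : ℕ → ℝ → ℕ → Set
  𝒩 b x n = 0 ℕ.< n × fromℕ n ≤ x × digitProduct b n ∣ⁿ n

  ζ : ℕ → ℝ → ℝ
  ζ b s = sum {b ℕ.∸ 1} λ i → fromℕ (suc (toℕ i)) ^ʳ (- s)

  ζ′ : ℕ → ℝ → ℝ
  ζ′ b = deriv (ζ b)

  IsPositiveRoot : ℕ → ℝ → Set
  IsPositiveRoot b s =
    0# < s ×
    ((1# + s) * ζ′ b s) / ζ b s - log (ζ b s / fromℕ b) ≡ 0#

  sᵣ : ℕ → ℝ
  sᵣ b = choose 0# (IsPositiveRoot b)

  η : ℕ → ℝ
  η 3 = log (fromℕ 2) / log (fromℕ 3)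
  η b = 1# + 1# / ((1# + sᵣ b) * log (fromℕ b)) * log (ζ b (sᵣ b) / fromℕ b)

-- Fix s ≥ 0 and put α = (1 - log ζ_b(s) / log b) / (1 + s) and y = x^α. A number
-- n ≤ x in 𝒩_b has no zero digit, so if p_b(n) ≤ y then n is counted by
-- Rankin's weight (y / p_b(n))^s, and these weights sum to at most about
-- y^s ζ_b(s)^ℓ, ℓ being the number of digits of x. If p_b(n) > y, then n is a
-- multiple of p_b(n), which takes polylogarithmically many values, and the
-- cofactor is less than x / y. The choice of α makes both bounds x^(1 - α + o(1));
-- s = s_b gives 1 - α = η_b for b ≥ 4, and s = 0 gives it for b = 3.
--
-- Since log ζ_b is strictly convex (its tangents lie below it by Jensen's
-- inequality), the left-hand side of the equation for s_b is strictly
-- increasing. At 0 it is negative because (b / (b-1))^(b-1) < e < 6 ≤ (b-1)!,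
-- and the tangent at 2 t + 1, evaluated at t with 2^t = b, shows it to be
-- positive at 2 t + 1.
--
-- On the exponential series: the error of the product of two partial sums is
-- bounded by the same error at the absolute values, hence tends to 0. This gives
-- the addition formula and, with y = - x, convergence at negative x. With
-- 1 + x ≤ exp x it yields everything else about exp and log that is needed.

module Submission where

open import Defs
open import Algebra.Bundles using (CommutativeRing)
import Algebra.Properties.Ring as RingProperties
import Algebra.Properties.Semiring.Mult as Mult
import Algebra.Properties.Semiring.Mult.TCOptimised as Mult′
import Algebra.Solver.Ring
open import Algebra.Solver.Ring.AlmostCommutativeRing using (fromCommutativeRing; _-Raw-AlmostCommutative⟶_)
open import Data.Digit using (toDigits; fromDigits)
open import Data.Fin.Base as Fin using (Fin; toℕ)
import Data.Fin.Properties as Fin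
open import Data.Integer.Base as ℤ using (ℤ; -[1+_])
import Data.Integer.Properties as ℤ
open import Data.List.Base using (List; []; _∷_; _++_; length; map; filter; upTo; allFin; tabulate; cartesianProductWith)
open import Data.List.Membership.Propositional using (_∈_)
open import Data.List.Membership.Propositional.Properties
  using (∈-map⁺; ∈-++⁺ˡ; ∈-++⁺ʳ; ∈-++⁻; ∈-∃++; ∈-filter⁺; ∈-allFin; ∈-upTo⁺; ∈-upTo⁻; ∈-cartesianProductWith⁺; ∈-cartesianProductWith⁻)
import Data.List.Properties as List
import Data.List.Relation.Unary.All as All
open import Data.List.Relation.Unary.AllPairs using ([]; _∷_)
open import Data.List.Relation.Unary.Any using (here; there)
open import Data.List.Relation.Unary.Unique.Propositional using (Unique)
open import Data.Maybe.Base as Maybe using (Maybe)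
open import Data.Nat.Base as ℕ using (ℕ; zero; suc; 2+; z≤n; s≤s; _!)
open import Data.Nat.Divisibility using (divides; 0∣⇒≡0) renaming (_∣_ to _∣ⁿ_)
open import Data.Nat.ListAction using (product)
import Data.Nat.Properties as ℕ
open import Data.Product using (∃; ∃!; _×_; _,_; proj₁; proj₂)
open import Data.Sum.Base using (_⊎_; inj₁; inj₂; [_,_]′)
open import Function.Base using (_∘_; id)
open import Function.Bundles using (Equivalence)
open import Relation.Binary.Bundles using (StrictPartialOrder)
open import Relation.Binary.Definitions using (tri<; tri≈; tri>)
open import Relation.Binary.PropositionalEquality
  using (_≡_; _≢_; refl; sym; trans; cong; cong₂; subst; subst₂; module ≡-Reasoning)
import Relation.Binary.Reasoning.StrictPartialOrder as StrictPartialOrderReasoning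
open import Relation.Binary.Structures using (IsStrictTotalOrder)
open import Relation.Nullary.Decidable using (Dec; yes; no; dec⇒maybe; _⊎-dec_)
open import Relation.Nullary.Negation using (¬_; contradiction)

-- The equation for s_b is a stationarity condition. The exponent 1 - α is an increasing affine
-- function of (log ζ_b(s) - log b) / (1 + s), whose derivative is the left-hand side divided by (1
-- + s)^2. So s_b gives the least exponent when b ≥ 4, while for b = 3 the left-hand side is already
-- positive at 0, as 9/4 > 2, and s = 0 is best. The counting is done for an arbitrary s ≥ 0 and the
-- exponent that belongs to it.
--
-- The point 2 t + 1 is the s with 1 + s = 2 (s - t). Twice the tangent inequality at t then
-- replaces the derivative, and the left-hand side is at least log ζ_b(s) + log b - 2 log ζ_b(t),
-- where ζ_b(t) < 2 and 4 ≤ b.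
--
-- The counting sees x only through the ℓ with b^ℓ ≤ x < b^(ℓ+1) and takes y = b^(αℓ), which costs a
-- constant factor. Constants and powers of log x are absorbed by proving a bound C x^(η+δ) for each
-- δ > 0. The function ε is not assembled from these bounds but read off from the count itself.

-- Lengths of lists.

unique-⊆⇒length≤ : ∀ {A : Set} {xs ys : List A} → Unique xs → (∀ {x} → x ∈ xs → x ∈ ys) → length xs ℕ.≤ length ys
unique-⊆⇒length≤ []                                _ = z≤n
unique-⊆⇒length≤ {A} {x ∷ xs} (x∉xs ∷ xs-unique) xs⊆ys with ∈-∃++ (xs⊆ys (here refl))
... | as , bs , refl = begin
  suc (length xs)               ≤⟨ s≤s (unique-⊆⇒length≤ xs-unique without-x) ⟩
  suc (length (as ++ bs))       ≡⟨ cong suc (List.length-++ as) ⟩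
  suc (length as ℕ.+ length bs) ≡⟨ sym (ℕ.+-suc (length as) (length bs)) ⟩
  length as ℕ.+ suc (length bs) ≡⟨ sym (List.length-++ as) ⟩
  length (as ++ x ∷ bs)         ∎
  where
  open ℕ.≤-Reasoning
  without-x : ∀ {y} → y ∈ xs → y ∈ as ++ bs
  without-x y∈xs with ∈-++⁻ as (xs⊆ys (there y∈xs))
  ... | inj₁ y∈as         = ∈-++⁺ˡ y∈as
  ... | inj₂ (here refl)  = contradiction refl (All.lookup x∉xs y∈xs)
  ... | inj₂ (there y∈bs) = ∈-++⁺ʳ as y∈bs

length-cartesianProductWith : ∀ {A B C : Set} (f : A → B → C) xs ys →
  length (cartesianProductWith f xs ys) ≡ length xs ℕ.* length ys
length-cartesianProductWith f []       ys = refl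
length-cartesianProductWith f (x ∷ xs) ys = trans (List.length-++ (map (f x) ys))
  (cong₂ ℕ._+_ (List.length-map (f x) ys) (length-cartesianProductWith f xs ys))

-- A word over Fin n stands for the numeral in base n + 1, least significant
-- digit first, whose digits are those of the word increased by one.

value : ∀ {n} → List (Fin n) → ℕ
value []          = 0
value {n} (d ∷ w) = suc (toℕ d) ℕ.+ value w ℕ.* suc n

wordProduct : ∀ {n} → List (Fin n) → ℕ
wordProduct []      = 1
wordProduct (d ∷ w) = suc (toℕ d) ℕ.* wordProduct w

-- A zero digit would make the product zero; every other digit `Fin.suc d` is recorded as `d`, which
-- `value` and `wordProduct` increase again.
digits⇒word : ∀ {n} (ds : List (Fin (suc n))) → product (map toℕ ds) ≢ 0 →
  ∃ λ (w : List (Fin n)) → value w ≡ fromDigits ds × wordProduct w ≡ product (map toℕ ds)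
digits⇒word []               _  = [] , refl , refl
digits⇒word (Fin.zero  ∷ ds) ≢0 = contradiction refl ≢0
digits⇒word {n} (Fin.suc d ∷ ds) ≢0 with digits⇒word ds (λ ≡0 → ≢0 (trans (cong (suc (toℕ d) ℕ.*_) ≡0) (ℕ.*-zeroʳ (suc (toℕ d)))))
... | w , value≡ , product≡ =
  d ∷ w , cong (λ v → suc (toℕ d) ℕ.+ v ℕ.* suc n) value≡ , cong (suc (toℕ d) ℕ.*_) product≡

-- Zero divides only zero, so divisibility together with 0 < N excludes zero digits.
divisible⇒word : ∀ m {N} → 0 ℕ.< N → digitProduct (2+ m) N ∣ⁿ N →
  ∃ λ (w : List (Fin (suc m))) → value w ≡ N × wordProduct w ∣ⁿ N
divisible⇒word m {N} 0<N P∣N with digits⇒word (proj₁ (toDigits (2+ m) N))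
  (λ P≡0 → ℕ.<⇒≢ 0<N (sym (0∣⇒≡0 (subst (_∣ⁿ N) P≡0 P∣N))))
... | w , value≡ , product≡ = w , trans value≡ (proj₂ (toDigits (2+ m) N)) , subst (_∣ⁿ N) (sym product≡) P∣N

-- No digit of a word is zero, so the most significant one contributes a full power of the base.
-- This bounds the length of the words whose value is at most x.
base^length≤value : ∀ {n} (d : Fin n) w → suc n ℕ.^ length w ℕ.≤ value (d ∷ w)
base^length≤value d []               = s≤s z≤n
base^length≤value {n} d (d′ ∷ w) = begin
  suc n ℕ.* suc n ℕ.^ length w               ≤⟨ ℕ.*-monoʳ-≤ (suc n) (base^length≤value d′ w) ⟩
  suc n ℕ.* value (d′ ∷ w)                   ≡⟨ ℕ.*-comm (suc n) (value (d′ ∷ w)) ⟩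
  value (d′ ∷ w) ℕ.* suc n                   ≤⟨ ℕ.m≤n+m _ (suc (toℕ d)) ⟩
  suc (toℕ d) ℕ.+ value (d′ ∷ w) ℕ.* suc n   ∎
  where open ℕ.≤-Reasoning

-- Enumerating words and digit products.

words : ∀ n → ℕ → List (List (Fin n))
words n zero    = [] ∷ []
words n (suc M) = [] ∷ cartesianProductWith _∷_ (allFin n) (words n M)

∈-words : ∀ {n} M (w : List (Fin n)) → length w ℕ.≤ M → w ∈ words n M
∈-words zero    []      _           = here refl
∈-words (suc M) []      _           = here refl
∈-words (suc M) (d ∷ w) (s≤s len≤M) = there (∈-cartesianProductWith⁺ _∷_ (∈-allFin d) (∈-words M w len≤M))

-- The numbers 1 ^ c₁ * ⋯ * n ^ cₙ with all exponents at most M.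
smooth : ℕ → ℕ → List ℕ
smooth zero    M = 1 ∷ []
smooth (suc n) M = cartesianProductWith (λ c v → suc n ℕ.^ c ℕ.* v) (upTo (suc M)) (smooth n M)

-- The source of the polylogarithmic count: n is fixed by the base, while M grows like log x.
length-smooth : ∀ n M → length (smooth n M) ≡ suc M ℕ.^ n
length-smooth zero    M = refl
length-smooth (suc n) M = trans
  (length-cartesianProductWith (λ c v → suc n ℕ.^ c ℕ.* v) (upTo (suc M)) (smooth n M))
  (cong₂ ℕ._*_ (List.length-upTo (suc M)) (length-smooth n M))

smooth-power : ∀ n {M c v} → c ℕ.≤ M → v ∈ smooth n M → suc n ℕ.^ c ℕ.* v ∈ smooth (suc n) M
smooth-power n c≤M v∈ = ∈-cartesianProductWith⁺ (λ c v → suc n ℕ.^ c ℕ.* v) (∈-upTo⁺ (s≤s c≤M)) v∈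

1∈smooth : ∀ n M → 1 ∈ smooth n M
1∈smooth zero    M = here refl
1∈smooth (suc n) M = smooth-power n {c = 0} z≤n (1∈smooth n M)

smooth-suc : ∀ n {M v} → v ∈ smooth n M → v ∈ smooth n (suc M)
smooth-suc zero    v∈ = v∈
smooth-suc (suc n) {M} v∈ with ∈-cartesianProductWith⁻ (λ c v → suc n ℕ.^ c ℕ.* v) (upTo (suc M)) (smooth n M) v∈
... | c , v , c∈ , v∈ , refl with ∈-upTo⁻ c∈
...   | s≤s c≤M = smooth-power n (ℕ.m≤n⇒m≤1+n c≤M) (smooth-suc n v∈)

-- A factor equal to the largest base raises its exponent by one; a smaller factor is passed on to
-- the smaller bases. Either way no exponent grows by more than one.
smooth-* : ∀ n {M v} d → d ℕ.< n → v ∈ smooth n M → suc d ℕ.* v ∈ smooth n (suc M)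
smooth-* (suc n) {M} d d<1+n v∈ with ∈-cartesianProductWith⁻ (λ c v → suc n ℕ.^ c ℕ.* v) (upTo (suc M)) (smooth n M) v∈
... | c , v , c∈ , v∈ , refl with ∈-upTo⁻ c∈ | ℕ.<-cmp d n
...   | s≤s c≤M | tri< d<n _ _  = subst (_∈ smooth (suc n) (suc M)) (swap (suc n ℕ.^ c) (suc d) v)
  (smooth-power n (ℕ.m≤n⇒m≤1+n c≤M) (smooth-* n d d<n v∈))
  where
  swap : ∀ x y z → x ℕ.* (y ℕ.* z) ≡ y ℕ.* (x ℕ.* z)
  swap x y z = trans (sym (ℕ.*-assoc x y z)) (trans (cong (ℕ._* z) (ℕ.*-comm x y)) (ℕ.*-assoc y x z))
...   | s≤s c≤M | tri≈ _ refl _ = subst (_∈ smooth (suc n) (suc M)) (ℕ.*-assoc (suc n) (suc n ℕ.^ c) v)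
  (smooth-power n (s≤s c≤M) (smooth-suc n v∈))
...   | s≤s c≤M | tri> d≯n _ n<d = contradiction (ℕ.≤-trans d<1+n n<d) (ℕ.<-irrefl refl)

wordProduct∈smooth : ∀ {n} M (w : List (Fin n)) → length w ℕ.≤ M → wordProduct w ∈ smooth n M
wordProduct∈smooth {n} M       []      _           = 1∈smooth n M
wordProduct∈smooth {n} (suc M) (d ∷ w) (s≤s len≤M) =
  smooth-* n (toℕ d) (Fin.toℕ<n d) (wordProduct∈smooth M w len≤M)

module Proof (𝓡 : RealNumbers) where

  open Analysis 𝓡 public

  open CommutativeRing commutativeRing public
    using (+-assoc; +-comm; +-identityˡ; +-identityʳ; -‿inverseʳ;
           *-assoc; *-comm; *-identityˡ; *-identityʳ; zeroˡ; zeroʳ; distribˡ; distribʳ; semiring)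
    renaming (ring to ℝ-ring)
  open RingProperties ℝ-ring public
    using (-‿+-comm; -‿distribˡ-*; -‿distribʳ-*; -0#≈0#)
    renaming (-‿involutive to neg-involutive)
  open Mult semiring public using (×-homo-+; ×1-homo-*)
  module Mult′ₛ = Mult′ semiring

  -- The ring solver with integer coefficients.

  -- With the optimised multiple, 1 and 2 evaluate to `1#` and `1# + 1#` by computation, so the
  -- constants of the solver agree with those in the goals.
  ⟦_⟧ℤ : ℤ → ℝ
  ⟦ ℤ.+ n ⟧ℤ      = n Mult′ₛ.× 1#
  ⟦ -[1+ n ] ⟧ℤ = - (suc n Mult′ₛ.× 1#)

  ⟦-⟧ : ∀ i → ⟦ ℤ.- i ⟧ℤ ≡ - ⟦ i ⟧ℤ
  ⟦-⟧ (ℤ.+ zero)  = sym -0#≈0#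
  ⟦-⟧ (ℤ.+ suc n) = refl
  ⟦-⟧ -[1+ n ]  = sym (neg-involutive _)

  ⟦⊖⟧ : ∀ m n → ⟦ m ℤ.⊖ n ⟧ℤ ≡ m Mult′ₛ.× 1# - n Mult′ₛ.× 1#
  ⟦⊖⟧ m       zero    = sym (trans (cong (m Mult′ₛ.× 1# +_) -0#≈0#) (+-identityʳ _))
  ⟦⊖⟧ zero    (suc n) = sym (+-identityˡ _)
  ⟦⊖⟧ (suc m) (suc n) = begin
    ⟦ suc m ℤ.⊖ suc n ⟧ℤ  ≡⟨ cong ⟦_⟧ℤ (ℤ.[1+m]⊖[1+n]≡m⊖n m n) ⟩
    ⟦ m ℤ.⊖ n ⟧ℤ          ≡⟨ ⟦⊖⟧ m n ⟩
    x - y                 ≡⟨ cong (_- y) (sym (+-identityʳ x)) ⟩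
    x + 0# - y            ≡⟨ cong (λ z → x + z - y) (sym (-‿inverseʳ 1#)) ⟩
    x + (1# - 1#) - y     ≡⟨ cong (_- y) (sym (+-assoc x 1# (- 1#))) ⟩
    x + 1# - 1# - y       ≡⟨ +-assoc (x + 1#) (- 1#) (- y) ⟩
    x + 1# + (- 1# + - y) ≡⟨ cong₂ _+_ (+-comm x 1#) (-‿+-comm 1# y) ⟩
    1# + x - (1# + y)     ≡⟨ sym (cong₂ _-_ (Mult′ₛ.1+× m 1#) (Mult′ₛ.1+× n 1#)) ⟩
    suc m Mult′ₛ.× 1# - suc n Mult′ₛ.× 1# ∎
    where
    open ≡-Reasoning
    x = m Mult′ₛ.× 1#
    y = n Mult′ₛ.× 1#

  ⟦+⟧ : ∀ i j → ⟦ i ℤ.+ j ⟧ℤ ≡ ⟦ i ⟧ℤ + ⟦ j ⟧ℤ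
  ⟦+⟧ (ℤ.+ m)    (ℤ.+ n)    = Mult′ₛ.×-homo-+ 1# m n
  ⟦+⟧ (ℤ.+ m)    -[1+ n ] = ⟦⊖⟧ m (suc n)
  ⟦+⟧ -[1+ m ] (ℤ.+ n)    = trans (⟦⊖⟧ n (suc m)) (+-comm _ _)
  ⟦+⟧ -[1+ m ] -[1+ n ] = trans
    (cong (λ k → - (k Mult′ₛ.× 1#)) (sym (ℕ.+-suc (suc m) n)))
    (trans (cong -_ (Mult′ₛ.×-homo-+ 1# (suc m) (suc n))) (sym (-‿+-comm _ _)))

  ⟦*⟧ : ∀ i j → ⟦ i ℤ.* j ⟧ℤ ≡ ⟦ i ⟧ℤ * ⟦ j ⟧ℤ
  ⟦*+⟧ : ∀ i n → ⟦ i ℤ.* ℤ.+ n ⟧ℤ ≡ ⟦ i ⟧ℤ * ⟦ ℤ.+ n ⟧ℤ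
  ⟦*+⟧ (ℤ.+ m)    n = trans (cong ⟦_⟧ℤ (sym (ℤ.pos-* m n))) (Mult′ₛ.×1-homo-* m n)
  ⟦*+⟧ -[1+ m ] n = begin
    ⟦ -[1+ m ] ℤ.* ℤ.+ n ⟧ℤ        ≡⟨ cong ⟦_⟧ℤ (sym (ℤ.neg-distribˡ-* (ℤ.+ suc m) (ℤ.+ n))) ⟩
    ⟦ ℤ.- (ℤ.+ suc m ℤ.* ℤ.+ n) ⟧ℤ   ≡⟨ ⟦-⟧ (ℤ.+ suc m ℤ.* ℤ.+ n) ⟩
    - ⟦ ℤ.+ suc m ℤ.* ℤ.+ n ⟧ℤ       ≡⟨ cong -_ (⟦*+⟧ (ℤ.+ suc m) n) ⟩
    - (⟦ ℤ.+ suc m ⟧ℤ * ⟦ ℤ.+ n ⟧ℤ)  ≡⟨ -‿distribˡ-* _ _ ⟩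
    ⟦ -[1+ m ] ⟧ℤ * ⟦ ℤ.+ n ⟧ℤ     ∎
    where open ≡-Reasoning

  ⟦*⟧ i (ℤ.+ n)    = ⟦*+⟧ i n
  ⟦*⟧ i -[1+ n ] = begin
    ⟦ i ℤ.* -[1+ n ] ⟧ℤ         ≡⟨ cong ⟦_⟧ℤ (sym (ℤ.neg-distribʳ-* i (ℤ.+ suc n))) ⟩
    ⟦ ℤ.- (i ℤ.* ℤ.+ suc n) ⟧ℤ    ≡⟨ ⟦-⟧ (i ℤ.* ℤ.+ suc n) ⟩
    - ⟦ i ℤ.* ℤ.+ suc n ⟧ℤ        ≡⟨ cong -_ (⟦*+⟧ i (suc n)) ⟩
    - (⟦ i ⟧ℤ * ⟦ ℤ.+ suc n ⟧ℤ)   ≡⟨ -‿distribʳ-* _ _ ⟩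
    ⟦ i ⟧ℤ * ⟦ -[1+ n ] ⟧ℤ      ∎
    where open ≡-Reasoning

  ℤ⟶ℝ : ℤ.+-*-rawRing -Raw-AlmostCommutative⟶ fromCommutativeRing commutativeRing
  ℤ⟶ℝ = record
    { ⟦_⟧    = ⟦_⟧ℤ
    ; +-homo = ⟦+⟧
    ; *-homo = ⟦*⟧
    ; -‿homo = ⟦-⟧
    ; 0-homo = refl
    ; 1-homo = refl
    }

  ⟦⟧-≟ : ∀ i j → Maybe (⟦ i ⟧ℤ ≡ ⟦ j ⟧ℤ)
  ⟦⟧-≟ i j = Maybe.map (cong ⟦_⟧ℤ) (dec⇒maybe (i ℤ.≟ j))

  open Algebra.Solver.Ring ℤ.+-*-rawRing (fromCommutativeRing commutativeRing) ℤ⟶ℝ ⟦⟧-≟ public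
    using (Polynomial; con; solve; _:=_; _:+_; _:*_; _:-_; :-_; _:^_)

  :0 :1 :2 : ∀ {n} → Polynomial n
  :0 = con (ℤ.+ 0)
  :1 = con (ℤ.+ 1)
  :2 = con (ℤ.+ 2)

  -- The ordered field of the reals.

  module <-Order = IsStrictTotalOrder isStrictTotalOrder

  strictPartialOrder : StrictPartialOrder _ _ _
  strictPartialOrder = record { isStrictPartialOrder = <-Order.isStrictPartialOrder }

  module ≤-Reasoning = StrictPartialOrderReasoning strictPartialOrder

  ≤-refl : ∀ {x} → x ≤ x
  ≤-refl = inj₂ refl

  ≤-reflexive : ∀ {x y} → x ≡ y → x ≤ y
  ≤-reflexive = inj₂

  <⇒≤ : ∀ {x y} → x < y → x ≤ y
  <⇒≤ = inj₁

  <-≤-trans : ∀ {x y z} → x < y → y ≤ z → x < z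
  <-≤-trans x<y (inj₁ y<z)  = <-trans x<y y<z
  <-≤-trans x<y (inj₂ refl) = x<y

  ≤-<-trans : ∀ {x y z} → x ≤ y → y < z → x < z
  ≤-<-trans (inj₁ x<y)  y<z = <-trans x<y y<z
  ≤-<-trans (inj₂ refl) y<z = y<z

  ≤-trans : ∀ {x y z} → x ≤ y → y ≤ z → x ≤ z
  ≤-trans x≤y (inj₁ y<z)  = inj₁ (≤-<-trans x≤y y<z)
  ≤-trans x≤y (inj₂ refl) = x≤y

  ≤-antisym : ∀ {x y} → x ≤ y → y ≤ x → x ≡ y
  ≤-antisym (inj₂ x≡y) _          = x≡y
  ≤-antisym (inj₁ _)   (inj₂ y≡x) = sym y≡x
  ≤-antisym (inj₁ x<y) (inj₁ y<x) = contradiction (<-trans x<y y<x) (<-irrefl refl)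

  <⇒≱ : ∀ {x y} → x < y → ¬ (y ≤ x)
  <⇒≱ x<y y≤x = <-irrefl refl (<-≤-trans x<y y≤x)

  <⇒≢ : ∀ {x y} → x < y → x ≢ y
  <⇒≢ x<y refl = <-irrefl refl x<y

  >⇒≢ : ∀ {x y} → y < x → x ≢ y
  >⇒≢ x<y refl = <-irrefl refl x<y

  ≮⇒≥ : ∀ {x y} → ¬ (x < y) → y ≤ x
  ≮⇒≥ {x} {y} x≮y with compare x y
  ... | tri< x<y _ _ = contradiction x<y x≮y
  ... | tri≈ _ x≡y _ = inj₂ (sym x≡y)
  ... | tri> _ _ y<x = inj₁ y<x

  <-≤-total : ∀ x y → x < y ⊎ y ≤ x
  <-≤-total x y with x <? y
  ... | yes x<y = inj₁ x<y
  ... | no  x≮y = inj₂ (≮⇒≥ x≮y)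

  ≤-total : ∀ x y → x ≤ y ⊎ y ≤ x
  ≤-total x y with <-≤-total x y
  ... | inj₁ x<y = inj₁ (<⇒≤ x<y)
  ... | inj₂ y≤x = inj₂ y≤x

  -- Inequalities are proved by exhibiting the difference of the two sides as a
  -- sum of products of quantities of known sign.

  <-by : ∀ {x y} d → 0# < d → y ≡ x + d → x < y
  <-by {x} d 0<d refl = subst₂ _<_ (+-identityˡ x) (+-comm d x) (+-monoˡ-< 0# d x 0<d)

  ≤-by : ∀ {x y} d → 0# ≤ d → y ≡ x + d → x ≤ y
  ≤-by d (inj₁ 0<d)  y≡ = inj₁ (<-by d 0<d y≡)
  ≤-by d (inj₂ refl) y≡ = inj₂ (sym (trans y≡ (+-identityʳ _)))

  x<y⇒0<y-x : ∀ {x y} → x < y → 0# < y - x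
  x<y⇒0<y-x {x} {y} x<y = subst (_< y - x) (-‿inverseʳ x) (+-monoˡ-< x y (- x) x<y)

  x≤y⇒0≤y-x : ∀ {x y} → x ≤ y → 0# ≤ y - x
  x≤y⇒0≤y-x     (inj₁ x<y)  = inj₁ (x<y⇒0<y-x x<y)
  x≤y⇒0≤y-x {x} (inj₂ refl) = inj₂ (sym (-‿inverseʳ x))

  +-mono-≤ : ∀ {w x y z} → w ≤ x → y ≤ z → w + y ≤ x + z
  +-mono-≤ {w} {x} {y} {z} w≤x y≤z = ≤-trans (right w≤x) (left y≤z)
    where
    right : ∀ {w x} → w ≤ x → w + y ≤ x + y
    right (inj₁ w<x)  = inj₁ (+-monoˡ-< _ _ y w<x)
    right (inj₂ refl) = ≤-refl

    left : ∀ {y z} → y ≤ z → x + y ≤ x + z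
    left (inj₁ y<z)  = inj₁ (subst₂ _<_ (+-comm _ x) (+-comm _ x) (+-monoˡ-< _ _ x y<z))
    left (inj₂ refl) = ≤-refl

  +-mono-<-≤ : ∀ {w x y z} → w < x → y ≤ z → w + y < x + z
  +-mono-<-≤ {w} {x} {y} {z} w<x y≤z =
    <-≤-trans (+-monoˡ-< w x y w<x) (+-mono-≤ (≤-refl {x}) y≤z)

  +-mono-≤-< : ∀ {w x y z} → w ≤ x → y < z → w + y < x + z
  +-mono-≤-< {w} {x} {y} {z} w≤x y<z =
    subst₂ _<_ (+-comm y w) (+-comm z x) (+-mono-<-≤ y<z w≤x)

  +-mono-< : ∀ {w x y z} → w < x → y < z → w + y < x + z
  +-mono-< w<x y<z = +-mono-<-≤ w<x (<⇒≤ y<z)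

  +-nonneg : ∀ {x y} → 0# ≤ x → 0# ≤ y → 0# ≤ x + y
  +-nonneg 0≤x 0≤y = subst (_≤ _) (+-identityˡ 0#) (+-mono-≤ 0≤x 0≤y)

  +-pos-nonneg : ∀ {x y} → 0# < x → 0# ≤ y → 0# < x + y
  +-pos-nonneg 0<x 0≤y = subst (_< _) (+-identityˡ 0#) (+-mono-<-≤ 0<x 0≤y)

  +-pos : ∀ {x y} → 0# < x → 0# < y → 0# < x + y
  +-pos 0<x 0<y = +-pos-nonneg 0<x (<⇒≤ 0<y)

  *-nonneg : ∀ {x y} → 0# ≤ x → 0# ≤ y → 0# ≤ x * y
  *-nonneg (inj₁ 0<x)  (inj₁ 0<y)  = inj₁ (*-pos _ _ 0<x 0<y)
  *-nonneg (inj₂ refl) _           = inj₂ (sym (zeroˡ _))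
  *-nonneg (inj₁ _)    (inj₂ refl) = inj₂ (sym (zeroʳ _))

  neg-mono-< : ∀ {x y} → x < y → - y < - x
  neg-mono-< {x} {y} x<y =
    <-by (y - x) (x<y⇒0<y-x x<y) (solve 2 (λ x y → :- x := :- y :+ (y :- x)) refl x y)

  neg-mono-≤ : ∀ {x y} → x ≤ y → - y ≤ - x
  neg-mono-≤ (inj₁ x<y)  = inj₁ (neg-mono-< x<y)
  neg-mono-≤ (inj₂ refl) = ≤-refl

  *-monoˡ-< : ∀ {x y z} → 0# < z → x < y → z * x < z * y
  *-monoˡ-< {x} {y} {z} 0<z x<y = <-by (z * (y - x)) (*-pos _ _ 0<z (x<y⇒0<y-x x<y))
    (solve 3 (λ x y z → z :* y := z :* x :+ z :* (y :- x)) refl x y z)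

  *-monoˡ-≤ : ∀ {x y z} → 0# ≤ z → x ≤ y → z * x ≤ z * y
  *-monoˡ-≤ {x} {y} {z} 0≤z x≤y = ≤-by (z * (y - x)) (*-nonneg 0≤z (x≤y⇒0≤y-x x≤y))
    (solve 3 (λ x y z → z :* y := z :* x :+ z :* (y :- x)) refl x y z)

  *-monoʳ-< : ∀ {x y z} → 0# < z → x < y → x * z < y * z
  *-monoʳ-< {x} {y} {z} 0<z x<y = subst₂ _<_ (*-comm z x) (*-comm z y) (*-monoˡ-< 0<z x<y)

  *-monoʳ-≤ : ∀ {x y z} → 0# ≤ z → x ≤ y → x * z ≤ y * z
  *-monoʳ-≤ {x} {y} {z} 0≤z x≤y = subst₂ _≤_ (*-comm z x) (*-comm z y) (*-monoˡ-≤ 0≤z x≤y)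

  *-mono-≤ : ∀ {w x y z} → 0# ≤ w → 0# ≤ y → w ≤ x → y ≤ z → w * y ≤ x * z
  *-mono-≤ 0≤w 0≤y w≤x y≤z =
    ≤-trans (*-monoʳ-≤ 0≤y w≤x) (*-monoˡ-≤ (≤-trans 0≤w w≤x) y≤z)

  *-cancelˡ-≤ : ∀ {x y z} → 0# < z → z * x ≤ z * y → x ≤ y
  *-cancelˡ-≤ {x} {y} {z} 0<z zx≤zy with <-≤-total y x
  ... | inj₁ y<x = contradiction zx≤zy (<⇒≱ (*-monoˡ-< 0<z y<x))
  ... | inj₂ x≤y = x≤y

  *-cancelˡ-< : ∀ {x y z} → 0# < z → z * x < z * y → x < y
  *-cancelˡ-< {x} {y} {z} 0<z zx<zy with <-≤-total x y
  ... | inj₁ x<y = x<y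
  ... | inj₂ y≤x = contradiction (*-monoˡ-≤ (<⇒≤ 0<z) y≤x) (<⇒≱ zx<zy)

  *-cancelˡ-≡ : ∀ {x y z} → z ≢ 0# → z * x ≡ z * y → x ≡ y
  *-cancelˡ-≡ {x} {y} {z} z≢0 zx≡zy = begin
    x              ≡⟨ undo x ⟩
    z ⁻¹ * (z * x) ≡⟨ cong (z ⁻¹ *_) zx≡zy ⟩
    z ⁻¹ * (z * y) ≡⟨ sym (undo y) ⟩
    y              ∎
    where
    open ≡-Reasoning
    undo : ∀ x → x ≡ z ⁻¹ * (z * x)
    undo x = begin
      x              ≡⟨ sym (*-identityˡ x) ⟩
      1# * x         ≡⟨ cong (_* x) (sym (⁻¹-inverse z z≢0)) ⟩
      z * z ⁻¹ * x   ≡⟨ solve 3 (λ z w x → z :* w :* x := w :* (z :* x)) refl z (z ⁻¹) x ⟩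
      z ⁻¹ * (z * x) ∎

  x²-nonneg : ∀ x → 0# ≤ x * x
  x²-nonneg x with ≤-total 0# x
  ... | inj₁ 0≤x = *-nonneg 0≤x 0≤x
  ... | inj₂ x≤0 = subst (0# ≤_) (solve 1 (λ x → (:0 :- x) :* (:0 :- x) := x :* x) refl x)
                     (*-nonneg (x≤y⇒0≤y-x x≤0) (x≤y⇒0≤y-x x≤0))

  x²-pos : ∀ {x} → x ≢ 0# → 0# < x * x
  x²-pos {x} x≢0 with x²-nonneg x
  ... | inj₁ 0<x² = 0<x²
  ... | inj₂ 0≡x² = contradiction
    (*-cancelˡ-≡ x≢0 (trans (sym 0≡x²) (sym (zeroʳ x)))) x≢0

  ⁻¹-pos : ∀ {x} → 0# < x → 0# < x ⁻¹
  ⁻¹-pos {x} 0<x = *-cancelˡ-< 0<x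
    (subst₂ _<_ (sym (zeroʳ x)) (sym (⁻¹-inverse x (>⇒≢ 0<x))) 0<1)

  /-cancel : ∀ x {y} → y ≢ 0# → y * (x / y) ≡ x
  /-cancel x {y} y≢0 = begin
    y * (x * y ⁻¹) ≡⟨ solve 3 (λ x y w → y :* (x :* w) := (y :* w) :* x) refl x y (y ⁻¹) ⟩
    y * y ⁻¹ * x   ≡⟨ cong (_* x) (⁻¹-inverse y y≢0) ⟩
    1# * x         ≡⟨ *-identityˡ x ⟩
    x              ∎
    where open ≡-Reasoning

  /-unique : ∀ {x y z} → y ≢ 0# → y * z ≡ x → x / y ≡ z
  /-unique {x} y≢0 yz≡x = *-cancelˡ-≡ y≢0 (trans (/-cancel x y≢0) (sym yz≡x))

  /-pos : ∀ {x y} → 0# < x → 0# < y → 0# < x / y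
  /-pos 0<x 0<y = *-pos _ _ 0<x (⁻¹-pos 0<y)

  /-nonneg : ∀ {x y} → 0# ≤ x → 0# < y → 0# ≤ x / y
  /-nonneg 0≤x 0<y = *-nonneg 0≤x (<⇒≤ (⁻¹-pos 0<y))

  2# : ℝ
  2# = 1# + 1#

  0<2 : 0# < 2#
  0<2 = +-pos 0<1 0<1

  half : ℝ → ℝ
  half x = x / 2#

  half-double : ∀ x → half x + half x ≡ x
  half-double x = trans (solve 1 (λ h → h :+ h := :2 :* h) refl (half x))
    (/-cancel x (>⇒≢ 0<2))

  half-pos : ∀ {x} → 0# < x → 0# < half x
  half-pos 0<x = /-pos 0<x 0<2

  half-< : ∀ {x} → 0# < x → half x < x
  half-< {x} 0<x = <-by (half x) (half-pos 0<x) (sym (half-double x))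

  min : ∀ x y → 0# < x → 0# < y → ∃ λ z → 0# < z × z ≤ x × z ≤ y
  min x y 0<x 0<y with ≤-total x y
  ... | inj₁ x≤y = x , 0<x , ≤-refl , x≤y
  ... | inj₂ y≤x = y , 0<y , y≤x , ≤-refl

  -- Absolute value.

  ∣x∣-cases : ∀ x → (x < 0# × ∣ x ∣ ≡ - x) ⊎ (0# ≤ x × ∣ x ∣ ≡ x)
  ∣x∣-cases x with x <? 0#
  ... | yes x<0 = inj₁ (x<0 , refl)
  ... | no  x≮0 = inj₂ (≮⇒≥ x≮0 , refl)

  0<-x : ∀ {x} → x < 0# → 0# < - x
  0<-x {x} x<0 = subst (_< - x) -0#≈0# (neg-mono-< x<0)

  0≤-x : ∀ {x} → x ≤ 0# → 0# ≤ - x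
  0≤-x {x} x≤0 = subst (_≤ - x) -0#≈0# (neg-mono-≤ x≤0)

  -x<0 : ∀ {x} → 0# < x → - x < 0#
  -x<0 {x} 0<x = subst (- x <_) -0#≈0# (neg-mono-< 0<x)

  -x≤0 : ∀ {x} → 0# ≤ x → - x ≤ 0#
  -x≤0 {x} 0≤x = subst (- x ≤_) -0#≈0# (neg-mono-≤ 0≤x)

  ∣x∣-nonneg : ∀ x → 0# ≤ ∣ x ∣
  ∣x∣-nonneg x with ∣x∣-cases x
  ... | inj₁ (x<0 , ∣x∣≡) = subst (0# ≤_) (sym ∣x∣≡) (<⇒≤ (0<-x x<0))
  ... | inj₂ (0≤x , ∣x∣≡) = subst (0# ≤_) (sym ∣x∣≡) 0≤x

  x≤∣x∣ : ∀ x → x ≤ ∣ x ∣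
  x≤∣x∣ x with ∣x∣-cases x
  ... | inj₁ (x<0 , ∣x∣≡) = ≤-trans (<⇒≤ x<0) (∣x∣-nonneg x)
  ... | inj₂ (0≤x , ∣x∣≡) = ≤-reflexive (sym ∣x∣≡)

  -x≤∣x∣ : ∀ x → - x ≤ ∣ x ∣
  -x≤∣x∣ x with ∣x∣-cases x
  ... | inj₁ (x<0 , ∣x∣≡) = ≤-reflexive (sym ∣x∣≡)
  ... | inj₂ (0≤x , ∣x∣≡) = ≤-trans (-x≤0 0≤x) (∣x∣-nonneg x)

  ∣x∣≤ : ∀ {x c} → x ≤ c → - x ≤ c → ∣ x ∣ ≤ c
  ∣x∣≤ {x} x≤c -x≤c with ∣x∣-cases x
  ... | inj₁ (_ , ∣x∣≡) = subst (_≤ _) (sym ∣x∣≡) -x≤c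
  ... | inj₂ (_ , ∣x∣≡) = subst (_≤ _) (sym ∣x∣≡) x≤c

  ∣x∣< : ∀ {x c} → x < c → - x < c → ∣ x ∣ < c
  ∣x∣< {x} x<c -x<c with ∣x∣-cases x
  ... | inj₁ (_ , ∣x∣≡) = subst (_< _) (sym ∣x∣≡) -x<c
  ... | inj₂ (_ , ∣x∣≡) = subst (_< _) (sym ∣x∣≡) x<c

  0≤x⇒∣x∣≡x : ∀ {x} → 0# ≤ x → ∣ x ∣ ≡ x
  0≤x⇒∣x∣≡x {x} 0≤x =
    ≤-antisym (∣x∣≤ ≤-refl (≤-trans (-x≤0 0≤x) 0≤x)) (x≤∣x∣ x)

  ∣-x∣≡∣x∣ : ∀ x → ∣ - x ∣ ≡ ∣ x ∣
  ∣-x∣≡∣x∣ x = ≤-antisym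
    (∣x∣≤ (-x≤∣x∣ x) (subst (_≤ ∣ x ∣) (sym (neg-involutive x)) (x≤∣x∣ x)))
    (∣x∣≤ (subst (_≤ ∣ - x ∣) (neg-involutive x) (-x≤∣x∣ (- x))) (x≤∣x∣ (- x)))

  ∣x+y∣≤∣x∣+∣y∣ : ∀ x y → ∣ x + y ∣ ≤ ∣ x ∣ + ∣ y ∣
  ∣x+y∣≤∣x∣+∣y∣ x y = ∣x∣≤ (+-mono-≤ (x≤∣x∣ x) (x≤∣x∣ y))
    (subst (_≤ ∣ x ∣ + ∣ y ∣) (-‿+-comm x y) (+-mono-≤ (-x≤∣x∣ x) (-x≤∣x∣ y)))

  ∣x*y∣≡∣x∣*∣y∣ : ∀ x y → ∣ x * y ∣ ≡ ∣ x ∣ * ∣ y ∣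
  ∣x*y∣≡∣x∣*∣y∣ x y with ≤-total 0# x | ≤-total 0# y
  ... | inj₁ 0≤x | inj₁ 0≤y =
    trans (0≤x⇒∣x∣≡x (*-nonneg 0≤x 0≤y)) (sym (cong₂ _*_ (0≤x⇒∣x∣≡x 0≤x) (0≤x⇒∣x∣≡x 0≤y)))
  ... | inj₁ 0≤x | inj₂ y≤0 = begin
    ∣ x * y ∣       ≡⟨ sym (∣-x∣≡∣x∣ (x * y)) ⟩
    ∣ - (x * y) ∣   ≡⟨ cong ∣_∣ (-‿distribʳ-* x y) ⟩
    ∣ x * - y ∣     ≡⟨ 0≤x⇒∣x∣≡x (*-nonneg 0≤x (0≤-x y≤0)) ⟩
    x * - y         ≡⟨ sym (cong₂ _*_ (0≤x⇒∣x∣≡x 0≤x) (0≤x⇒∣x∣≡x (0≤-x y≤0))) ⟩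
    ∣ x ∣ * ∣ - y ∣ ≡⟨ cong (∣ x ∣ *_) (∣-x∣≡∣x∣ y) ⟩
    ∣ x ∣ * ∣ y ∣   ∎
    where open ≡-Reasoning
  ... | inj₂ x≤0 | inj₁ 0≤y = begin
    ∣ x * y ∣       ≡⟨ sym (∣-x∣≡∣x∣ (x * y)) ⟩
    ∣ - (x * y) ∣   ≡⟨ cong ∣_∣ (-‿distribˡ-* x y) ⟩
    ∣ - x * y ∣     ≡⟨ 0≤x⇒∣x∣≡x (*-nonneg (0≤-x x≤0) 0≤y) ⟩
    - x * y         ≡⟨ sym (cong₂ _*_ (0≤x⇒∣x∣≡x (0≤-x x≤0)) (0≤x⇒∣x∣≡x 0≤y)) ⟩
    ∣ - x ∣ * ∣ y ∣ ≡⟨ cong (_* ∣ y ∣) (∣-x∣≡∣x∣ x) ⟩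
    ∣ x ∣ * ∣ y ∣   ∎
    where open ≡-Reasoning
  ... | inj₂ x≤0 | inj₂ y≤0 = begin
    ∣ x * y ∣         ≡⟨ cong ∣_∣ (solve 2 (λ x y → x :* y := :- x :* :- y) refl x y) ⟩
    ∣ - x * - y ∣     ≡⟨ 0≤x⇒∣x∣≡x (*-nonneg (0≤-x x≤0) (0≤-x y≤0)) ⟩
    - x * - y         ≡⟨ sym (cong₂ _*_ (0≤x⇒∣x∣≡x (0≤-x x≤0)) (0≤x⇒∣x∣≡x (0≤-x y≤0))) ⟩
    ∣ - x ∣ * ∣ - y ∣ ≡⟨ cong₂ _*_ (∣-x∣≡∣x∣ x) (∣-x∣≡∣x∣ y) ⟩
    ∣ x ∣ * ∣ y ∣     ∎
    where open ≡-Reasoning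

  ∣x∣-pos : ∀ {x} → x ≢ 0# → 0# < ∣ x ∣
  ∣x∣-pos {x} x≢0 with ∣x∣-cases x
  ... | inj₁ (x<0 , ∣x∣≡)       = subst (0# <_) (sym ∣x∣≡) (0<-x x<0)
  ... | inj₂ (inj₁ 0<x , ∣x∣≡)  = subst (0# <_) (sym ∣x∣≡) 0<x
  ... | inj₂ (inj₂ 0≡x , _)     = contradiction (sym 0≡x) x≢0

  -- Natural numbers among the reals and the Archimedean property.

  fromℕ-homo-+ : ∀ m n → fromℕ (m ℕ.+ n) ≡ fromℕ m + fromℕ n
  fromℕ-homo-+ = ×-homo-+ 1#

  fromℕ-homo-* : ∀ m n → fromℕ (m ℕ.* n) ≡ fromℕ m * fromℕ n
  fromℕ-homo-* = ×1-homo-*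

  fromℕ-homo-^ : ∀ m n → fromℕ (m ℕ.^ n) ≡ fromℕ m ^ n
  fromℕ-homo-^ m zero    = +-identityʳ 1#
  fromℕ-homo-^ m (suc n) =
    trans (fromℕ-homo-* m (m ℕ.^ n)) (cong (fromℕ m *_) (fromℕ-homo-^ m n))

  fromℕ-nonneg : ∀ n → 0# ≤ fromℕ n
  fromℕ-nonneg zero    = ≤-refl
  fromℕ-nonneg (suc n) = +-nonneg (<⇒≤ 0<1) (fromℕ-nonneg n)

  fromℕ-pos : ∀ {n} → 0 ℕ.< n → 0# < fromℕ n
  fromℕ-pos {suc n} _ = +-pos-nonneg 0<1 (fromℕ-nonneg n)

  fromℕ-mono-≤ : ∀ {m n} → m ℕ.≤ n → fromℕ m ≤ fromℕ n
  fromℕ-mono-≤ {n = n} z≤n = fromℕ-nonneg n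
  fromℕ-mono-≤ (s≤s m≤n)   = +-mono-≤ ≤-refl (fromℕ-mono-≤ m≤n)

  fromℕ-mono-< : ∀ {m n} → m ℕ.< n → fromℕ m < fromℕ n
  fromℕ-mono-< {m} {n} m<n =
    <-≤-trans (<-by 1# 0<1 (+-comm 1# (fromℕ m))) (fromℕ-mono-≤ m<n)

  fromℕ-cancel-< : ∀ {m n} → fromℕ m < fromℕ n → m ℕ.< n
  fromℕ-cancel-< {m} {n} m<n with ℕ.<-≤-connex m n
  ... | inj₁ lt = lt
  ... | inj₂ ge = contradiction (fromℕ-mono-≤ ge) (<⇒≱ m<n)

  -- If x bounded all naturals, they would have a supremum s; but a natural above s - 1 has its
  -- successor above s.
  archimedean : ∀ x → ∃ λ n → x < fromℕ n
  archimedean x with em {∃ λ n → x < fromℕ n}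
  ... | yes p = p
  ... | no ¬p = contradiction (proj₂ approximant) (<⇒≱ s<approximant+1)
    where
    isNat : ℝ → Set
    isNat y = ∃ λ n → y ≡ fromℕ n

    bounded : ∀ y → isNat y → y ≤ x
    bounded y (n , refl) = ≮⇒≥ (λ x<n → ¬p (n , x<n))

    s,isSup : ∃ (IsSup isNat)
    s,isSup = sup isNat (0# , 0 , refl) (x , bounded)

    s : ℝ
    s = proj₁ s,isSup

    near : ∃ λ y → isNat y × s - 1# < y
    near = proj₂ (proj₂ s,isSup) (s - 1#)
      (<-by 1# 0<1 (solve 1 (λ s → s := s :- :1 :+ :1) refl s))

    n : ℕ
    n = proj₁ (proj₁ (proj₂ near))

    approximant : ∃ λ n → fromℕ (suc n) ≤ s
    approximant = n , proj₁ (proj₂ s,isSup) _ (suc n , refl)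

    s<approximant+1 : s < fromℕ (suc (proj₁ approximant))
    s<approximant+1 = subst₂ _<_
      (solve 1 (λ s → s :- :1 :+ :1 := s) refl s)
      (+-comm (fromℕ n) 1#)
      (+-monoˡ-< _ _ 1# (subst (s - 1# <_) (proj₂ (proj₁ (proj₂ near))) (proj₂ (proj₂ near))))

  choose-spec : ∀ {A : Set} {default : A} {P : A → Set} → ∃ P → P (choose default P)
  choose-spec {P = P} p with em {∃ P}
  ... | yes (_ , Px) = Px
  ... | no ¬p        = contradiction p ¬p

  -- Applies also where existence is left open; the default then has to satisfy the property too.
  choose-elim : ∀ {A : Set} {default : A} {P : A → Set} (Q : A → Set) →
    Q default → (∀ x → P x → Q x) → Q (choose default P)
  choose-elim {P = P} Q Qdefault P⇒Q with em {∃ P}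
  ... | yes (x , Px) = P⇒Q x Px
  ... | no _         = Qdefault

  -- Null sequences and limits.

  -- `Converges u L` is `Null (λ n → u n - L)` by computation, so limits are handled as null
  -- sequences.
  Null : (ℕ → ℝ) → Set
  Null u = ∀ δ → 0# < δ → ∃ λ N → ∀ n → N ℕ.≤ n → ∣ u n ∣ < δ

  null-dominated : ∀ {u v : ℕ → ℝ} K → 0# < K →
    (∃ λ N → ∀ n → N ℕ.≤ n → ∣ v n ∣ ≤ K * ∣ u n ∣) → Null u → Null v
  null-dominated {u} {v} K 0<K (M , v≤Ku) u→0 δ 0<δ with u→0 (δ / K) (/-pos 0<δ 0<K)
  ... | N , u< = M ℕ.⊔ N , λ n M⊔N≤n → begin-strict
    ∣ v n ∣     ≤⟨ v≤Ku n (ℕ.m⊔n≤o⇒m≤o M N M⊔N≤n) ⟩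
    K * ∣ u n ∣ <⟨ *-monoˡ-< 0<K (u< n (ℕ.m⊔n≤o⇒n≤o M N M⊔N≤n)) ⟩
    K * (δ / K) ≡⟨ /-cancel δ (>⇒≢ 0<K) ⟩
    δ           ∎
    where open ≤-Reasoning

  null-+ : ∀ {u v : ℕ → ℝ} → Null u → Null v → Null (λ n → u n + v n)
  null-+ {u} {v} u→0 v→0 δ 0<δ
    with u→0 (half δ) (half-pos 0<δ) | v→0 (half δ) (half-pos 0<δ)
  ... | M , u< | N , v< = M ℕ.⊔ N , λ n M⊔N≤n → begin-strict
    ∣ u n + v n ∣     ≤⟨ ∣x+y∣≤∣x∣+∣y∣ (u n) (v n) ⟩
    ∣ u n ∣ + ∣ v n ∣ <⟨ +-mono-< (u< n (ℕ.m⊔n≤o⇒m≤o M N M⊔N≤n)) (v< n (ℕ.m⊔n≤o⇒n≤o M N M⊔N≤n)) ⟩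
    half δ + half δ   ≡⟨ half-double δ ⟩
    δ                 ∎
    where open ≤-Reasoning

  null-cong : ∀ {u v : ℕ → ℝ} → (∀ n → u n ≡ v n) → Null u → Null v
  null-cong u≡v u→0 δ 0<δ with u→0 δ 0<δ
  ... | N , u< = N , λ n N≤n → subst (λ x → ∣ x ∣ < δ) (u≡v n) (u< n N≤n)

  null-scale : ∀ {u : ℕ → ℝ} c → Null u → Null (λ n → c * u n)
  null-scale {u} c = null-dominated (∣ c ∣ + 1#) (subst (0# <_) (+-comm 1# ∣ c ∣) (+-pos-nonneg 0<1 (∣x∣-nonneg c)))
    (0 , λ n _ → ≤-trans (≤-reflexive (∣x*y∣≡∣x∣*∣y∣ c (u n)))
      (*-monoʳ-≤ (∣x∣-nonneg (u n)) (≤-by 1# (<⇒≤ 0<1) refl)))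

  -- In the expansion of the error, the product of the two individual errors is dominated by one of
  -- them as soon as the other is below 1.
  converges-* : ∀ {u v : ℕ → ℝ} {L M} → Converges u L → Converges v M →
    Converges (λ n → u n * v n) (L * M)
  converges-* {u} {v} {L} {M} u→L v→M = null-cong
    (λ n → solve 4 (λ u v l m → (u :- l) :* (v :- m) :+ (l :* (v :- m) :+ m :* (u :- l)) := u :* v :- l :* m)
      refl (u n) (v n) L M)
    (null-+ (null-dominated 1# 0<1 (N , small) v→M)
            (null-+ (null-scale L v→M) (null-scale M u→L)))
    where
    N = proj₁ (u→L 1# 0<1)
    small : ∀ n → N ℕ.≤ n → ∣ (u n - L) * (v n - M) ∣ ≤ 1# * ∣ v n - M ∣
    small n N≤n = ≤-trans (≤-reflexive (∣x*y∣≡∣x∣*∣y∣ (u n - L) (v n - M)))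
      (*-monoʳ-≤ (∣x∣-nonneg (v n - M)) (<⇒≤ (proj₂ (u→L 1# 0<1) n N≤n)))

  converges-cong-null : ∀ {u v : ℕ → ℝ} {L} → Null (λ n → u n - v n) → Converges u L → Converges v L
  converges-cong-null {u} {v} {L} u-v→0 u→L = null-cong
    (λ n → solve 3 (λ u v l → (u :- l) :+ :- :1 :* (u :- v) := v :- l) refl (u n) (v n) L)
    (null-+ u→L (null-scale (- 1#) u-v→0))

  limit-≤ : ∀ {u : ℕ → ℝ} {L} c → (∃ λ N → ∀ n → N ℕ.≤ n → u n ≤ c) → Converges u L → L ≤ c
  limit-≤ {u} {L} c (M , u≤c) u→L = ≮⇒≥ λ c<L →
    let (N , close) = u→L (L - c) (x<y⇒0<y-x c<L)
        n = M ℕ.⊔ N in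
    <⇒≱ (begin-strict
      L - c       ≤⟨ +-mono-≤ (≤-refl {L}) (neg-mono-≤ (u≤c n (ℕ.m≤m⊔n M N))) ⟩
      L - u n     ≡⟨ solve 2 (λ l u → l :- u := :- (u :- l)) refl L (u n) ⟩
      - (u n - L) ≤⟨ -x≤∣x∣ (u n - L) ⟩
      ∣ u n - L ∣ <⟨ close n (ℕ.m≤n⊔m M N) ⟩
      L - c       ∎) ≤-refl
    where open ≤-Reasoning

  limit-≥ : ∀ {u : ℕ → ℝ} {L} c → (∃ λ N → ∀ n → N ℕ.≤ n → c ≤ u n) → Converges u L → c ≤ L
  limit-≥ {u} {L} c (M , c≤u) u→L = ≮⇒≥ λ L<c →
    let (N , close) = u→L (c - L) (x<y⇒0<y-x L<c)
        n = M ℕ.⊔ N in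
    <⇒≱ (begin-strict
      c - L       ≤⟨ +-mono-≤ (c≤u n (ℕ.m≤m⊔n M N)) ≤-refl ⟩
      u n - L     ≤⟨ x≤∣x∣ (u n - L) ⟩
      ∣ u n - L ∣ <⟨ close n (ℕ.m≤n⊔m M N) ⟩
      c - L       ∎) ≤-refl
    where open ≤-Reasoning

  null-constant : ∀ {c} → Null (λ _ → c) → c ≡ 0#
  null-constant {c} c→0 with c ≟ 0#
  ... | yes c≡0 = c≡0
  ... | no  c≢0 = let (N , c<) = c→0 ∣ c ∣ (∣x∣-pos c≢0) in
    contradiction (c< N ℕ.≤-refl) (<-irrefl refl)

  converges-unique : ∀ {u : ℕ → ℝ} {L M} → Converges u L → Converges u M → L ≡ M
  converges-unique {u} {L} {M} u→L u→M = sym (begin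
    M           ≡⟨ solve 2 (λ l m → m := l :- (l :- m)) refl L M ⟩
    L - (L - M) ≡⟨ cong (λ z → L - z) L-M≡0 ⟩
    L - 0#      ≡⟨ solve 1 (λ l → l :- :0 := l) refl L ⟩
    L           ∎)
    where
    open ≡-Reasoning
    L-M≡0 : L - M ≡ 0#
    L-M≡0 = null-constant (null-cong
      (λ n → solve 3 (λ u l m → (u :- m) :+ :- :1 :* (u :- l) := l :- m) refl (u n) L M)
      (null-+ u→M (null-scale (- 1#) u→L)))

  module _ (u : ℕ → ℝ) (u-step : ∀ n → u n ≤ u (suc n)) where

    monotone : ∀ {m n} → m ℕ.≤ n → u m ≤ u n
    monotone m≤n = go (ℕ.≤⇒≤′ m≤n)
      where
      go : ∀ {m n} → m ℕ.≤′ n → u m ≤ u n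
      go (ℕ.≤′-reflexive refl) = ≤-refl
      go (ℕ.≤′-step m≤n)       = ≤-trans (go m≤n) (u-step _)

    monotone-converges : ∀ {B} → (∀ n → u n ≤ B) → ∃ (Converges u)
    monotone-converges {B} u≤B with sup (λ x → ∃ λ n → x ≡ u n) (u 0 , 0 , refl) (B , λ { _ (n , refl) → u≤B n })
    ... | s , upper , approx = s , u→s
      where
      u→s : Converges u s
      u→s δ 0<δ with approx (s - δ) (<-by δ 0<δ (solve 2 (λ s d → s := s :- d :+ d) refl s δ))
      ... | _ , (N , refl) , s-δ<uN = N , λ n N≤n → ∣x∣<
        (≤-<-trans (≤-by (s - u n) (x≤y⇒0≤y-x (upper (u n) (n , refl)))
          (solve 2 (λ s u → :0 := (u :- s) :+ (s :- u)) refl s (u n))) 0<δ)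
        (<-by (u n - (s - δ)) (x<y⇒0<y-x (<-≤-trans s-δ<uN (monotone N≤n)))
          (solve 3 (λ s u d → d := :- (u :- s) :+ (u :- (s :- d))) refl s (u n) δ))

  -- Partial sums.

  -- Has the shape of the sums in the definition of `exp`, so that those are `∑ n (expTerm x)` by
  -- computation.
  ∑ : ℕ → (ℕ → ℝ) → ℝ
  ∑ n f = sum {n} (f ∘ toℕ)

  ∑-last : ∀ n f → ∑ (suc n) f ≡ ∑ n f + f n
  ∑-last zero    f = +-comm (f 0) 0#
  ∑-last (suc n) f = trans (cong (f 0 +_) (∑-last n (f ∘ suc))) (sym (+-assoc _ _ _))

  ∑-cong : ∀ n {f g : ℕ → ℝ} → (∀ i → f i ≡ g i) → ∑ n f ≡ ∑ n g
  ∑-cong zero    f≡g = refl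
  ∑-cong (suc n) f≡g = cong₂ _+_ (f≡g 0) (∑-cong n (f≡g ∘ suc))

  ∑-step : ∀ {f : ℕ → ℝ} → (∀ i → 0# ≤ f i) → ∀ n → ∑ n f ≤ ∑ (suc n) f
  ∑-step {f} 0≤f n = ≤-by (f n) (0≤f n) (∑-last n f)

  -- Formal power series, given by their coefficients.

  infixl 7 _⊛_
  -- The Cauchy product, by recursion on the left factor, read as its constant coefficient plus X
  -- times the series `f ∘ suc`.
  _⊛_ : (ℕ → ℝ) → (ℕ → ℝ) → ℕ → ℝ
  (f ⊛ g) zero    = f 0 * g 0
  (f ⊛ g) (suc k) = f 0 * g (suc k) + (f ∘ suc ⊛ g) k

  -- The formal derivative.
  D : (ℕ → ℝ) → ℕ → ℝ
  D f i = fromℕ (suc i) * f (suc i)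

  ⊛-cong : ∀ {f f′ g g′ : ℕ → ℝ} → (∀ i → f i ≡ f′ i) → (∀ i → g i ≡ g′ i) →
    ∀ k → (f ⊛ g) k ≡ (f′ ⊛ g′) k
  ⊛-cong f≡ g≡ zero    = cong₂ _*_ (f≡ 0) (g≡ 0)
  ⊛-cong f≡ g≡ (suc k) = cong₂ _+_ (cong₂ _*_ (f≡ 0) (g≡ (suc k))) (⊛-cong (f≡ ∘ suc) g≡ k)

  ⊛-+ˡ : ∀ f f′ g k → ((λ i → f i + f′ i) ⊛ g) k ≡ (f ⊛ g) k + (f′ ⊛ g) k
  ⊛-+ˡ f f′ g zero    = distribʳ (g 0) (f 0) (f′ 0)
  ⊛-+ˡ f f′ g (suc k) = trans
    (cong ((f 0 + f′ 0) * g (suc k) +_) (⊛-+ˡ (f ∘ suc) (f′ ∘ suc) g k))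
    (solve 5 (λ a b c d e → (a :+ b) :* c :+ (d :+ e) := (a :* c :+ d) :+ (b :* c :+ e))
      refl (f 0) (f′ 0) (g (suc k)) ((f ∘ suc ⊛ g) k) ((f′ ∘ suc ⊛ g) k))

  ⊛-scaleˡ : ∀ c f g k → ((λ i → c * f i) ⊛ g) k ≡ c * (f ⊛ g) k
  ⊛-scaleˡ c f g zero    = *-assoc c (f 0) (g 0)
  ⊛-scaleˡ c f g (suc k) = trans
    (cong (c * f 0 * g (suc k) +_) (⊛-scaleˡ c (f ∘ suc) g k))
    (solve 4 (λ c a b d → c :* a :* b :+ c :* d := c :* (a :* b :+ d))
      refl c (f 0) (g (suc k)) ((f ∘ suc ⊛ g) k))

  ⊛-scaleʳ : ∀ c f g k → (f ⊛ (λ i → c * g i)) k ≡ c * (f ⊛ g) k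
  ⊛-scaleʳ c f g zero    = solve 3 (λ c a b → a :* (c :* b) := c :* (a :* b)) refl c (f 0) (g 0)
  ⊛-scaleʳ c f g (suc k) = trans
    (cong (f 0 * (c * g (suc k)) +_) (⊛-scaleʳ c (f ∘ suc) g k))
    (solve 4 (λ c a b d → a :* (c :* b) :+ c :* d := c :* (a :* b :+ d))
      refl c (f 0) (g (suc k)) ((f ∘ suc ⊛ g) k))

  -- Peels the constant coefficient off the left factor: if f is f 0 + X f₁, then its derivative is
  -- f₁ + X times the derivative of f₁, which is `shift-D`.
  ⊛-leibniz : ∀ f g k → D (f ⊛ g) k ≡ (D f ⊛ g) k + (f ⊛ D g) k
  ⊛-leibniz f g zero =
    solve 5 (λ a f₀ f₁ g₀ g₁ → a :* (f₀ :* g₁ :+ f₁ :* g₀) := a :* f₁ :* g₀ :+ f₀ :* (a :* g₁))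
      refl (fromℕ 1) (f 0) (f 1) (g 0) (g 1)
  ⊛-leibniz f g (suc k) = begin
    (1# + K) * (f 0 * g (2+ k) + (f₁ ⊛ g) (suc k))
      ≡⟨ solve 3 (λ K a c → (:1 :+ K) :* (a :+ c) := (:1 :+ K) :* a :+ (c :+ K :* c))
           refl K (f 0 * g (2+ k)) ((f₁ ⊛ g) (suc k)) ⟩
    (1# + K) * (f 0 * g (2+ k)) + ((f₁ ⊛ g) (suc k) + K * (f₁ ⊛ g) (suc k))
      ≡⟨ cong (λ z → (1# + K) * (f 0 * g (2+ k)) + ((f₁ ⊛ g) (suc k) + z)) (⊛-leibniz f₁ g k) ⟩
    (1# + K) * (f 0 * g (2+ k)) + (f 1 * g (suc k) + (f₂ ⊛ g) k + ((D f₁ ⊛ g) k + (f₁ ⊛ D g) k))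
      ≡⟨ solve 8 (λ K f₀ f₁ g₁ g₂ p q r →
           (:1 :+ K) :* (f₀ :* g₂) :+ (f₁ :* g₁ :+ p :+ (q :+ r)) :=
           (:1 :+ :0) :* f₁ :* g₁ :+ (p :+ q) :+ (f₀ :* ((:1 :+ K) :* g₂) :+ r))
           refl K (f 0) (f 1) (g (suc k)) (g (2+ k)) ((f₂ ⊛ g) k) ((D f₁ ⊛ g) k) ((f₁ ⊛ D g) k) ⟩
    fromℕ 1 * f 1 * g (suc k) + ((f₂ ⊛ g) k + (D f₁ ⊛ g) k) + (f 0 * D g (suc k) + (f₁ ⊛ D g) k)
      ≡⟨ cong (λ z → fromℕ 1 * f 1 * g (suc k) + z + (f 0 * D g (suc k) + (f₁ ⊛ D g) k))
           (sym (trans (⊛-cong shift-D (λ _ → refl) k) (⊛-+ˡ f₂ (D f₁) g k))) ⟩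
    (D f ⊛ g) (suc k) + (f ⊛ D g) (suc k) ∎
    where
    open ≡-Reasoning
    f₁ f₂ : ℕ → ℝ
    f₁ = f ∘ suc
    f₂ = f₁ ∘ suc
    K : ℝ
    K = fromℕ (suc k)
    shift-D : ∀ i → D f (suc i) ≡ f₂ i + D f₁ i
    shift-D i = solve 2 (λ a x → (:1 :+ a) :* x := x :+ a :* x) refl (fromℕ (suc i)) (f₂ i)

  -- The sum of f i * T (n ∸ i) over i < n.
  cauchy : (ℕ → ℝ) → (ℕ → ℝ) → ℕ → ℝ
  cauchy f T zero    = 0#
  cauchy f T (suc n) = f 0 * T (suc n) + cauchy (f ∘ suc) T n

  cauchy-step : ∀ f g n → cauchy f (λ k → ∑ k g) (suc n) ≡ cauchy f (λ k → ∑ k g) n + (f ⊛ g) n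
  cauchy-step f g zero    =
    solve 2 (λ a b → a :* (b :+ :0) :+ :0 := :0 :+ a :* b) refl (f 0) (g 0)
  cauchy-step f g (suc n) = begin
    f 0 * ∑ (2+ n) g + cauchy (f ∘ suc) (λ k → ∑ k g) (suc n)
      ≡⟨ cong₂ (λ a b → f 0 * a + b) (∑-last (suc n) g) (cauchy-step (f ∘ suc) g n) ⟩
    f 0 * (∑ (suc n) g + g (suc n)) + (cauchy (f ∘ suc) (λ k → ∑ k g) n + (f ∘ suc ⊛ g) n)
      ≡⟨ solve 5 (λ a b c d e → a :* (b :+ c) :+ (d :+ e) := a :* b :+ d :+ (a :* c :+ e))
           refl (f 0) (∑ (suc n) g) (g (suc n)) (cauchy (f ∘ suc) (λ k → ∑ k g) n) ((f ∘ suc ⊛ g) n) ⟩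
    cauchy f (λ k → ∑ k g) (suc n) + (f ⊛ g) (suc n) ∎
    where open ≡-Reasoning

  -- The products of coefficients with i + j < n, grouped by i.
  ∑-⊛ : ∀ f g n → ∑ n (f ⊛ g) ≡ cauchy f (λ k → ∑ k g) n
  ∑-⊛ f g zero    = refl
  ∑-⊛ f g (suc n) = begin
    ∑ (suc n) (f ⊛ g)                           ≡⟨ ∑-last n (f ⊛ g) ⟩
    ∑ n (f ⊛ g) + (f ⊛ g) n                     ≡⟨ cong (_+ (f ⊛ g) n) (∑-⊛ f g n) ⟩
    cauchy f (λ k → ∑ k g) n + (f ⊛ g) n        ≡⟨ sym (cauchy-step f g n) ⟩
    cauchy f (λ k → ∑ k g) (suc n)              ∎
    where open ≡-Reasoning

  -- The difference on the left is the sum of `f i * (T N - T (n ∸ i))` over i < n, and the one on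
  -- the right is the same for `F` and `T′`; the domination is termwise.
  cauchy-dominated : ∀ N (f F T T′ : ℕ → ℝ) → (∀ i → ∣ f i ∣ ≤ F i) →
    (∀ m → m ℕ.≤ N → ∣ T N - T m ∣ ≤ T′ N - T′ m) →
    ∀ n → n ℕ.≤ N → ∣ ∑ n f * T N - cauchy f T n ∣ ≤ ∑ n F * T′ N - cauchy F T′ n
  cauchy-dominated N f F T T′ f≤F T≤T′ zero _ = ∣x∣≤
    (≤-reflexive (solve 2 (λ a b → :0 :* a :- :0 := :0 :* b :- :0) refl (T N) (T′ N)))
    (≤-reflexive (solve 2 (λ a b → :- (:0 :* a :- :0) := :0 :* b :- :0) refl (T N) (T′ N)))
  cauchy-dominated N f F T T′ f≤F T≤T′ (suc n) n<N = begin
    ∣ ∑ (suc n) f * T N - cauchy f T (suc n) ∣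
      ≡⟨ cong ∣_∣ (split (f 0) (∑ n f₁) (T N) (T (suc n)) (cauchy f₁ T n)) ⟩
    ∣ f 0 * (T N - T (suc n)) + (∑ n f₁ * T N - cauchy f₁ T n) ∣
      ≤⟨ ∣x+y∣≤∣x∣+∣y∣ _ _ ⟩
    ∣ f 0 * (T N - T (suc n)) ∣ + ∣ ∑ n f₁ * T N - cauchy f₁ T n ∣
      ≤⟨ +-mono-≤ head (cauchy-dominated N f₁ F₁ T T′ (f≤F ∘ suc) T≤T′ n (ℕ.<⇒≤ n<N)) ⟩
    F 0 * (T′ N - T′ (suc n)) + (∑ n F₁ * T′ N - cauchy F₁ T′ n)
      ≡⟨ sym (split (F 0) (∑ n F₁) (T′ N) (T′ (suc n)) (cauchy F₁ T′ n)) ⟩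
    ∑ (suc n) F * T′ N - cauchy F T′ (suc n) ∎
    where
    open ≤-Reasoning
    f₁ F₁ : ℕ → ℝ
    f₁ = f ∘ suc
    F₁ = F ∘ suc
    split : ∀ a s t u c → (a + s) * t - (a * u + c) ≡ a * (t - u) + (s * t - c)
    split = solve 5 (λ a s t u c → (a :+ s) :* t :- (a :* u :+ c) := a :* (t :- u) :+ (s :* t :- c)) refl
    head : ∣ f 0 * (T N - T (suc n)) ∣ ≤ F 0 * (T′ N - T′ (suc n))
    head = ≤-trans (≤-reflexive (∣x*y∣≡∣x∣*∣y∣ (f 0) _))
      (*-mono-≤ (∣x∣-nonneg _) (∣x∣-nonneg _) (f≤F 0) (T≤T′ (suc n) n<N))

  module _ (T : ℕ → ℝ) (0≤T : ∀ n → 0# ≤ T n) where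

    cauchy-nonneg : ∀ (f : ℕ → ℝ) → (∀ i → 0# ≤ f i) → ∀ n → 0# ≤ cauchy f T n
    cauchy-nonneg f 0≤f zero    = ≤-refl
    cauchy-nonneg f 0≤f (suc n) = +-nonneg (*-nonneg (0≤f 0) (0≤T _)) (cauchy-nonneg (f ∘ suc) (0≤f ∘ suc) n)

    -- The first n summands on the right evaluate `T` beyond k, and the remaining ones are
    -- nonnegative.
    ∑*≤cauchy : (∀ n → T n ≤ T (suc n)) → ∀ k n (f : ℕ → ℝ) → (∀ i → 0# ≤ f i) →
      ∑ n f * T k ≤ cauchy f T (n ℕ.+ k)
    ∑*≤cauchy T-step k zero    f 0≤f = subst (_≤ cauchy f T k) (sym (zeroˡ (T k))) (cauchy-nonneg f 0≤f k)
    ∑*≤cauchy T-step k (suc n) f 0≤f = begin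
      (f 0 + ∑ n (f ∘ suc)) * T k     ≡⟨ distribʳ _ _ _ ⟩
      f 0 * T k + ∑ n (f ∘ suc) * T k ≤⟨ +-mono-≤
        (*-monoˡ-≤ (0≤f 0) (monotone T T-step (ℕ.m≤n+m k (suc n))))
        (∑*≤cauchy T-step k n (f ∘ suc) (0≤f ∘ suc)) ⟩
      cauchy f T (suc n ℕ.+ k)        ∎
      where open ≤-Reasoning

  -- The exponential function.

  expTerm : ℝ → ℕ → ℝ
  expTerm x i = x ^ i / fromℕ (i !)

  expTerm-zero : ∀ x → expTerm x 0 ≡ 1#
  expTerm-zero x = /-unique (>⇒≢ (fromℕ-pos {1} (s≤s z≤n)))
    (solve 0 ((:1 :+ :0) :* :1 := :1) refl)

  !-pos : ∀ n → 0# < fromℕ (n !)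
  !-pos n = fromℕ-pos (ℕ.>-nonZero⁻¹ (n !) {{n ℕ.!≢0}})

  -- The differential equation of e^(x z), for its coefficients as a series in z.
  D-expTerm : ∀ x i → D (expTerm x) i ≡ x * expTerm x i
  D-expTerm x i = *-cancelˡ-≡ (>⇒≢ (!-pos i)) (begin
    F * (K * (x ^ suc i / fromℕ (suc i !))) ≡⟨ solve 3 (λ f k y → f :* (k :* y) := k :* f :* y) refl F K _ ⟩
    K * F * (x ^ suc i / fromℕ (suc i !))   ≡⟨ cong (_* (x ^ suc i / fromℕ (suc i !))) (sym (fromℕ-homo-* (suc i) (i !))) ⟩
    fromℕ (suc i !) * (x ^ suc i / fromℕ (suc i !))
                                            ≡⟨ /-cancel (x ^ suc i) (>⇒≢ (!-pos (suc i))) ⟩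
    x * x ^ i                               ≡⟨ cong (x *_) (sym (/-cancel (x ^ i) (>⇒≢ (!-pos i)))) ⟩
    x * (F * (x ^ i / F))                   ≡⟨ solve 3 (λ f x y → x :* (f :* y) := f :* (x :* y)) refl F x _ ⟩
    F * (x * (x ^ i / F))                   ∎)
    where
    open ≡-Reasoning
    F K : ℝ
    F = fromℕ (i !)
    K = fromℕ (suc i)

  fromℕ-suc≢0 : ∀ n → fromℕ (suc n) ≢ 0#
  fromℕ-suc≢0 n = >⇒≢ (fromℕ-pos {suc n} (s≤s z≤n))

  -- The binomial theorem: both sides satisfy D h = (x + y) h and h(0) = 1.
  expTerm-+ : ∀ x y k → (expTerm x ⊛ expTerm y) k ≡ expTerm (x + y) k
  expTerm-+ x y zero    = begin
    expTerm x 0 * expTerm y 0 ≡⟨ cong₂ _*_ (expTerm-zero x) (expTerm-zero y) ⟩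
    1# * 1#                   ≡⟨ *-identityˡ 1# ⟩
    1#                        ≡⟨ sym (expTerm-zero (x + y)) ⟩
    expTerm (x + y) 0         ∎
    where open ≡-Reasoning
  expTerm-+ x y (suc k) = *-cancelˡ-≡ (fromℕ-suc≢0 k) (begin
    D (e x ⊛ e y) k                             ≡⟨ ⊛-leibniz (e x) (e y) k ⟩
    (D (e x) ⊛ e y) k + (e x ⊛ D (e y)) k       ≡⟨ cong₂ _+_
      (trans (⊛-cong (D-expTerm x) (λ _ → refl) k) (⊛-scaleˡ x (e x) (e y) k))
      (trans (⊛-cong (λ _ → refl) (D-expTerm y) k) (⊛-scaleʳ y (e x) (e y) k)) ⟩
    x * (e x ⊛ e y) k + y * (e x ⊛ e y) k       ≡⟨ sym (distribʳ _ x y) ⟩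
    (x + y) * (e x ⊛ e y) k                     ≡⟨ cong ((x + y) *_) (expTerm-+ x y k) ⟩
    (x + y) * e (x + y) k                       ≡⟨ sym (D-expTerm (x + y) k) ⟩
    D (e (x + y)) k                             ∎)
    where
    open ≡-Reasoning
    e : ℝ → ℕ → ℝ
    e = expTerm

  ^-nonneg : ∀ {x} → 0# ≤ x → ∀ n → 0# ≤ x ^ n
  ^-nonneg 0≤x zero    = <⇒≤ 0<1
  ^-nonneg 0≤x (suc n) = *-nonneg 0≤x (^-nonneg 0≤x n)

  ∣^∣ : ∀ x n → ∣ x ^ n ∣ ≡ ∣ x ∣ ^ n
  ∣^∣ x zero    = 0≤x⇒∣x∣≡x (<⇒≤ 0<1)
  ∣^∣ x (suc n) = trans (∣x*y∣≡∣x∣*∣y∣ x (x ^ n)) (cong (∣ x ∣ *_) (∣^∣ x n))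

  expTerm-nonneg : ∀ {x} → 0# ≤ x → ∀ n → 0# ≤ expTerm x n
  expTerm-nonneg 0≤x n = /-nonneg (^-nonneg 0≤x n) (!-pos n)

  ∣expTerm∣ : ∀ x n → ∣ expTerm x n ∣ ≡ expTerm ∣ x ∣ n
  ∣expTerm∣ x n = trans (∣x*y∣≡∣x∣*∣y∣ (x ^ n) _)
    (cong₂ _*_ (∣^∣ x n) (0≤x⇒∣x∣≡x (<⇒≤ (⁻¹-pos (!-pos n)))))

  expSum : ℝ → ℕ → ℝ
  expSum x n = ∑ n (expTerm x)

  expSum-step : ∀ {x} → 0# ≤ x → ∀ n → expSum x n ≤ expSum x (suc n)
  expSum-step 0≤x = ∑-step (expTerm-nonneg 0≤x)

  expSum-mono : ∀ {x} → 0# ≤ x → ∀ {m n} → m ℕ.≤ n → expSum x m ≤ expSum x n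
  expSum-mono {x} 0≤x = monotone (expSum x) (expSum-step 0≤x)

  expSum-nonneg : ∀ {x} → 0# ≤ x → ∀ n → 0# ≤ expSum x n
  expSum-nonneg 0≤x n = expSum-mono 0≤x {0} {n} z≤n

  expSum-one : ∀ x → expSum x 1 ≡ 1#
  expSum-one x = trans (cong (_+ 0#) (expTerm-zero x)) (+-identityʳ 1#)

  expSum-0# : ∀ n → expSum 0# (suc n) ≡ 1#
  expSum-0# zero    = expSum-one 0#
  expSum-0# (suc n) = begin
    expSum 0# (2+ n)                      ≡⟨ ∑-last (suc n) (expTerm 0#) ⟩
    expSum 0# (suc n) + expTerm 0# (suc n) ≡⟨ cong₂ _+_ (expSum-0# n)
                                                (solve 2 (λ x y → :0 :* x :* y := :0) refl (0# ^ n) _) ⟩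
    1# + 0#                               ≡⟨ +-identityʳ 1# ⟩
    1#                                    ∎
    where open ≡-Reasoning

  -- Past M > 2 x the tail is at most a geometric series of ratio 1/2. Hence a partial sum plus
  -- twice its next term is non-increasing there, and bounds every partial sum.
  expSum-bounded : ∀ {x} → 0# ≤ x → ∃ λ B → ∀ n → expSum x n ≤ B
  expSum-bounded {x} 0≤x with archimedean (2# * x)
  ... | M , 2x<M = G M , λ n → ≤-trans (expSum-mono 0≤x (ℕ.m≤n+m n M)) (≤-trans
      (≤-by (2# * e (M ℕ.+ n)) (*-nonneg (<⇒≤ 0<2) (expTerm-nonneg 0≤x (M ℕ.+ n))) refl)
      (G-bounded n))
    where
    open ≤-Reasoning
    e : ℕ → ℝ
    e = expTerm x
    -- From n = M on, consecutive terms decrease at least by the factor 2.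
    G : ℕ → ℝ
    G n = expSum x n + 2# * e n
    2e≤e : ∀ n → M ℕ.≤ n → 2# * e (suc n) ≤ e n
    2e≤e n M≤n = *-cancelˡ-≤ (fromℕ-pos {suc n} (s≤s z≤n)) (begin
      fromℕ (suc n) * (2# * e (suc n)) ≡⟨ solve 3 (λ k t y → k :* (t :* y) := t :* (k :* y)) refl (fromℕ (suc n)) 2# (e (suc n)) ⟩
      2# * D e n                       ≡⟨ cong (2# *_) (D-expTerm x n) ⟩
      2# * (x * e n)                   ≡⟨ sym (*-assoc 2# x (e n)) ⟩
      2# * x * e n                     ≤⟨ *-monoʳ-≤ (expTerm-nonneg 0≤x n)
                                           (≤-trans (<⇒≤ 2x<M) (fromℕ-mono-≤ (ℕ.m≤n⇒m≤1+n M≤n))) ⟩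
      fromℕ (suc n) * e n              ∎)
    G-bounded : ∀ n → G (M ℕ.+ n) ≤ G M
    G-bounded zero    = ≤-reflexive (cong G (ℕ.+-identityʳ M))
    G-bounded (suc n) = begin
      G (M ℕ.+ suc n)                          ≡⟨ cong G (ℕ.+-suc M n) ⟩
      expSum x (suc m) + 2# * e (suc m)        ≡⟨ cong (_+ 2# * e (suc m)) (∑-last m e) ⟩
      expSum x m + e m + 2# * e (suc m)        ≤⟨ +-mono-≤ (≤-refl {expSum x m + e m}) (2e≤e m (ℕ.m≤m+n M n)) ⟩
      expSum x m + e m + e m                   ≡⟨ solve 2 (λ s e → s :+ e :+ e := s :+ :2 :* e) refl (expSum x m) (e m) ⟩
      G m                                      ≤⟨ G-bounded n ⟩
      G M                                      ∎
      where
      m : ℕ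
      m = M ℕ.+ n

  expSum-converges⁺ : ∀ {x} → 0# ≤ x → ∃ (Converges (expSum x))
  expSum-converges⁺ {x} 0≤x = monotone-converges (expSum x) (expSum-step 0≤x) (proj₂ (expSum-bounded 0≤x))

  expSum-diff : ∀ x {m n} → m ℕ.≤ n → ∣ expSum x n - expSum x m ∣ ≤ (expSum ∣ x ∣ n) - (expSum ∣ x ∣ m)
  expSum-diff x m≤n = go (ℕ.≤⇒≤′ m≤n)
    where
    open ≤-Reasoning
    go : ∀ {m n} → m ℕ.≤′ n → ∣ expSum x n - expSum x m ∣ ≤ (expSum ∣ x ∣ n) - (expSum ∣ x ∣ m)
    go {m} (ℕ.≤′-reflexive refl) = ∣x∣≤
      (≤-reflexive (trans (-‿inverseʳ _) (sym (-‿inverseʳ _))))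
      (≤-reflexive (trans (solve 1 (λ s → :- (s :- s) := :0) refl (expSum x m)) (sym (-‿inverseʳ _))))
    go {m} (ℕ.≤′-step {n} m≤n) = begin
      ∣ expSum x (suc n) - expSum x m ∣           ≡⟨ cong ∣_∣ (split x) ⟩
      ∣ expSum x n - expSum x m + expTerm x n ∣   ≤⟨ ∣x+y∣≤∣x∣+∣y∣ _ _ ⟩
      ∣ expSum x n - expSum x m ∣ + ∣ expTerm x n ∣
        ≤⟨ +-mono-≤ (go m≤n) (≤-reflexive (∣expTerm∣ x n)) ⟩
      (expSum ∣ x ∣ n) - (expSum ∣ x ∣ m) + (expTerm ∣ x ∣ n) ≡⟨ sym (split ∣ x ∣) ⟩
      (expSum ∣ x ∣ (suc n)) - (expSum ∣ x ∣ m)       ∎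
      where
      split : ∀ x → expSum x (suc n) - expSum x m ≡ expSum x n - expSum x m + expTerm x n
      split x = trans (cong (_- expSum x m) (∑-last n (expTerm x)))
        (solve 3 (λ s e t → s :+ e :- t := s :- t :+ e) refl (expSum x n) (expTerm x n) (expSum x m))

  expSum-+ : ∀ x y n → expSum (x + y) n ≡ cauchy (expTerm x) (expSum y) n
  expSum-+ x y n = trans (∑-cong n (λ k → sym (expTerm-+ x y k))) (∑-⊛ (expTerm x) (expTerm y) n)

  -- The error of the product of two partial sums is dominated by that for ∣ x ∣
  -- and ∣ y ∣, which is at most a stretch of the series of ∣ x ∣ + ∣ y ∣.
  expSum-*-error : ∀ x y n → ∣ expSum x n * expSum y n - expSum (x + y) n ∣ ≤
    expSum (∣ x ∣ + ∣ y ∣) (n ℕ.+ n) - expSum (∣ x ∣ + ∣ y ∣) n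
  expSum-*-error x y n = begin
    ∣ expSum x n * expSum y n - expSum (x + y) n ∣
      ≡⟨ cong (λ z → ∣ expSum x n * expSum y n - z ∣) (expSum-+ x y n) ⟩
    ∣ expSum x n * expSum y n - cauchy (expTerm x) (expSum y) n ∣
      ≤⟨ cauchy-dominated n (expTerm x) (expTerm ∣ x ∣) (expSum y) (expSum ∣ y ∣)
           (λ i → ≤-reflexive (∣expTerm∣ x i)) (λ m m≤n → expSum-diff y m≤n) n ℕ.≤-refl ⟩
    (expSum ∣ x ∣ n) * (expSum ∣ y ∣ n) - cauchy (expTerm ∣ x ∣) (expSum ∣ y ∣) n
      ≤⟨ +-mono-≤ (∑*≤cauchy (expSum ∣ y ∣) (expSum-nonneg (∣x∣-nonneg y)) (expSum-step (∣x∣-nonneg y)) n n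
           (expTerm ∣ x ∣) (expTerm-nonneg (∣x∣-nonneg x))) ≤-refl ⟩
    cauchy (expTerm ∣ x ∣) (expSum ∣ y ∣) (n ℕ.+ n) - cauchy (expTerm ∣ x ∣) (expSum ∣ y ∣) n
      ≡⟨ sym (cong₂ _-_ (expSum-+ ∣ x ∣ ∣ y ∣ (n ℕ.+ n)) (expSum-+ ∣ x ∣ ∣ y ∣ n)) ⟩
    expSum (∣ x ∣ + ∣ y ∣) (n ℕ.+ n) - expSum (∣ x ∣ + ∣ y ∣) n ∎
    where open ≤-Reasoning

  -- The dominating stretch `S (n + n) - S n` is a difference of two sequences with the same limit.
  expSum-*-null : ∀ x y → Null (λ n → expSum x n * expSum y n - expSum (x + y) n)
  expSum-*-null x y = null-dominated 1# 0<1 (0 , dominated) doubled→0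
    where
    a : ℝ
    a = ∣ x ∣ + ∣ y ∣
    S : ℕ → ℝ
    S = expSum a
    0≤a : 0# ≤ a
    0≤a = +-nonneg (∣x∣-nonneg x) (∣x∣-nonneg y)
    doubled→0 : Null (λ n → S (n ℕ.+ n) - S n)
    doubled→0 = null-cong
      (λ n → solve 3 (λ s t l → (s :- l) :+ :- :1 :* (t :- l) := s :- t) refl (S (n ℕ.+ n)) (S n) L)
      (null-+ subsequence (null-scale (- 1#) S→L))
      where
      L : ℝ
      L = proj₁ (expSum-converges⁺ 0≤a)
      S→L : Null (λ n → S n - L)
      S→L = proj₂ (expSum-converges⁺ 0≤a)
      subsequence : Null (λ n → S (n ℕ.+ n) - L)
      subsequence δ 0<δ = proj₁ (S→L δ 0<δ) ,
        λ n N≤n → proj₂ (S→L δ 0<δ) (n ℕ.+ n) (ℕ.≤-trans N≤n (ℕ.m≤m+n n n))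
    dominated : ∀ n → 0 ℕ.≤ n →
      ∣ expSum x n * expSum y n - expSum (x + y) n ∣ ≤ 1# * ∣ S (n ℕ.+ n) - S n ∣
    dominated n _ = ≤-trans (expSum-*-error x y n)
      (≤-trans (x≤∣x∣ (S (n ℕ.+ n) - S n)) (≤-reflexive (sym (*-identityˡ ∣ S (n ℕ.+ n) - S n ∣))))

  -- For x < 0 the product of the partial sums at x and - x tends to 1.
  expSum-converges⁻ : ∀ {x} → x < 0# → ∃ (Converges (expSum x))
  expSum-converges⁻ {x} x<0 = E ⁻¹ , null-dominated 1# 0<1 (1 , dominated) error→0
    where
    open ≤-Reasoning
    E : ℝ
    E = proj₁ (expSum-converges⁺ (<⇒≤ (0<-x x<0)))
    S : ℕ → ℝ
    S = expSum (- x)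
    1≤S : ∀ n → 1 ℕ.≤ n → 1# ≤ S n
    1≤S n 1≤n = subst (_≤ S n) (expSum-one (- x)) (expSum-mono (<⇒≤ (0<-x x<0)) 1≤n)
    S→E : Converges S E
    S→E = proj₂ (expSum-converges⁺ (<⇒≤ (0<-x x<0)))
    0<E : 0# < E
    0<E = <-≤-trans 0<1 (limit-≥ 1# (1 , 1≤S) S→E)
    -- From n = 1 on, where the series at 0 has partial sum 1, this is the distance of `expSum x n`
    -- from `E ⁻¹` times `S n`. As `S n` is at least 1, it dominates that distance.
    error : ℕ → ℝ
    error n = (expSum x n * S n - expSum (x + - x) n) + - (E ⁻¹) * (S n - E)
    error→0 : Null error
    error→0 = null-+ (expSum-*-null x (- x)) (null-scale (- (E ⁻¹)) S→E)
    error≡ : ∀ n → 1 ℕ.≤ n → error n ≡ (expSum x n - E ⁻¹) * S n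
    error≡ (suc n) _ = begin-equality
      error (suc n)
        ≡⟨ cong (λ z → (expSum x (suc n) * S (suc n) - z) + - (E ⁻¹) * (S (suc n) - E))
             (trans (cong (λ z → expSum z (suc n)) (-‿inverseʳ x)) (trans (expSum-0# n) (sym (⁻¹-inverse E (>⇒≢ 0<E))))) ⟩
      expSum x (suc n) * S (suc n) - E * E ⁻¹ + - (E ⁻¹) * (S (suc n) - E)
        ≡⟨ solve 4 (λ t s e i → t :* s :- e :* i :+ :- i :* (s :- e) := (t :- i) :* s)
             refl (expSum x (suc n)) (S (suc n)) E (E ⁻¹) ⟩
      (expSum x (suc n) - E ⁻¹) * S (suc n) ∎
    dominated : ∀ n → 1 ℕ.≤ n → ∣ expSum x n - E ⁻¹ ∣ ≤ 1# * ∣ error n ∣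
    dominated n 1≤n = begin
      ∣ expSum x n - E ⁻¹ ∣              ≡⟨ sym (*-identityʳ _) ⟩
      ∣ expSum x n - E ⁻¹ ∣ * 1#         ≤⟨ *-monoˡ-≤ (∣x∣-nonneg _) (≤-trans (1≤S n 1≤n) (x≤∣x∣ (S n))) ⟩
      ∣ expSum x n - E ⁻¹ ∣ * ∣ S n ∣    ≡⟨ sym (∣x*y∣≡∣x∣*∣y∣ _ (S n)) ⟩
      ∣ (expSum x n - E ⁻¹) * S n ∣      ≡⟨ cong ∣_∣ (sym (error≡ n 1≤n)) ⟩
      ∣ error n ∣                        ≡⟨ sym (*-identityˡ _) ⟩
      1# * ∣ error n ∣                   ∎

  expSum→exp : ∀ x → Converges (expSum x) (exp x)
  expSum→exp x = choose-spec {P = Converges (expSum x)}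
    ([ expSum-converges⁻ , expSum-converges⁺ ]′ (<-≤-total x 0#))

  exp-+ : ∀ x y → exp (x + y) ≡ exp x * exp y
  exp-+ x y = converges-unique {u = expSum (x + y)} (expSum→exp (x + y))
    (converges-cong-null (expSum-*-null x y) (converges-* (expSum→exp x) (expSum→exp y)))

  exp-0# : exp 0# ≡ 1#
  exp-0# = ≤-antisym
    (limit-≤ 1# (1 , λ { (suc n) _ → ≤-reflexive (expSum-0# n) }) (expSum→exp 0#))
    (limit-≥ 1# (1 , λ { (suc n) _ → ≤-reflexive (sym (expSum-0# n)) }) (expSum→exp 0#))

  exp-inverse : ∀ x → exp x * exp (- x) ≡ 1#
  exp-inverse x = trans (sym (exp-+ x (- x))) (trans (cong exp (-‿inverseʳ x)) exp-0#)

  -- e^x is the square of e^(x/2), which is invertible and so nonzero.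
  exp-pos : ∀ x → 0# < exp x
  exp-pos x = subst (0# <_) (trans (sym (exp-+ (half x) (half x))) (cong exp (half-double x)))
    (x²-pos (λ exp≡0 → <-irrefl (begin
      0#                              ≡⟨ sym (zeroˡ _) ⟩
      0# * exp (- half x)             ≡⟨ cong (_* exp (- half x)) (sym exp≡0) ⟩
      exp (half x) * exp (- half x)   ≡⟨ exp-inverse (half x) ⟩
      1#                              ∎) 0<1))
    where open ≡-Reasoning

  -- The last term on the right carries the induction: passing from n to n + 1 replaces e_n by y e_n
  -- = (n + 1) e_(n+1), which is at least e_(n+1).
  1-y*expSum≤1 : ∀ {y} → 0# ≤ y → ∀ n → (1# - y) * expSum y n ≤ 1# - expTerm y n
  1-y*expSum≤1 {y} 0≤y zero    = ≤-reflexive (trans (zeroʳ _)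
    (sym (trans (cong (λ z → 1# - z) (expTerm-zero y)) (-‿inverseʳ 1#))))
  1-y*expSum≤1 {y} 0≤y (suc n) = begin
    (1# - y) * expSum y (suc n)                ≡⟨ cong ((1# - y) *_) (∑-last n (expTerm y)) ⟩
    (1# - y) * (expSum y n + e)                ≡⟨ distribˡ _ _ _ ⟩
    (1# - y) * expSum y n + (1# - y) * e       ≤⟨ +-mono-≤ (1-y*expSum≤1 0≤y n) ≤-refl ⟩
    (1# - e) + (1# - y) * e                    ≡⟨ solve 2 (λ e y → (:1 :- e) :+ (:1 :- y) :* e := :1 :- y :* e) refl e y ⟩
    1# - y * e                                 ≡⟨ cong (λ z → 1# - z) (sym (D-expTerm y n)) ⟩
    1# - (1# + fromℕ n) * e′                   ≤⟨ ≤-by (fromℕ n * e′) (*-nonneg (fromℕ-nonneg n) (expTerm-nonneg 0≤y (suc n)))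
                                                   (solve 2 (λ k e → :1 :- e := :1 :- (:1 :+ k) :* e :+ k :* e) refl (fromℕ n) e′) ⟩
    1# - e′                                    ∎
    where
    open ≤-Reasoning
    e e′ : ℝ
    e  = expTerm y n
    e′ = expTerm y (suc n)

  1-y*exp≤1 : ∀ {y} → 0# ≤ y → y < 1# → (1# - y) * exp y ≤ 1#
  1-y*exp≤1 {y} 0≤y y<1 = subst ((1# - y) * exp y ≤_) (⁻¹-inverse _ (>⇒≢ 0<1-y))
    (*-monoˡ-≤ (<⇒≤ 0<1-y) (limit-≤ ((1# - y) ⁻¹) (0 , bound) (expSum→exp y)))
    where
    0<1-y : 0# < 1# - y
    0<1-y = x<y⇒0<y-x y<1
    bound : ∀ n → 0 ℕ.≤ n → expSum y n ≤ (1# - y) ⁻¹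
    bound n _ = *-cancelˡ-≤ 0<1-y (≤-trans (≤-trans (1-y*expSum≤1 0≤y n)
      (≤-by (expTerm y n) (expTerm-nonneg 0≤y n) (solve 1 (λ e → :1 := :1 :- e :+ e) refl (expTerm y n))))
      (≤-reflexive (sym (⁻¹-inverse _ (>⇒≢ 0<1-y)))))

  -- For x ≥ 0 the first two terms of the series suffice. For -1 < x < 0 the claim is (1 - y) e^y ≤
  -- 1 at y = - x, multiplied by e^x. For x ≤ -1 positivity is enough.
  1+x≤exp : ∀ x → 1# + x ≤ exp x
  1+x≤exp x = [ (λ x<0 → [ negative x<0 , small ]′ (<-≤-total (- 1#) x)) , nonnegative ]′ (<-≤-total x 0#)
    where
    open ≤-Reasoning
    nonnegative : 0# ≤ x → 1# + x ≤ exp x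
    nonnegative 0≤x = limit-≥ (1# + x)
      (2 , λ n 2≤n → subst (_≤ expSum x n) expSum-two (expSum-mono 0≤x 2≤n)) (expSum→exp x)
      where
      expTerm-one : expTerm x 1 ≡ x
      expTerm-one = /-unique (fromℕ-suc≢0 0) (solve 1 (λ x → (:1 :+ :0) :* x := x :* :1) refl x)
      expSum-two : expSum x 2 ≡ 1# + x
      expSum-two = cong₂ _+_ (expTerm-zero x) (trans (+-identityʳ _) expTerm-one)
    negative : x < 0# → - 1# < x → 1# + x ≤ exp x
    negative x<0 -1<x = begin
      1# + x                                ≡⟨ solve 1 (λ x → :1 :+ x := :1 :* (:1 :- :- x)) refl x ⟩
      1# * (1# - - x)                       ≡⟨ cong (_* (1# - - x)) (sym (exp-inverse x)) ⟩
      exp x * exp (- x) * (1# - - x)        ≡⟨ solve 3 (λ a b c → a :* b :* c := a :* (c :* b)) refl (exp x) (exp (- x)) (1# - - x) ⟩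
      exp x * ((1# - - x) * exp (- x))      ≤⟨ *-monoˡ-≤ (<⇒≤ (exp-pos x)) (1-y*exp≤1 (<⇒≤ (0<-x x<0)) -x<1) ⟩
      exp x * 1#                            ≡⟨ *-identityʳ _ ⟩
      exp x                                 ∎
      where
      -x<1 : - x < 1#
      -x<1 = subst (- x <_) (neg-involutive 1#) (neg-mono-< -1<x)
    small : x ≤ - 1# → 1# + x ≤ exp x
    small x≤-1 = begin
      1# + x   ≤⟨ +-mono-≤ ≤-refl x≤-1 ⟩
      1# - 1#  ≡⟨ -‿inverseʳ 1# ⟩
      0#       <⟨ exp-pos x ⟩
      exp x    ∎

  -- Squaring the weak inequality at h = x/2 gains the positive term h^2, provided 1 + h ≥ 0;
  -- otherwise 1 + x is negative.
  1+x<exp : ∀ {x} → x ≢ 0# → 1# + x < exp x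
  1+x<exp {x} x≢0 = [ far , near ]′ (<-≤-total (1# + h) 0#)
    where
    open ≤-Reasoning
    h : ℝ
    h = half x
    h≢0 : h ≢ 0#
    h≢0 h≡0 = x≢0 (trans (sym (half-double x)) (trans (cong₂ _+_ h≡0 h≡0) (+-identityˡ 0#)))
    far : 1# + h < 0# → 1# + x < exp x
    far 1+h<0 = begin-strict
      1# + x                    ≡⟨ cong (1# +_) (sym (half-double x)) ⟩
      1# + (h + h)              <⟨ <-by 1# 0<1 (solve 1 (λ h → (:1 :+ h) :+ (:1 :+ h) := :1 :+ (h :+ h) :+ :1) refl h) ⟩
      (1# + h) + (1# + h)       <⟨ +-mono-< 1+h<0 1+h<0 ⟩
      0# + 0#                   ≡⟨ +-identityˡ 0# ⟩
      0#                        <⟨ exp-pos x ⟩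
      exp x                     ∎
    near : 0# ≤ 1# + h → 1# + x < exp x
    near 0≤1+h = begin-strict
      1# + x              ≡⟨ cong (1# +_) (sym (half-double x)) ⟩
      1# + (h + h)        <⟨ <-by (h * h) (x²-pos h≢0)
                               (solve 1 (λ h → (:1 :+ h) :* (:1 :+ h) := :1 :+ (h :+ h) :+ h :* h) refl h) ⟩
      (1# + h) * (1# + h) ≤⟨ *-mono-≤ 0≤1+h 0≤1+h (1+x≤exp h) (1+x≤exp h) ⟩
      exp h * exp h       ≡⟨ trans (sym (exp-+ h h)) (cong exp (half-double x)) ⟩
      exp x               ∎

  exp-neg : ∀ x → exp (- x) * exp x ≡ 1#
  exp-neg x = trans (*-comm _ _) (exp-inverse x)

  exp-mono-< : ∀ {x y} → x < y → exp x < exp y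
  exp-mono-< {x} {y} x<y = begin-strict
    exp x                   ≡⟨ sym (*-identityʳ _) ⟩
    exp x * 1#              <⟨ *-monoˡ-< (exp-pos x) 1<exp ⟩
    exp x * exp (y - x)     ≡⟨ sym (exp-+ x (y - x)) ⟩
    exp (x + (y - x))       ≡⟨ cong exp (solve 2 (λ x y → x :+ (y :- x) := y) refl x y) ⟩
    exp y                   ∎
    where
    open ≤-Reasoning
    1<exp : 1# < exp (y - x)
    1<exp = <-≤-trans (<-by (y - x) (x<y⇒0<y-x x<y) refl) (1+x≤exp (y - x))

  exp-mono-≤ : ∀ {x y} → x ≤ y → exp x ≤ exp y
  exp-mono-≤ (inj₁ x<y)  = inj₁ (exp-mono-< x<y)
  exp-mono-≤ (inj₂ refl) = inj₂ refl

  exp-cancel-≤ : ∀ {x y} → exp x ≤ exp y → x ≤ y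
  exp-cancel-≤ ex≤ey = ≮⇒≥ λ y<x → <⇒≱ (exp-mono-< y<x) ex≤ey

  exp-cancel-< : ∀ {x y} → exp x < exp y → x < y
  exp-cancel-< {x} {y} ex<ey = [ id , (λ y≤x → contradiction (exp-mono-≤ y≤x) (<⇒≱ ex<ey)) ]′ (<-≤-total x y)

  exp-injective : ∀ {x y} → exp x ≡ exp y → x ≡ y
  exp-injective eq = ≤-antisym (exp-cancel-≤ (inj₂ eq)) (exp-cancel-≤ (inj₂ (sym eq)))

  [1-h]exp≤1 : ∀ h → (1# - h) * exp h ≤ 1#
  [1-h]exp≤1 h = begin
    (1# - h) * exp h      ≤⟨ *-monoʳ-≤ (<⇒≤ (exp-pos h)) (1+x≤exp (- h)) ⟩
    exp (- h) * exp h     ≡⟨ exp-neg h ⟩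
    1#                    ∎
    where open ≤-Reasoning

  -- For h ≤ 1/2 the upper bound comes from e^h ≤ 1 / (1 - h) and (1 - h)(1 + h + 2 h^2) = 1 + h^2
  -- (1 - 2 h).
  exp-quadratic : ∀ {h} → 2# * h ≤ 1# → ∣ exp h - 1# - h ∣ ≤ 2# * (h * h)
  exp-quadratic {h} 2h≤1 = subst (_≤ 2# * (h * h)) (sym (0≤x⇒∣x∣≡x lower)) upper
    where
    open ≤-Reasoning
    lower : 0# ≤ exp h - 1# - h
    lower = subst (0# ≤_) (solve 2 (λ e h → e :- (:1 :+ h) := e :- :1 :- h) refl (exp h) h) (x≤y⇒0≤y-x (1+x≤exp h))
    0<1-h : 0# < 1# - h
    0<1-h = *-cancelˡ-< 0<2 (begin-strict
      2# * 0#           ≡⟨ zeroʳ 2# ⟩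
      0#                <⟨ 0<1 ⟩
      1#                ≤⟨ ≤-by (1# - 2# * h) (x≤y⇒0≤y-x 2h≤1)
                             (solve 1 (λ h → :2 :* (:1 :- h) := :1 :+ (:1 :- :2 :* h)) refl h) ⟩
      2# * (1# - h)     ∎)
    upper′ : exp h ≤ 1# + h + 2# * (h * h)
    upper′ = *-cancelˡ-≤ 0<1-h (begin
      (1# - h) * exp h  ≤⟨ [1-h]exp≤1 h ⟩
      1#                ≤⟨ ≤-by (h * h * (1# - 2# * h)) (*-nonneg (x²-nonneg h) (x≤y⇒0≤y-x 2h≤1))
                             (solve 1 (λ h → (:1 :- h) :* (:1 :+ h :+ :2 :* (h :* h)) := :1 :+ h :* h :* (:1 :- :2 :* h)) refl h) ⟩
      (1# - h) * (1# + h + 2# * (h * h)) ∎)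
    upper : exp h - 1# - h ≤ 2# * (h * h)
    upper = ≤-by (1# + h + 2# * (h * h) - exp h) (x≤y⇒0≤y-x upper′)
      (solve 2 (λ e h → :2 :* (h :* h) := e :- :1 :- h :+ (:1 :+ h :+ :2 :* (h :* h) :- e)) refl (exp h) h)

  -- Calculus with explicit error bounds.

  -- Lipschitz at the point x only: this gives the continuity used for intermediate values, and sums
  -- and products pass it on with explicit constants.
  record LipschitzAt (f : ℝ → ℝ) (x : ℝ) : Set where
    constructor lipschitz
    field
      K     : ℝ
      0≤K   : 0# ≤ K
      δ     : ℝ
      0<δ   : 0# < δ
      bound : ∀ h → ∣ h ∣ < δ → ∣ f (x + h) - f x ∣ ≤ K * ∣ h ∣

  -- A first-order expansion with quadratic error, stated without a quotient. The exponential series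
  -- provides it, and sums and constant multiples preserve it.
  record HasDerivAt² (f : ℝ → ℝ) (x D : ℝ) : Set where
    constructor derivative
    field
      K     : ℝ
      0≤K   : 0# ≤ K
      δ     : ℝ
      0<δ   : 0# < δ
      bound : ∀ h → ∣ h ∣ < δ → ∣ f (x + h) - f x - h * D ∣ ≤ K * (h * h)

  ∣h∣²≡h² : ∀ h → ∣ h ∣ * ∣ h ∣ ≡ h * h
  ∣h∣²≡h² h = trans (sym (∣x*y∣≡∣x∣*∣y∣ h h)) (0≤x⇒∣x∣≡x (x²-nonneg h))

  ∣0∣≡0 : ∣ 0# ∣ ≡ 0#
  ∣0∣≡0 = 0≤x⇒∣x∣≡x ≤-refl

  deriv²⇒deriv : ∀ {f x D} → HasDerivAt² f x D → HasDerivAt f x D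
  deriv²⇒deriv {f} {x} {D} (derivative K 0≤K δ 0<δ bound) ε 0<ε =
    proj₁ m , proj₁ (proj₂ m) , quotient
    where
    open ≤-Reasoning
    0<K+1 : 0# < K + 1#
    0<K+1 = subst (0# <_) (+-comm 1# K) (+-pos-nonneg 0<1 0≤K)
    m : ∃ λ r → 0# < r × r ≤ δ × r ≤ ε / (K + 1#)
    m = min δ (ε / (K + 1#)) 0<δ (/-pos 0<ε 0<K+1)
    quotient : ∀ h → h ≢ 0# → ∣ h ∣ < proj₁ m → ∣ (f (x + h) - f x) / h - D ∣ < ε
    quotient h h≢0 ∣h∣<r = ≤-<-trans (*-cancelˡ-≤ 0<∣h∣ (begin
      ∣ h ∣ * ∣ (f (x + h) - f x) / h - D ∣   ≡⟨ sym (∣x*y∣≡∣x∣*∣y∣ h _) ⟩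
      ∣ h * ((f (x + h) - f x) / h - D) ∣     ≡⟨ cong ∣_∣ (trans (solve 3 (λ h q d → h :* (q :- d) := h :* q :- h :* d) refl h ((f (x + h) - f x) / h) D)
                                                    (cong (_- h * D) (/-cancel (f (x + h) - f x) h≢0))) ⟩
      ∣ f (x + h) - f x - h * D ∣             ≤⟨ bound h (<-≤-trans ∣h∣<r (proj₁ (proj₂ (proj₂ m)))) ⟩
      K * (h * h)                             ≡⟨ cong (K *_) (sym (∣h∣²≡h² h)) ⟩
      K * (∣ h ∣ * ∣ h ∣)                     ≡⟨ solve 2 (λ k a → k :* (a :* a) := a :* (k :* a)) refl K (∣ h ∣) ⟩
      ∣ h ∣ * (K * ∣ h ∣)                     ∎)) (begin-strict
      K * ∣ h ∣                               ≤⟨ ≤-by ∣ h ∣ (∣x∣-nonneg h) (solve 2 (λ k a → (k :+ :1) :* a := k :* a :+ a) refl K ∣ h ∣) ⟩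
      (K + 1#) * ∣ h ∣                        <⟨ *-monoˡ-< 0<K+1 (<-≤-trans ∣h∣<r (proj₂ (proj₂ (proj₂ m)))) ⟩
      (K + 1#) * (ε / (K + 1#))               ≡⟨ /-cancel ε (>⇒≢ 0<K+1) ⟩
      ε                                       ∎)
      where
      0<∣h∣ : 0# < ∣ h ∣
      0<∣h∣ = ∣x∣-pos h≢0

  -- `deriv` is defined by choice, and uniqueness identifies its value. With half the gap as
  -- tolerance, a single difference quotient would have to be close to both candidates.
  deriv-unique : ∀ {f x D D′} → HasDerivAt f x D → HasDerivAt f x D′ → D ≡ D′
  deriv-unique {f} {x} {D} {D′} hasD hasD′ = ≤-antisym (≤-half hasD hasD′) (≤-half hasD′ hasD)
    where
    open ≤-Reasoning
    ≤-half : ∀ {D D′} → HasDerivAt f x D → HasDerivAt f x D′ → D ≤ D′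
    ≤-half {D} {D′} hasD hasD′ = ≮⇒≥ λ D′<D →
      let ε = half (D - D′)
          0<ε = half-pos (x<y⇒0<y-x D′<D)
          (δ , 0<δ , close) = hasD ε 0<ε
          (δ′ , 0<δ′ , close′) = hasD′ ε 0<ε
          (r , 0<r , r≤δ , r≤δ′) = min δ δ′ 0<δ 0<δ′
          h = half r
          0<h = half-pos 0<r
          ∣h∣<r = subst (_< r) (sym (0≤x⇒∣x∣≡x (<⇒≤ 0<h))) (half-< 0<r)
          q = (f (x + h) - f x) / h
      in <⇒≱ (begin-strict
        D - D′                  ≡⟨ solve 3 (λ a b q → a :- b := :- (q :- a) :+ (q :- b)) refl D D′ q ⟩
        - (q - D) + (q - D′)    ≤⟨ +-mono-≤ (-x≤∣x∣ (q - D)) (x≤∣x∣ (q - D′)) ⟩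
        ∣ q - D ∣ + ∣ q - D′ ∣  <⟨ +-mono-< (close h (>⇒≢ 0<h) (<-≤-trans ∣h∣<r r≤δ)) (close′ h (>⇒≢ 0<h) (<-≤-trans ∣h∣<r r≤δ′)) ⟩
        ε + ε                   ≡⟨ half-double (D - D′) ⟩
        D - D′                  ∎) ≤-refl

  deriv≡ : ∀ {f x D} → HasDerivAt² f x D → deriv f x ≡ D
  deriv≡ {f} {x} {D} hasD = deriv-unique {f}
    (choose-spec {P = HasDerivAt f x} (D , deriv²⇒deriv hasD)) (deriv²⇒deriv hasD)

  deriv²⇒lipschitz : ∀ {f x D} → HasDerivAt² f x D → LipschitzAt f x
  deriv²⇒lipschitz {f} {x} {D} (derivative K 0≤K δ 0<δ bound) =
    lipschitz (K + ∣ D ∣) (+-nonneg 0≤K (∣x∣-nonneg D)) r 0<r λ h ∣h∣<r → begin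
      ∣ f (x + h) - f x ∣                       ≡⟨ cong ∣_∣ (solve 3 (λ a b c → a :- b := a :- b :- c :+ c) refl (f (x + h)) (f x) (h * D)) ⟩
      ∣ f (x + h) - f x - h * D + h * D ∣       ≤⟨ ∣x+y∣≤∣x∣+∣y∣ _ _ ⟩
      ∣ f (x + h) - f x - h * D ∣ + ∣ h * D ∣   ≤⟨ +-mono-≤ (bound h (<-≤-trans ∣h∣<r r≤δ)) (≤-reflexive (∣x*y∣≡∣x∣*∣y∣ h D)) ⟩
      K * (h * h) + ∣ h ∣ * ∣ D ∣               ≡⟨ cong (λ z → K * z + ∣ h ∣ * ∣ D ∣) (sym (∣h∣²≡h² h)) ⟩
      K * (∣ h ∣ * ∣ h ∣) + ∣ h ∣ * ∣ D ∣       ≤⟨ +-mono-≤ (*-monoˡ-≤ 0≤K (≤-trans (*-monoˡ-≤ (∣x∣-nonneg h) (≤-trans (<⇒≤ ∣h∣<r) r≤1)) (≤-reflexive (*-identityʳ _)))) ≤-refl ⟩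
      K * ∣ h ∣ + ∣ h ∣ * ∣ D ∣                 ≡⟨ solve 3 (λ k h d → k :* h :+ h :* d := (k :+ d) :* h) refl K (∣ h ∣) (∣ D ∣) ⟩
      (K + ∣ D ∣) * ∣ h ∣                       ∎
    where
    open ≤-Reasoning
    m : ∃ λ r → 0# < r × r ≤ δ × r ≤ 1#
    m = min δ 1# 0<δ 0<1
    r  = proj₁ m
    0<r = proj₁ (proj₂ m)
    r≤δ = proj₁ (proj₂ (proj₂ m))
    r≤1 = proj₂ (proj₂ (proj₂ m))

  deriv²-0 : ∀ {x} → HasDerivAt² (λ _ → 0#) x 0#
  deriv²-0 = derivative 0# ≤-refl 1# 0<1 λ h _ → ≤-reflexive
    (trans (cong ∣_∣ (solve 1 (λ h → :0 :- :0 :- h :* :0 := :0) refl h)) (trans ∣0∣≡0 (sym (zeroˡ _))))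

  deriv²-+ : ∀ {f g x D E} → HasDerivAt² f x D → HasDerivAt² g x E →
    HasDerivAt² (λ y → f y + g y) x (D + E)
  deriv²-+ {f} {g} {x} {D} {E} (derivative K 0≤K δ 0<δ bound) (derivative L 0≤L δ′ 0<δ′ bound′) =
    derivative (K + L) (+-nonneg 0≤K 0≤L) (proj₁ m) (proj₁ (proj₂ m)) λ h ∣h∣<r → begin
      ∣ f (x + h) + g (x + h) - (f x + g x) - h * (D + E) ∣
        ≡⟨ cong ∣_∣ (solve 7 (λ a b c d h D E → a :+ b :- (c :+ d) :- h :* (D :+ E) :=
             a :- c :- h :* D :+ (b :- d :- h :* E)) refl (f (x + h)) (g (x + h)) (f x) (g x) h D E) ⟩
      ∣ f (x + h) - f x - h * D + (g (x + h) - g x - h * E) ∣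
        ≤⟨ ∣x+y∣≤∣x∣+∣y∣ _ _ ⟩
      ∣ f (x + h) - f x - h * D ∣ + ∣ g (x + h) - g x - h * E ∣
        ≤⟨ +-mono-≤ (bound h (<-≤-trans ∣h∣<r (proj₁ (proj₂ (proj₂ m)))))
                    (bound′ h (<-≤-trans ∣h∣<r (proj₂ (proj₂ (proj₂ m))))) ⟩
      K * (h * h) + L * (h * h)
        ≡⟨ sym (distribʳ _ K L) ⟩
      (K + L) * (h * h) ∎
    where
    open ≤-Reasoning
    m : ∃ λ r → 0# < r × r ≤ δ × r ≤ δ′
    m = min δ δ′ 0<δ 0<δ′

  deriv²-scale : ∀ {f x D} c → HasDerivAt² f x D → HasDerivAt² (λ y → c * f y) x (c * D)
  deriv²-scale {f} {x} {D} c (derivative K 0≤K δ 0<δ bound) =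
    derivative (∣ c ∣ * K) (*-nonneg (∣x∣-nonneg c) 0≤K) δ 0<δ λ h ∣h∣<δ → begin
      ∣ c * f (x + h) - c * f x - h * (c * D) ∣
        ≡⟨ cong ∣_∣ (solve 5 (λ c a b h d → c :* a :- c :* b :- h :* (c :* d) := c :* (a :- b :- h :* d)) refl c (f (x + h)) (f x) h D) ⟩
      ∣ c * (f (x + h) - f x - h * D) ∣      ≡⟨ ∣x*y∣≡∣x∣*∣y∣ c _ ⟩
      ∣ c ∣ * ∣ f (x + h) - f x - h * D ∣    ≤⟨ *-monoˡ-≤ (∣x∣-nonneg c) (bound h ∣h∣<δ) ⟩
      ∣ c ∣ * (K * (h * h))                  ≡⟨ sym (*-assoc _ _ _) ⟩
      ∣ c ∣ * K * (h * h)                    ∎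
    where open ≤-Reasoning

  deriv²-sum : ∀ {n} {f : Fin n → ℝ → ℝ} {D : Fin n → ℝ} {x} → (∀ i → HasDerivAt² (f i) x (D i)) →
    HasDerivAt² (λ y → sum (λ i → f i y)) x (sum D)
  deriv²-sum {zero}  hasD = deriv²-0
  deriv²-sum {suc n} hasD = deriv²-+ (hasD Fin.zero) (deriv²-sum (hasD ∘ Fin.suc))

  deriv²-exp : ∀ c x → HasDerivAt² (λ y → exp (y * c)) x (c * exp (x * c))
  deriv²-exp c x = derivative (e * 2# * (c * c)) (*-nonneg (*-nonneg 0≤e (<⇒≤ 0<2)) (x²-nonneg c))
    -- This radius ensures 2 h c ≤ 1, as `exp-quadratic` requires; the 1 added to `∣ c ∣` covers c =
    -- 0.
    (2a ⁻¹) (⁻¹-pos 0<2a) λ h ∣h∣<δ → begin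
      ∣ exp ((x + h) * c) - e - h * (c * e) ∣
        ≡⟨ cong ∣_∣ (trans (cong (λ z → z - e - h * (c * e)) (trans (cong exp (distribʳ c x h)) (exp-+ (x * c) (h * c))))
             (solve 4 (λ e d h c → e :* d :- e :- h :* (c :* e) := e :* (d :- :1 :- h :* c)) refl e (exp (h * c)) h c)) ⟩
      ∣ e * (exp (h * c) - 1# - h * c) ∣     ≡⟨ ∣x*y∣≡∣x∣*∣y∣ e _ ⟩
      ∣ e ∣ * ∣ exp (h * c) - 1# - h * c ∣   ≡⟨ cong (_* ∣ exp (h * c) - 1# - h * c ∣) (0≤x⇒∣x∣≡x 0≤e) ⟩
      e * ∣ exp (h * c) - 1# - h * c ∣       ≤⟨ *-monoˡ-≤ 0≤e (exp-quadratic (2hc≤1 h (<⇒≤ ∣h∣<δ))) ⟩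
      e * (2# * (h * c * (h * c)))           ≡⟨ solve 3 (λ e h c → e :* (:2 :* (h :* c :* (h :* c))) := e :* :2 :* (c :* c) :* (h :* h)) refl e h c ⟩
      e * 2# * (c * c) * (h * h)             ∎
    where
    open ≤-Reasoning
    e 2a : ℝ
    e = exp (x * c)
    2a = 2# * (∣ c ∣ + 1#)
    0≤e : 0# ≤ e
    0≤e = <⇒≤ (exp-pos (x * c))
    0<2a : 0# < 2a
    0<2a = *-pos _ _ 0<2 (subst (0# <_) (+-comm 1# ∣ c ∣) (+-pos-nonneg 0<1 (∣x∣-nonneg c)))
    2hc≤1 : ∀ h → ∣ h ∣ ≤ 2a ⁻¹ → 2# * (h * c) ≤ 1#
    2hc≤1 h ∣h∣≤ = begin
      2# * (h * c)                 ≤⟨ *-monoˡ-≤ (<⇒≤ 0<2) (≤-trans (x≤∣x∣ (h * c)) (≤-reflexive (∣x*y∣≡∣x∣*∣y∣ h c))) ⟩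
      2# * (∣ h ∣ * ∣ c ∣)         ≤⟨ *-monoˡ-≤ (<⇒≤ 0<2) (*-monoˡ-≤ (∣x∣-nonneg h) (≤-by 1# (<⇒≤ 0<1) refl)) ⟩
      2# * (∣ h ∣ * (∣ c ∣ + 1#))  ≡⟨ solve 3 (λ t h c → t :* (h :* c) := t :* c :* h) refl 2# (∣ h ∣) (∣ c ∣ + 1#) ⟩
      2a * ∣ h ∣                   ≤⟨ *-monoˡ-≤ (<⇒≤ 0<2a) ∣h∣≤ ⟩
      2a * 2a ⁻¹                   ≡⟨ ⁻¹-inverse 2a (>⇒≢ 0<2a) ⟩
      1#                           ∎

  lipschitz-const : ∀ {c x} → LipschitzAt (λ _ → c) x
  lipschitz-const {c} = lipschitz 0# ≤-refl 1# 0<1 λ h _ → ≤-reflexive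
    (trans (cong ∣_∣ (-‿inverseʳ c)) (trans ∣0∣≡0 (sym (zeroˡ _))))

  lipschitz-id : ∀ {x} → LipschitzAt (λ y → y) x
  lipschitz-id {x} = lipschitz 1# (<⇒≤ 0<1) 1# 0<1 λ h _ → ≤-reflexive
    (trans (cong ∣_∣ (solve 2 (λ x h → x :+ h :- x := h) refl x h)) (sym (*-identityˡ _)))

  lipschitz-+ : ∀ {f g x} → LipschitzAt f x → LipschitzAt g x → LipschitzAt (λ y → f y + g y) x
  lipschitz-+ {f} {g} {x} (lipschitz K 0≤K δ 0<δ bound) (lipschitz L 0≤L δ′ 0<δ′ bound′) =
    lipschitz (K + L) (+-nonneg 0≤K 0≤L) (proj₁ m) (proj₁ (proj₂ m)) λ h ∣h∣<r → begin
      ∣ f (x + h) + g (x + h) - (f x + g x) ∣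
        ≡⟨ cong ∣_∣ (solve 4 (λ a b c d → a :+ b :- (c :+ d) := a :- c :+ (b :- d)) refl (f (x + h)) (g (x + h)) (f x) (g x)) ⟩
      ∣ f (x + h) - f x + (g (x + h) - g x) ∣     ≤⟨ ∣x+y∣≤∣x∣+∣y∣ _ _ ⟩
      ∣ f (x + h) - f x ∣ + ∣ g (x + h) - g x ∣
        ≤⟨ +-mono-≤ (bound h (<-≤-trans ∣h∣<r (proj₁ (proj₂ (proj₂ m)))))
                    (bound′ h (<-≤-trans ∣h∣<r (proj₂ (proj₂ (proj₂ m))))) ⟩
      K * ∣ h ∣ + L * ∣ h ∣                       ≡⟨ sym (distribʳ _ K L) ⟩
      (K + L) * ∣ h ∣                             ∎
    where
    open ≤-Reasoning
    m : ∃ λ r → 0# < r × r ≤ δ × r ≤ δ′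
    m = min δ δ′ 0<δ 0<δ′

  lipschitz-* : ∀ {f g x} → LipschitzAt f x → LipschitzAt g x → LipschitzAt (λ y → f y * g y) x
  lipschitz-* {f} {g} {x} (lipschitz K 0≤K δ 0<δ bound) (lipschitz L 0≤L δ′ 0<δ′ bound′) =
    lipschitz (K * L + ∣ f x ∣ * L + ∣ g x ∣ * K)
      (+-nonneg (+-nonneg (*-nonneg 0≤K 0≤L) (*-nonneg (∣x∣-nonneg _) 0≤L)) (*-nonneg (∣x∣-nonneg _) 0≤K))
      (proj₁ r) (proj₁ (proj₂ r))
      λ h ∣h∣<r → product-bound h (f (x + h)) (g (x + h))
        (≤-trans (<⇒≤ ∣h∣<r) (proj₂ (proj₂ (proj₂ r))))
        (bound h (<-≤-trans (<-≤-trans ∣h∣<r (proj₁ (proj₂ (proj₂ r)))) (proj₁ (proj₂ (proj₂ m)))))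
        (bound′ h (<-≤-trans (<-≤-trans ∣h∣<r (proj₁ (proj₂ (proj₂ r)))) (proj₂ (proj₂ (proj₂ m)))))
    where
    open ≤-Reasoning
    m : ∃ λ r → 0# < r × r ≤ δ × r ≤ δ′
    m = min δ δ′ 0<δ 0<δ′
    r : ∃ λ r → 0# < r × r ≤ proj₁ m × r ≤ 1#
    r = min (proj₁ m) 1# (proj₁ (proj₂ m)) 0<1
    product-bound : ∀ h u v → ∣ h ∣ ≤ 1# → ∣ u - f x ∣ ≤ K * ∣ h ∣ → ∣ v - g x ∣ ≤ L * ∣ h ∣ →
      ∣ u * v - f x * g x ∣ ≤ (K * L + ∣ f x ∣ * L + ∣ g x ∣ * K) * ∣ h ∣
    product-bound h u v ∣h∣≤1 f-bound g-bound = begin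
      ∣ u * v - f x * g x ∣
        ≡⟨ cong ∣_∣ (solve 4 (λ a b c d → a :* b :- c :* d := (a :- c) :* (b :- d) :+ c :* (b :- d) :+ d :* (a :- c))
             refl u v (f x) (g x)) ⟩
      ∣ Δf * Δg + f x * Δg + g x * Δf ∣
        ≤⟨ ≤-trans (∣x+y∣≤∣x∣+∣y∣ (Δf * Δg + f x * Δg) (g x * Δf)) (+-mono-≤ (∣x+y∣≤∣x∣+∣y∣ (Δf * Δg) (f x * Δg)) ≤-refl) ⟩
      ∣ Δf * Δg ∣ + ∣ f x * Δg ∣ + ∣ g x * Δf ∣
        ≡⟨ cong₂ _+_ (cong₂ _+_ (∣x*y∣≡∣x∣*∣y∣ Δf Δg) (∣x*y∣≡∣x∣*∣y∣ (f x) Δg)) (∣x*y∣≡∣x∣*∣y∣ (g x) Δf) ⟩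
      ∣ Δf ∣ * ∣ Δg ∣ + ∣ f x ∣ * ∣ Δg ∣ + ∣ g x ∣ * ∣ Δf ∣
        ≤⟨ +-mono-≤ (+-mono-≤ (*-mono-≤ (∣x∣-nonneg Δf) (∣x∣-nonneg Δg)
               (≤-trans f-bound (≤-trans (*-monoˡ-≤ 0≤K ∣h∣≤1) (≤-reflexive (*-identityʳ K)))) g-bound)
             (*-monoˡ-≤ (∣x∣-nonneg (f x)) g-bound)) (*-monoˡ-≤ (∣x∣-nonneg (g x)) f-bound) ⟩
      K * (L * ∣ h ∣) + ∣ f x ∣ * (L * ∣ h ∣) + ∣ g x ∣ * (K * ∣ h ∣)
        ≡⟨ solve 5 (λ k l f g h → k :* (l :* h) :+ f :* (l :* h) :+ g :* (k :* h) := (k :* l :+ f :* l :+ g :* k) :* h)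
             refl K L (∣ f x ∣) (∣ g x ∣) (∣ h ∣) ⟩
      (K * L + ∣ f x ∣ * L + ∣ g x ∣ * K) * ∣ h ∣ ∎
      where
      Δf Δg : ℝ
      Δf = u - f x
      Δg = v - g x

  lipschitz⇒continuous : ∀ {f x} → LipschitzAt f x → ∀ ε → 0# < ε →
    ∃ λ r → 0# < r × (∀ h → ∣ h ∣ ≤ r → ∣ f (x + h) - f x ∣ < ε)
  lipschitz⇒continuous {f} {x} (lipschitz K 0≤K δ 0<δ bound) ε 0<ε =
    proj₁ m , proj₁ (proj₂ m) , λ h ∣h∣≤r → begin-strict
      ∣ f (x + h) - f x ∣        ≤⟨ bound h (≤-<-trans (≤-trans ∣h∣≤r (proj₁ (proj₂ (proj₂ m)))) (half-< 0<δ)) ⟩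
      K * ∣ h ∣                  ≤⟨ *-monoˡ-≤ 0≤K (≤-trans ∣h∣≤r (proj₂ (proj₂ (proj₂ m)))) ⟩
      K * (ε / (K + 1#))         <⟨ <-by (ε / (K + 1#)) (/-pos 0<ε 0<K+1) (solve 2 (λ k y → (k :+ :1) :* y := k :* y :+ y) refl K (ε / (K + 1#))) ⟩
      (K + 1#) * (ε / (K + 1#))  ≡⟨ /-cancel ε (>⇒≢ 0<K+1) ⟩
      ε                          ∎
    where
    open ≤-Reasoning
    0<K+1 : 0# < K + 1#
    0<K+1 = subst (0# <_) (+-comm 1# K) (+-pos-nonneg 0<1 0≤K)
    m : ∃ λ r → 0# < r × r ≤ half δ × r ≤ ε / (K + 1#)
    m = min (half δ) (ε / (K + 1#)) (half-pos 0<δ) (/-pos 0<ε 0<K+1)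

  -- The intermediate value theorem.

  module IntermediateValue (f : ℝ → ℝ) (f-lip : ∀ x → LipschitzAt f x) (a b : ℝ)
    (a<b : a < b) (fa<0 : f a < 0#) (0<fb : 0# < f b) where

    Negative : ℝ → Set
    Negative x = x ≤ b × f x < 0#

    supremum : ∃ (IsSup Negative)
    supremum = sup Negative (a , <⇒≤ a<b , fa<0) (b , λ _ → proj₁)

    s : ℝ
    s = proj₁ supremum

    upper : ∀ x → Negative x → x ≤ s
    upper = proj₁ (proj₂ supremum)

    s≤b : s ≤ b
    s≤b = ≮⇒≥ λ b<s → let (x , (x≤b , _) , b<x) = proj₂ (proj₂ supremum) b b<s in <⇒≱ b<x x≤b

    -- A negative value would persist slightly to the right of s, still within b because f b is
    -- positive, and so beyond the upper bound.
    fs≮0 : ¬ (f s < 0#)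
    fs≮0 fs<0 = <⇒≱ (<-by h 0<h refl) (upper (s + h) (s+h≤b , fs+h<0))
      where
      s<b : s < b
      s<b = [ id , (λ s≡b → contradiction (<-trans 0<fb (subst (λ z → f z < 0#) s≡b fs<0)) (<-irrefl refl)) ]′ s≤b
      cont = lipschitz⇒continuous (f-lip s) (- f s) (0<-x fs<0)
      m : ∃ λ h → 0# < h × h ≤ proj₁ cont × h ≤ b - s
      m = min (proj₁ cont) (b - s) (proj₁ (proj₂ cont)) (x<y⇒0<y-x s<b)
      h : ℝ
      h = proj₁ m
      0<h : 0# < h
      0<h = proj₁ (proj₂ m)
      s+h≤b : s + h ≤ b
      s+h≤b = ≤-trans (+-mono-≤ (≤-refl {s}) (proj₂ (proj₂ (proj₂ m))))
        (≤-reflexive (solve 2 (λ s b → s :+ (b :- s) := b) refl s b))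
      fs+h<0 : f (s + h) < 0#
      fs+h<0 = begin-strict
        f (s + h)             ≡⟨ solve 2 (λ a b → a := b :+ (a :- b)) refl (f (s + h)) (f s) ⟩
        f s + (f (s + h) - f s) <⟨ +-mono-≤-< (≤-refl {f s}) (≤-<-trans (x≤∣x∣ _) (proj₂ (proj₂ cont) h
                                   (subst (_≤ proj₁ cont) (sym (0≤x⇒∣x∣≡x (<⇒≤ 0<h))) (proj₁ (proj₂ (proj₂ m)))))) ⟩
        f s + - f s           ≡⟨ -‿inverseʳ (f s) ⟩
        0#                    ∎
        where open ≤-Reasoning

    -- A positive value would persist on an interval to the left of s, where the supremum has a
    -- point of the set.
    fs≯0 : ¬ (0# < f s)
    fs≯0 0<fs = <⇒≱ 0<fx (<⇒≤ (proj₂ (proj₁ (proj₂ near))))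
      where
      cont = lipschitz⇒continuous (f-lip s) (f s) 0<fs
      r : ℝ
      r = proj₁ cont
      near : ∃ λ x → Negative x × s - r < x
      near = proj₂ (proj₂ supremum) (s - r)
        (<-by r (proj₁ (proj₂ cont)) (solve 2 (λ s d → s := s :- d :+ d) refl s r))
      x : ℝ
      x = proj₁ near
      ∣x-s∣≤r : ∣ x - s ∣ ≤ r
      ∣x-s∣≤r = ∣x∣≤
        (≤-trans (≤-by (s - x) (x≤y⇒0≤y-x (upper x (proj₁ (proj₂ near)))) (solve 2 (λ s x → :0 := x :- s :+ (s :- x)) refl s x))
          (<⇒≤ (proj₁ (proj₂ cont))))
        (≤-by (x - (s - r)) (<⇒≤ (x<y⇒0<y-x (proj₂ (proj₂ near)))) (solve 3 (λ s x e → e := :- (x :- s) :+ (x :- (s :- e))) refl s x r))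
      0<fx : 0# < f x
      0<fx = begin-strict
        0#                        ≡⟨ sym (-‿inverseʳ (f s)) ⟩
        f s + - f s               <⟨ +-mono-≤-< (≤-refl {f s}) (neg-mono-< (≤-<-trans (-x≤∣x∣ _) (proj₂ (proj₂ cont) (x - s) ∣x-s∣≤r))) ⟩
        f s + - - (f (s + (x - s)) - f s) ≡⟨ solve 2 (λ a b → b :+ :- :- (a :- b) := a) refl (f (s + (x - s))) (f s) ⟩
        f (s + (x - s))           ≡⟨ cong f (solve 2 (λ s x → s :+ (x :- s) := x) refl s x) ⟩
        f x                       ∎
        where open ≤-Reasoning

    fs≡0 : f s ≡ 0#
    fs≡0 = ≤-antisym (≮⇒≥ fs≯0) (≮⇒≥ fs≮0)

    a<s : a < s
    a<s = [ id , (λ a≡s → contradiction fa<0 (<-irrefl (trans (cong f a≡s) fs≡0))) ]′ (upper a (<⇒≤ a<b , fa<0))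

  intermediate-value : ∀ (f : ℝ → ℝ) → (∀ x → LipschitzAt f x) → ∀ {a b} → a < b → f a < 0# → 0# < f b →
    ∃ λ c → a < c × f c ≡ 0#
  intermediate-value f f-lip {a} {b} a<b fa<0 0<fb = s , a<s , fs≡0
    where open IntermediateValue f f-lip a b a<b fa<0 0<fb

  -- Surjectivity of the exponential function and the logarithm.

  lipschitz-exp : ∀ x → LipschitzAt exp x
  lipschitz-exp x = lipschitz K 0≤K δ 0<δ λ h ∣h∣<δ →
    subst₂ (λ y z → ∣ exp y - exp z ∣ ≤ K * ∣ h ∣) (*-identityʳ (x + h)) (*-identityʳ x) (bound h ∣h∣<δ)
    where open LipschitzAt (deriv²⇒lipschitz (deriv²-exp 1# x))

  -- The bracket is from -u to x with u = 1/x: (1 + u) e^(-u) ≤ 1 gives e^(-u) < x, and x < 1 + x ≤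
  -- e^x.
  exp-surjective : ∀ {x} → 0# < x → ∃ λ y → exp y ≡ x
  exp-surjective {x} 0<x = proj₁ root , trans (solve 2 (λ e x → e := e :- x :+ x) refl (exp (proj₁ root)) x)
    (trans (cong (_+ x) (proj₂ (proj₂ root))) (+-identityˡ x))
    where
    open ≤-Reasoning
    u : ℝ
    u = x ⁻¹
    0<u : 0# < u
    0<u = ⁻¹-pos 0<x
    exp-u<x : exp (- u) < x
    exp-u<x = *-cancelˡ-< 0<u (begin-strict
      u * exp (- u)        <⟨ <-by (exp (- u)) (exp-pos (- u)) (solve 2 (λ u e → (:1 :- :- u) :* e := u :* e :+ e) refl u (exp (- u))) ⟩
      (1# - - u) * exp (- u) ≤⟨ [1-h]exp≤1 (- u) ⟩
      1#                   ≡⟨ sym (⁻¹-inverse x (>⇒≢ 0<x)) ⟩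
      x * u                ≡⟨ *-comm x u ⟩
      u * x                ∎)
    x<exp : x < exp x
    x<exp = <-≤-trans (<-by 1# 0<1 (+-comm 1# x)) (1+x≤exp x)
    root = intermediate-value (λ y → exp y + - x) (λ y → lipschitz-+ (lipschitz-exp y) lipschitz-const)
      (<-trans (-x<0 0<u) 0<x)
      (≤-<-trans ≤-refl (subst (exp (- u) - x <_) (-‿inverseʳ x) (+-monoˡ-< _ _ (- x) exp-u<x)))
      (x<y⇒0<y-x x<exp)

  exp-log : ∀ {x} → 0# < x → exp (log x) ≡ x
  exp-log {x} 0<x = choose-spec {P = λ y → exp y ≡ x} (exp-surjective 0<x)

  log-exp : ∀ x → log (exp x) ≡ x
  log-exp x = exp-injective (exp-log (exp-pos x))

  log-* : ∀ {x y} → 0# < x → 0# < y → log (x * y) ≡ log x + log y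
  log-* {x} {y} 0<x 0<y = exp-injective (begin
    exp (log (x * y))       ≡⟨ exp-log (*-pos x y 0<x 0<y) ⟩
    x * y                   ≡⟨ sym (cong₂ _*_ (exp-log 0<x) (exp-log 0<y)) ⟩
    exp (log x) * exp (log y) ≡⟨ sym (exp-+ (log x) (log y)) ⟩
    exp (log x + log y)     ∎)
    where open ≡-Reasoning

  log-/ : ∀ {x y} → 0# < x → 0# < y → log (x / y) ≡ log x - log y
  log-/ {x} {y} 0<x 0<y = begin
    log (x / y)                     ≡⟨ solve 2 (λ a b → a := b :+ a :- b) refl (log (x / y)) (log y) ⟩
    log y + log (x / y) - log y     ≡⟨ cong (_- log y) (sym (log-* 0<y (/-pos 0<x 0<y))) ⟩
    log (y * (x / y)) - log y       ≡⟨ cong (λ z → log z - log y) (/-cancel x (>⇒≢ 0<y)) ⟩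
    log x - log y                   ∎
    where open ≡-Reasoning

  log-mono-< : ∀ {x y} → 0# < x → x < y → log x < log y
  log-mono-< 0<x x<y = exp-cancel-< (subst₂ _<_ (sym (exp-log 0<x)) (sym (exp-log (<-trans 0<x x<y))) x<y)

  log-mono-≤ : ∀ {x y} → 0# < x → x ≤ y → log x ≤ log y
  log-mono-≤ 0<x (inj₁ x<y)  = inj₁ (log-mono-< 0<x x<y)
  log-mono-≤ 0<x (inj₂ refl) = inj₂ refl

  log-1# : log 1# ≡ 0#
  log-1# = trans (cong log (sym exp-0#)) (log-exp 0#)

  -- Finite sums.

  sum-cong : ∀ {n} {f g : Fin n → ℝ} → (∀ i → f i ≡ g i) → sum f ≡ sum g
  sum-cong {zero}  f≡g = refl
  sum-cong {suc n} f≡g = cong₂ _+_ (f≡g Fin.zero) (sum-cong (f≡g ∘ Fin.suc))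

  sum-linear : ∀ {n} a c (f g : Fin n → ℝ) → sum (λ i → a * f i + c * g i) ≡ a * sum f + c * sum g
  sum-linear {zero}  a c f g = solve 2 (λ a c → :0 := a :* :0 :+ c :* :0) refl a c
  sum-linear {suc n} a c f g = trans
    (cong (a * f Fin.zero + c * g Fin.zero +_) (sum-linear a c (f ∘ Fin.suc) (g ∘ Fin.suc)))
    (solve 6 (λ a c x y s t → a :* x :+ c :* y :+ (a :* s :+ c :* t) := a :* (x :+ s) :+ c :* (y :+ t))
      refl a c (f Fin.zero) (g Fin.zero) (sum (f ∘ Fin.suc)) (sum (g ∘ Fin.suc)))

  sum-mono-≤ : ∀ {n} {f g : Fin n → ℝ} → (∀ i → f i ≤ g i) → sum f ≤ sum g
  sum-mono-≤ {zero}  f≤g = ≤-refl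
  sum-mono-≤ {suc n} f≤g = +-mono-≤ (f≤g Fin.zero) (sum-mono-≤ (f≤g ∘ Fin.suc))

  sum-mono-< : ∀ {n} {f g : Fin n → ℝ} → (∀ i → f i ≤ g i) → ∀ i → f i < g i → sum f < sum g
  sum-mono-< f≤g Fin.zero    f₀<g₀ = +-mono-<-≤ f₀<g₀ (sum-mono-≤ (f≤g ∘ Fin.suc))
  sum-mono-< f≤g (Fin.suc i) fᵢ<gᵢ = +-mono-≤-< (f≤g Fin.zero) (sum-mono-< (f≤g ∘ Fin.suc) i fᵢ<gᵢ)

  sum-const : ∀ n c → sum {n} (λ _ → c) ≡ fromℕ n * c
  sum-const zero    c = sym (zeroˡ c)
  sum-const (suc n) c = trans (cong (c +_) (sum-const n c))
    (solve 2 (λ k c → c :+ k :* c := (:1 :+ k) :* c) refl (fromℕ n) c)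

  sum-nonneg : ∀ {n} {f : Fin n → ℝ} → (∀ i → 0# ≤ f i) → 0# ≤ sum f
  sum-nonneg {zero}  0≤f = ≤-refl
  sum-nonneg {suc n} 0≤f = +-nonneg (0≤f Fin.zero) (sum-nonneg (0≤f ∘ Fin.suc))

  deriv²-cong : ∀ {f g x D E} → (∀ y → f y ≡ g y) → D ≡ E → HasDerivAt² f x D → HasDerivAt² g x E
  deriv²-cong {f} {g} {x} {D} f≡g refl (derivative K 0≤K δ 0<δ bound) = derivative K 0≤K δ 0<δ λ h ∣h∣<δ →
    subst₂ (λ u v → ∣ u - v - h * D ∣ ≤ K * (h * h)) (f≡g (x + h)) (f≡g x) (bound h ∣h∣<δ)

  -- Dirichlet polynomials.

  module Dirichlet {n} (l : Fin (suc n) → ℝ) where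

    -- Written as `_^ʳ_` unfolds, so that ζ is `Z` for the logarithms of the digits by computation.
    weight : ℝ → Fin (suc n) → ℝ
    weight s i = exp (- s * l i)

    -- `φ₁` is the logarithmic derivative of `Z`; it enters through the tangent inequality and not
    -- as a limit.
    Z Z₁ φ φ₁ : ℝ → ℝ
    Z  s = sum (weight s)
    Z₁ s = sum (λ i → - l i * weight s i)
    φ  s = log (Z s)
    φ₁ s = Z₁ s / Z s

    deriv²-weight : ∀ i s → HasDerivAt² (λ s → weight s i) s (- l i * weight s i)
    deriv²-weight i s = deriv²-cong (λ y → cong exp (swap y)) (cong (λ z → - l i * exp z) (swap s)) (deriv²-exp (- l i) s)
      where
      swap : ∀ y → y * - l i ≡ - y * l i
      swap y = solve 2 (λ y l → y :* :- l := :- y :* l) refl y (l i)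

    deriv²-Z : ∀ s → HasDerivAt² Z s (Z₁ s)
    deriv²-Z s = deriv²-sum {f = λ i s → weight s i} {D = λ i → - l i * weight s i} (λ i → deriv²-weight i s)

    lipschitz-Z : ∀ s → LipschitzAt Z s
    lipschitz-Z s = deriv²⇒lipschitz (deriv²-Z s)

    lipschitz-Z₁ : ∀ s → LipschitzAt Z₁ s
    lipschitz-Z₁ s = deriv²⇒lipschitz (deriv²-sum {f = λ i s → - l i * weight s i} {D = λ i → - l i * (- l i * weight s i)}
      (λ i → deriv²-scale (- l i) (deriv²-weight i s)))

    Z-pos : ∀ s → 0# < Z s
    Z-pos s = +-pos-nonneg (exp-pos (- s * l Fin.zero)) (sum-nonneg (λ i → <⇒≤ (exp-pos (- s * l (Fin.suc i)))))

    weight-at-0 : ∀ i → weight 0# i ≡ 1#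
    weight-at-0 i = trans (cong exp (solve 1 (λ l → :- :0 :* l := :0) refl (l i))) exp-0#

    Z-at-0 : Z 0# ≡ fromℕ (suc n)
    Z-at-0 = trans (sum-cong weight-at-0) (trans (sum-const (suc n) 1#) (*-identityʳ (fromℕ (suc n))))

    exp-φ : ∀ s → exp (φ s) ≡ Z s
    exp-φ s = exp-log (Z-pos s)

    Z*φ₁ : ∀ s → Z s * φ₁ s ≡ Z₁ s
    Z*φ₁ s = /-cancel (Z₁ s) (>⇒≢ (Z-pos s))

    -- Jensen's inequality: e^x lies above its tangent at m, the mean of the
    -- exponents (t - s) lᵢ with respect to the weights at t.
    module Tangent (s t : ℝ) where

      m : ℝ
      m = (s - t) * φ₁ t

      tangent : Fin (suc n) → ℝ
      tangent i = exp m * (1# - m) * weight t i + exp m * (s - t) * (- l i * weight t i)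

      excess : Fin (suc n) → ℝ
      excess i = (t - s) * l i - m

      tangent≡ : ∀ i → tangent i ≡ weight t i * exp m * (1# + excess i)
      tangent≡ i = solve 6 (λ e m w s t l → e :* (:1 :- m) :* w :+ e :* (s :- t) :* (:- l :* w) :=
          w :* e :* (:1 :+ ((t :- s) :* l :- m)))
        refl (exp m) m (weight t i) s t (l i)

      weight≡ : ∀ i → weight s i ≡ weight t i * exp m * exp (excess i)
      weight≡ i = begin
        exp (- s * l i)                          ≡⟨ cong exp (solve 4 (λ s t l m → :- s :* l := :- t :* l :+ m :+ ((t :- s) :* l :- m)) refl s t (l i) m) ⟩
        exp (- t * l i + m + excess i)           ≡⟨ exp-+ (- t * l i + m) (excess i) ⟩
        exp (- t * l i + m) * exp (excess i)     ≡⟨ cong (_* exp (excess i)) (exp-+ (- t * l i) m) ⟩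
        weight t i * exp m * exp (excess i)      ∎
        where open ≡-Reasoning

      0<w*e : ∀ i → 0# < weight t i * exp m
      0<w*e i = *-pos _ _ (exp-pos (- t * l i)) (exp-pos m)

      tangent≤ : ∀ i → tangent i ≤ weight s i
      tangent≤ i = subst₂ _≤_ (sym (tangent≡ i)) (sym (weight≡ i))
        (*-monoˡ-≤ (<⇒≤ (0<w*e i)) (1+x≤exp (excess i)))

      tangent< : ∀ i → excess i ≢ 0# → tangent i < weight s i
      tangent< i excess≢0 = subst₂ _<_ (sym (tangent≡ i)) (sym (weight≡ i))
        (*-monoˡ-< (0<w*e i) (1+x<exp excess≢0))

      sum-tangent : sum tangent ≡ exp (φ t + m)
      sum-tangent = begin
        sum tangent                                          ≡⟨ sum-linear (exp m * (1# - m)) (exp m * (s - t)) (weight t) (λ i → - l i * weight t i) ⟩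
        exp m * (1# - m) * Z t + exp m * (s - t) * Z₁ t      ≡⟨ cong (λ z → exp m * (1# - m) * Z t + exp m * (s - t) * z) (sym (Z*φ₁ t)) ⟩
        exp m * (1# - m) * Z t + exp m * (s - t) * (Z t * φ₁ t) ≡⟨ solve 5 (λ e s t z p → e :* (:1 :- (s :- t) :* p) :* z :+ e :* (s :- t) :* (z :* p) := z :* e)
                                                                    refl (exp m) s t (Z t) (φ₁ t) ⟩
        Z t * exp m                                          ≡⟨ cong (_* exp m) (sym (exp-φ t)) ⟩
        exp (φ t) * exp m                                    ≡⟨ sym (exp-+ (φ t) m) ⟩
        exp (φ t + m)                                        ∎
        where open ≡-Reasoning

    φ-tangent-≤ : ∀ s t → φ t + (s - t) * φ₁ t ≤ φ s
    φ-tangent-≤ s t = exp-cancel-≤ (subst₂ _≤_ sum-tangent (sym (exp-φ s)) (sum-mono-≤ tangent≤))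
      where open Tangent s t

    -- If the excesses at i and j both vanished, (t - s) l i and (t - s) l j would both equal the
    -- mean m, hence l i = l j.
    φ-tangent-< : ∀ i j → l i ≢ l j → ∀ s t → s ≢ t → φ t + (s - t) * φ₁ t < φ s
    φ-tangent-< i j lᵢ≢lⱼ s t s≢t = exp-cancel-< (subst₂ _<_ sum-tangent (sym (exp-φ s)) (strict (excess i ≟ 0#)))
      where
      open Tangent s t
      strict : Dec (excess i ≡ 0#) → sum tangent < Z s
      strict (no  excessᵢ≢0) = sum-mono-< tangent≤ i (tangent< i excessᵢ≢0)
      strict (yes excessᵢ≡0) = sum-mono-< tangent≤ j (tangent< j λ excessⱼ≡0 →
        lᵢ≢lⱼ (*-cancelˡ-≡ t-s≢0 (begin
          (t - s) * l i     ≡⟨ solve 2 (λ a m → a := a :- m :+ m) refl ((t - s) * l i) m ⟩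
          excess i + m      ≡⟨ cong (_+ m) (trans excessᵢ≡0 (sym excessⱼ≡0)) ⟩
          excess j + m      ≡⟨ solve 2 (λ a m → a :- m :+ m := a) refl ((t - s) * l j) m ⟩
          (t - s) * l j     ∎)))
        where
        open ≡-Reasoning
        t-s≢0 : t - s ≢ 0#
        t-s≢0 t-s≡0 = s≢t (begin
          s             ≡⟨ sym (+-identityˡ s) ⟩
          0# + s        ≡⟨ cong (_+ s) (sym t-s≡0) ⟩
          t - s + s     ≡⟨ solve 2 (λ s t → t :- s :+ s := t) refl s t ⟩
          t             ∎)

    module _ (Λ : ℝ) (0≤l : ∀ i → 0# ≤ l i) (l≤Λ : ∀ i → l i ≤ Λ) where

      -- `- φ₁ s` is the mean of the `l i` with respect to the weights at s, so it lies between 0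
      -- and `Λ`.
      0≤-φ₁ : ∀ s → 0# ≤ - φ₁ s
      0≤-φ₁ s = subst (0# ≤_) (sym (-‿distribˡ-* (Z₁ s) (Z s ⁻¹))) (/-nonneg
        (subst (0# ≤_) -Z₁≡ (sum-nonneg (λ i → *-nonneg (0≤l i) (<⇒≤ (exp-pos (- s * l i)))))) (Z-pos s))
        where
        -Z₁≡ : sum (λ i → l i * weight s i) ≡ - Z₁ s
        -Z₁≡ = trans (sum-cong (λ i → solve 2 (λ l w → l :* w := :- :1 :* (:- l :* w) :+ :0 :* w) refl (l i) (weight s i)))
          (trans (sum-linear (- 1#) 0# (λ i → - l i * weight s i) (weight s))
                 (solve 2 (λ z w → :- :1 :* z :+ :0 :* w := :- z) refl (Z₁ s) (Z s)))

      -φ₁≤Λ : ∀ s → - φ₁ s ≤ Λ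
      -φ₁≤Λ s = *-cancelˡ-≤ (Z-pos s) (begin
        Z s * - φ₁ s             ≡⟨ sym (-‿distribʳ-* (Z s) (φ₁ s)) ⟩
        - (Z s * φ₁ s)           ≡⟨ cong -_ (Z*φ₁ s) ⟩
        - Z₁ s                   ≡⟨ solve 2 (λ z w → :- z := :- :1 :* z :+ :0 :* w) refl (Z₁ s) (Z s) ⟩
        - 1# * Z₁ s + 0# * Z s   ≡⟨ sym (sum-linear (- 1#) 0# (λ i → - l i * weight s i) (weight s)) ⟩
        sum (λ i → - 1# * (- l i * weight s i) + 0# * weight s i) ≤⟨ sum-mono-≤ (λ i → ≤-by ((Λ - l i) * weight s i)
                                     (*-nonneg (x≤y⇒0≤y-x (l≤Λ i)) (<⇒≤ (exp-pos (- s * l i))))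
                                     (solve 3 (λ k l w → k :* w :+ :0 :* w := :- :1 :* (:- l :* w) :+ :0 :* w :+ (k :- l) :* w) refl Λ (l i) (weight s i))) ⟩
        sum (λ i → Λ * weight s i + 0# * weight s i) ≡⟨ sum-linear Λ 0# (weight s) (weight s) ⟩
        Λ * Z s + 0# * Z s       ≡⟨ solve 2 (λ k z → k :* z :+ :0 :* z := z :* k) refl Λ (Z s) ⟩
        Z s * Λ                  ∎)
        where open ≤-Reasoning

      φ₁-bound : ∀ h s → h * φ₁ s ≤ Λ * ∣ h ∣
      φ₁-bound h s = begin
        h * φ₁ s            ≡⟨ solve 2 (λ h p → h :* p := :- h :* :- p) refl h (φ₁ s) ⟩
        - h * - φ₁ s        ≤⟨ *-monoʳ-≤ (0≤-φ₁ s) (-x≤∣x∣ h) ⟩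
        ∣ h ∣ * - φ₁ s      ≤⟨ *-monoˡ-≤ (∣x∣-nonneg h) (-φ₁≤Λ s) ⟩
        ∣ h ∣ * Λ           ≡⟨ *-comm ∣ h ∣ Λ ⟩
        Λ * ∣ h ∣           ∎
        where open ≤-Reasoning

      -- The tangent at t bounds the difference by a slope, and slopes are at most `Λ` in absolute
      -- value. Used in both directions, this makes log Z Lipschitz without differentiating the
      -- logarithm.
      φ-decrease : ∀ s t → φ t - φ s ≤ Λ * ∣ t - s ∣
      φ-decrease s t = ≤-trans (≤-by (φ s - (φ t + (s - t) * φ₁ t)) (x≤y⇒0≤y-x (φ-tangent-≤ s t))
        (solve 5 (λ a b s t p → (t :- s) :* p := a :- b :+ (b :- (a :+ (s :- t) :* p))) refl (φ t) (φ s) s t (φ₁ t)))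
        (φ₁-bound (t - s) t)

      lipschitz-φ : ∀ s → LipschitzAt φ s
      lipschitz-φ s = lipschitz Λ (≤-trans (0≤l Fin.zero) (l≤Λ Fin.zero)) 1# 0<1 λ h _ → ∣x∣≤
        (subst (λ z → φ (s + h) - φ s ≤ Λ * ∣ z ∣) (solve 2 (λ s h → s :+ h :- s := h) refl s h) (φ-decrease s (s + h)))
        (subst₂ _≤_ (solve 2 (λ a b → a :- b := :- (b :- a)) refl (φ s) (φ (s + h)))
          (cong (Λ *_) (trans (cong ∣_∣ (solve 2 (λ s h → s :- (s :+ h) := :- h) refl s h)) (∣-x∣≡∣x∣ h)))
          (φ-decrease (s + h) s))

    -- F is the left-hand side of the equation defining s_b, with L in place of log b.
    module _ (L : ℝ) where

      F G : ℝ → ℝ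
      F s = (1# + s) * φ₁ s - (φ s - L)
      G s = (1# + s) * Z₁ s + - 1# * (Z s * (φ s + - L))

      -- Clearing the positive denominator `Z s` keeps signs and roots, and leaves an expression
      -- within reach of the sum and product rules for Lipschitz bounds.
      G≡Z*F : ∀ s → G s ≡ Z s * F s
      G≡Z*F s = trans (cong (λ z → (1# + s) * z + - 1# * (Z s * (φ s + - L))) (sym (Z*φ₁ s)))
        (solve 5 (λ s z p q L → (:1 :+ s) :* (z :* p) :+ :- :1 :* (z :* (q :+ :- L)) := z :* ((:1 :+ s) :* p :- (q :- L)))
          refl s (Z s) (φ₁ s) (φ s) L)

      -- The increase of F is the gap at s between φ and its tangent at t, plus 1 + s times the
      -- increase of the slope. Both are positive by strict convexity; adding the two tangent
      -- inequalities between s and t shows that the slope increases.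
      F-mono-< : ∀ i j → l i ≢ l j → ∀ {s t} → 0# < s → s < t → F s < F t
      F-mono-< i j lᵢ≢lⱼ {s} {t} 0<s s<t = <-by
        (φ s - (φ t + (s - t) * φ₁ t) + (1# + s) * (φ₁ t - φ₁ s))
        (+-pos (x<y⇒0<y-x below-s) (*-pos _ _ (+-pos 0<1 0<s) (*-cancelˡ-< (x<y⇒0<y-x s<t) (subst (_< (t - s) * (φ₁ t - φ₁ s)) (sym (zeroʳ (t - s))) φ₁-increases))))
        (solve 7 (λ s t p q u v L → (:1 :+ t) :* q :- (v :- L) :=
            (:1 :+ s) :* p :- (u :- L) :+ (u :- (v :+ (s :- t) :* q) :+ (:1 :+ s) :* (q :- p)))
          refl s t (φ₁ s) (φ₁ t) (φ s) (φ t) L)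
        where
        below-s : φ t + (s - t) * φ₁ t < φ s
        below-s = φ-tangent-< i j lᵢ≢lⱼ s t (<⇒≢ s<t)
        below-t : φ s + (t - s) * φ₁ s < φ t
        below-t = φ-tangent-< i j lᵢ≢lⱼ t s (>⇒≢ s<t)
        φ₁-increases : 0# < (t - s) * (φ₁ t - φ₁ s)
        φ₁-increases = subst (0# <_) (solve 6 (λ s t p q u v →
            u :- (v :+ (s :- t) :* q) :+ (v :- (u :+ (t :- s) :* p)) := (t :- s) :* (q :- p)) refl s t (φ₁ s) (φ₁ t) (φ s) (φ t))
          (+-pos (x<y⇒0<y-x below-s) (x<y⇒0<y-x below-t))

      -- The tangent at 2 t + 1, evaluated at t.
      F-lower : ∀ t → φ (t + t + 1#) + (L - (φ t + φ t)) ≤ F (t + t + 1#)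
      F-lower t = ≤-by (φ t - (φ s + (t - s) * φ₁ s) + (φ t - (φ s + (t - s) * φ₁ s)))
        (+-nonneg (x≤y⇒0≤y-x (φ-tangent-≤ t s)) (x≤y⇒0≤y-x (φ-tangent-≤ t s)))
        (solve 5 (λ t p u v L → (:1 :+ (t :+ t :+ :1)) :* p :- (v :- L) :=
            v :+ (L :- (u :+ u)) :+ (u :- (v :+ (t :- (t :+ t :+ :1)) :* p) :+ (u :- (v :+ (t :- (t :+ t :+ :1)) :* p))))
          refl t (φ₁ s) (φ t) (φ s) L)
        where
        s : ℝ
        s = t + t + 1#

  -- The equation defining s_b.

  digitLog : ∀ {n} → Fin n → ℝ
  digitLog i = log (fromℕ (suc (toℕ i)))

  -- `fromℕ 1` unfolds to `1# + 0#`, so this is not definitional.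
  fromℕ-1 : fromℕ 1 ≡ 1#
  fromℕ-1 = +-identityʳ 1#

  0<suc : ∀ n → 0# < fromℕ (suc n)
  0<suc n = fromℕ-pos {suc n} (s≤s z≤n)

  log-fromℕ-mono-≤ : ∀ m n → suc m ℕ.≤ n → log (fromℕ (suc m)) ≤ log (fromℕ n)
  log-fromℕ-mono-≤ m _ m<n = log-mono-≤ (0<suc m) (fromℕ-mono-≤ {suc m} m<n)

  log-fromℕ-mono-< : ∀ m n → suc m ℕ.< n → log (fromℕ (suc m)) < log (fromℕ n)
  log-fromℕ-mono-< m _ m<n = log-mono-< (0<suc m) (fromℕ-mono-< {suc m} m<n)

  log-fromℕ-1 : log (fromℕ 1) ≡ 0#
  log-fromℕ-1 = trans (cong log fromℕ-1) log-1#

  0<log-fromℕ : ∀ n → 0# < log (fromℕ (2+ n))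
  0<log-fromℕ n = subst (_< log (fromℕ (2+ n))) log-fromℕ-1 (log-fromℕ-mono-< 0 (2+ n) (s≤s (s≤s z≤n)))

  digitLog-nonneg : ∀ {n} (i : Fin n) → 0# ≤ digitLog i
  digitLog-nonneg i = subst (_≤ digitLog i) log-fromℕ-1 (log-fromℕ-mono-≤ 0 (suc (toℕ i)) (s≤s z≤n))

  -- (1 - h) e^h ≤ 1 at h = 1/2 gives e^(1/2) ≤ 2, hence e ≤ 4; the 6 is 3!.
  exp-1<6 : exp 1# < fromℕ 6
  exp-1<6 = begin-strict
    exp 1#          ≡⟨ cong exp (sym (half-double 1#)) ⟩
    exp (h + h)     ≡⟨ exp-+ h h ⟩
    exp h * exp h   ≤⟨ *-mono-≤ (<⇒≤ (exp-pos h)) (<⇒≤ (exp-pos h)) exp-h≤2 exp-h≤2 ⟩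
    2# * 2#         <⟨ <-by 2# 0<2 (solve 0 (:1 :+ (:1 :+ (:1 :+ (:1 :+ (:1 :+ (:1 :+ :0))))) := :2 :* :2 :+ :2) refl) ⟩
    fromℕ 6         ∎
    where
    open ≤-Reasoning
    h : ℝ
    h = half 1#
    exp-h≤2 : exp h ≤ 2#
    exp-h≤2 = begin
      exp h                        ≡⟨ sym (*-identityˡ (exp h)) ⟩
      1# * exp h                   ≡⟨ cong (_* exp h) (sym (half-double 1#)) ⟩
      (h + h) * exp h              ≡⟨ solve 2 (λ h e → (h :+ h) :* e := :2 :* (h :* e)) refl h (exp h) ⟩
      2# * (h * exp h)             ≡⟨ cong (λ z → 2# * (z * exp h)) h≡1-h ⟩
      2# * ((1# - h) * exp h)      ≤⟨ *-monoˡ-≤ (<⇒≤ 0<2) ([1-h]exp≤1 h) ⟩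
      2# * 1#                      ≡⟨ *-identityʳ 2# ⟩
      2#                           ∎
      where
      h≡1-h : h ≡ 1# - h
      h≡1-h = trans (solve 1 (λ h → h := h :+ h :- h) refl h) (cong (_- h) (half-double 1#))

  1<log6 : 1# < log (fromℕ 6)
  1<log6 = exp-cancel-< (subst (exp 1# <_) (sym (exp-log (0<suc 5))) exp-1<6)

  -- The logarithmic form of (1 + 1/N)^N ≤ e, from 1 + 1/N ≤ e^(1/N).
  n*log[1+1/n]≤1 : ∀ n → fromℕ (suc n) * (log (fromℕ (2+ n)) - log (fromℕ (suc n))) ≤ 1#
  n*log[1+1/n]≤1 n = begin
    N * (log (1# + N) - log N)    ≡⟨ cong (N *_) (sym (log-/ (0<suc (suc n)) 0<N)) ⟩
    N * log ((1# + N) / N)        ≤⟨ *-monoˡ-≤ (<⇒≤ 0<N) log≤ ⟩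
    N * N ⁻¹                      ≡⟨ ⁻¹-inverse N (>⇒≢ 0<N) ⟩
    1#                            ∎
    where
    open ≤-Reasoning
    N : ℝ
    N = fromℕ (suc n)
    0<N : 0# < N
    0<N = 0<suc n
    log≤ : log ((1# + N) / N) ≤ N ⁻¹
    log≤ = exp-cancel-≤ (begin
      exp (log ((1# + N) / N))    ≡⟨ exp-log (/-pos (0<suc (suc n)) 0<N) ⟩
      (1# + N) * N ⁻¹             ≡⟨ distribʳ (N ⁻¹) 1# N ⟩
      1# * N ⁻¹ + N * N ⁻¹        ≡⟨ cong₂ _+_ (*-identityˡ (N ⁻¹)) (⁻¹-inverse N (>⇒≢ 0<N)) ⟩
      N ⁻¹ + 1#                   ≡⟨ +-comm (N ⁻¹) 1# ⟩
      1# + N ⁻¹                   ≤⟨ 1+x≤exp (N ⁻¹) ⟩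
      exp (N ⁻¹)                  ∎)

  module _ {n : ℕ} where

    open Dirichlet {n} digitLog

    weight-of-1 : ∀ s → weight s Fin.zero ≡ 1#
    weight-of-1 s = trans (cong exp (trans (cong (- s *_) log-fromℕ-1) (zeroʳ (- s)))) exp-0#

    -- The digit 1 alone contributes 1.
    1≤Z : ∀ s → 1# ≤ Z s
    1≤Z s = subst (_≤ Z s) (weight-of-1 s) (≤-by (sum (λ i → weight s (Fin.suc i)))
      (sum-nonneg {f = λ i → weight s (Fin.suc i)} (λ i → <⇒≤ (exp-pos (- s * digitLog (Fin.suc i))))) refl)

    φ-nonneg : ∀ s → 0# ≤ φ s
    φ-nonneg s = subst (_≤ φ s) log-1# (log-mono-≤ 0<1 (1≤Z s))

  module PositiveRoot (k : ℕ) where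

    b n : ℕ
    b = 4 ℕ.+ k
    n = 3 ℕ.+ k

    open Dirichlet {2+ k} digitLog

    L B log2 : ℝ
    B = fromℕ b
    L = log B
    log2 = log (fromℕ 2)

    ζ≡Z : ∀ s → ζ b s ≡ Z s
    ζ≡Z s = refl

    ζ′≡Z₁ : ∀ s → ζ′ b s ≡ Z₁ s
    ζ′≡Z₁ s = deriv≡ {f = ζ b} (deriv²-cong {f = Z} {g = ζ b} (λ y → sym (ζ≡Z y)) refl (deriv²-Z s))

    lhs≡F : ∀ s → ((1# + s) * ζ′ b s) / ζ b s - log (ζ b s / fromℕ b) ≡ F L s
    lhs≡F s = begin
      ((1# + s) * ζ′ b s) / ζ b s - log (ζ b s / fromℕ b)  ≡⟨ cong₂ (λ y z → ((1# + s) * y) / z - log (z / fromℕ b)) (ζ′≡Z₁ s) (ζ≡Z s) ⟩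
      ((1# + s) * Z₁ s) / Z s - log (Z s / fromℕ b)        ≡⟨ cong₂ _-_ (*-assoc (1# + s) (Z₁ s) (Z s ⁻¹)) (log-/ (Z-pos s) (0<suc n)) ⟩
      F L s                                          ∎
      where open ≡-Reasoning

    0<log2 : 0# < log2
    0<log2 = 0<log-fromℕ 0

    -- The digits 1 and 2 make log ζ strictly convex.
    rates-differ : digitLog {n} Fin.zero ≢ digitLog {n} (Fin.suc Fin.zero)
    rates-differ eq = <-irrefl (trans (sym log-fromℕ-1) eq) 0<log2

    -- The sum is log (b-1)!, and the digits 2 and 3, present since b ≥ 4, already contribute log 6.
    1<sum-log : 1# < sum {n} digitLog
    1<sum-log = begin-strict
      1#                                        <⟨ 1<log6 ⟩
      log (fromℕ 6)                             ≡⟨ trans (cong log (fromℕ-homo-* 2 3)) (log-* (0<suc 1) (0<suc 2)) ⟩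
      log2 + log (fromℕ 3)                      ≡⟨ solve 2 (λ a b → a :+ b := :0 :+ (a :+ (b :+ :0))) refl log2 (log (fromℕ 3)) ⟩
      0# + (log2 + (log (fromℕ 3) + 0#))        ≤⟨ +-mono-≤ (digitLog-nonneg {n} Fin.zero) (+-mono-≤ (≤-refl {log2}) (+-mono-≤ (≤-refl {log (fromℕ 3)})
                                                     (sum-nonneg {k} {λ i → digitLog (Fin.suc (Fin.suc (Fin.suc i)))} (λ i → digitLog-nonneg (Fin.suc (Fin.suc (Fin.suc i))))))) ⟩
      sum {n} digitLog                          ∎
      where open ≤-Reasoning

    -- All weights are 1 at 0, so the value is n log (b / n) - log n! with n = b - 1: the first term
    -- is at most 1 and log n! exceeds 1.
    G-at-0 : G L 0# < 0#
    G-at-0 = begin-strict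
      (1# + 0#) * Z₁ 0# + - 1# * (Z 0# * (log (Z 0#) + - L))
        ≡⟨ cong₂ (λ u v → (1# + 0#) * u + - 1# * (v * (log v + - L))) Z₁-at-0 Z-at-0 ⟩
      (1# + 0#) * (- Σlog) + - 1# * (fromℕ n * (log (fromℕ n) + - L))
        ≡⟨ solve 4 (λ u v w L → (:1 :+ :0) :* :- u :+ :- :1 :* (v :* (w :+ :- L)) := v :* (L :- w) :- u) refl Σlog (fromℕ n) (log (fromℕ n)) L ⟩
      fromℕ n * (L - log (fromℕ n)) - Σlog
        ≤⟨ +-mono-≤ (n*log[1+1/n]≤1 (2+ k)) ≤-refl ⟩
      1# - Σlog <⟨ +-monoˡ-< 1# Σlog (- Σlog) 1<sum-log ⟩
      Σlog - Σlog ≡⟨ -‿inverseʳ Σlog ⟩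
      0# ∎
      where
      open ≤-Reasoning
      Σlog : ℝ
      Σlog = sum {n} digitLog
      Z₁-at-0 : Z₁ 0# ≡ - Σlog
      Z₁-at-0 = begin-equality
        Z₁ 0#                                            ≡⟨ sum-cong (λ i → trans (cong (- digitLog i *_) (weight-at-0 i))
                                                              (solve 1 (λ l → :- l :* :1 := :- :1 :* l :+ :0 :* l) refl (digitLog i))) ⟩
        sum {n} (λ i → - 1# * digitLog i + 0# * digitLog i)  ≡⟨ sum-linear {n} (- 1#) 0# digitLog digitLog ⟩
        - 1# * Σlog + 0# * Σlog                          ≡⟨ solve 1 (λ x → :- :1 :* x :+ :0 :* x := :- x) refl Σlog ⟩
        - Σlog                                           ∎

    -- At t = log b / log 2 every d ≥ 2 has d^(- t) ≤ 1 / b, so that ζ(t) < 2 ≤ √b.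
    t : ℝ
    t = L / log2

    0<L : 0# < L
    0<L = 0<log-fromℕ (2+ k)

    0<t : 0# < t
    0<t = /-pos 0<L 0<log2

    Z-t<2 : Z t < 2#
    Z-t<2 = begin-strict
      weight t Fin.zero + sum (λ i → weight t (Fin.suc i))
        ≤⟨ +-mono-≤ (≤-reflexive (weight-of-1 {2+ k} t)) (sum-mono-≤ (λ i → weight-suc i)) ⟩
      1# + sum {2+ k} (λ _ → B ⁻¹)     ≡⟨ cong (1# +_) (sum-const (2+ k) (B ⁻¹)) ⟩
      1# + fromℕ (2+ k) * B ⁻¹         <⟨ +-mono-≤-< (≤-refl {1#}) (*-monoʳ-< (⁻¹-pos 0<B) (fromℕ-mono-< {2+ k} {b} (ℕ.m≤n+m (3 ℕ.+ k) 1))) ⟩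
      1# + B * B ⁻¹                    ≡⟨ cong (1# +_) (⁻¹-inverse B (>⇒≢ 0<B)) ⟩
      2#                               ∎
      where
      open ≤-Reasoning
      0<B : 0# < B
      0<B = 0<suc n
      exp-neg-L : exp (- L) ≡ B ⁻¹
      exp-neg-L = *-cancelˡ-≡ (>⇒≢ 0<B) (trans (cong (_* exp (- L)) (sym (exp-log 0<B)))
        (trans (exp-inverse L) (sym (⁻¹-inverse B (>⇒≢ 0<B)))))
      weight-suc : ∀ i → weight t (Fin.suc i) ≤ B ⁻¹
      weight-suc i = subst (weight t (Fin.suc i) ≤_) exp-neg-L (exp-mono-≤ (begin
        - t * digitLog (Fin.suc i)   ≡⟨ sym (-‿distribˡ-* t _) ⟩
        - (t * digitLog (Fin.suc i)) ≤⟨ neg-mono-≤ (*-monoˡ-≤ (<⇒≤ 0<t) (log-fromℕ-mono-≤ 1 (2+ (toℕ i)) (s≤s (s≤s z≤n)))) ⟩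
        - (t * log2)                 ≡⟨ cong -_ (trans (*-comm t log2) (/-cancel L (>⇒≢ 0<log2))) ⟩
        - L                          ∎))

    φ+φ<L : φ t + φ t < L
    φ+φ<L = begin-strict
      φ t + φ t                  <⟨ +-mono-< φ<log2 φ<log2 ⟩
      log2 + log2                ≡⟨ sym (trans (cong log (fromℕ-homo-* 2 2)) (log-* (0<suc 1) (0<suc 1))) ⟩
      log (fromℕ 4)              ≤⟨ log-fromℕ-mono-≤ 3 b (ℕ.m≤m+n 4 k) ⟩
      L                          ∎
      where
      open ≤-Reasoning
      φ<log2 : φ t < log2
      φ<log2 = log-mono-< (Z-pos t) (subst (Z t <_) (solve 0 (:2 := :1 :+ (:1 :+ :0)) refl) Z-t<2)

    0<F : 0# < F L (t + t + 1#)
    0<F = <-≤-trans (subst (_< φ (t + t + 1#) + (L - (φ t + φ t))) (+-identityˡ 0#)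
      (+-mono-≤-< (φ-nonneg {2+ k} (t + t + 1#)) (x<y⇒0<y-x φ+φ<L))) (F-lower L t)

    lipschitz-G : ∀ s → LipschitzAt (G L) s
    lipschitz-G s = lipschitz-+
      (lipschitz-* (lipschitz-+ lipschitz-const lipschitz-id) (lipschitz-Z₁ s))
      (lipschitz-* lipschitz-const (lipschitz-* (lipschitz-Z s)
        (lipschitz-+ (lipschitz-φ (log (fromℕ n)) digitLog-nonneg (λ i → log-fromℕ-mono-≤ (toℕ i) n (Fin.toℕ<n i)) s) lipschitz-const)))

    G-root : ∃ λ s → 0# < s × G L s ≡ 0#
    G-root = intermediate-value (G L) lipschitz-G (+-pos (+-pos 0<t 0<t) 0<1) G-at-0
      (subst (0# <_) (sym (G≡Z*F L (t + t + 1#))) (*-pos _ _ (Z-pos (t + t + 1#)) 0<F))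

    G-root⇒root : ∀ s → G L s ≡ 0# → ((1# + s) * ζ′ b s) / ζ b s - log (ζ b s / fromℕ b) ≡ 0#
    G-root⇒root s Gs≡0 = trans (lhs≡F s) (*-cancelˡ-≡ (>⇒≢ (Z-pos s))
      (trans (sym (G≡Z*F L s)) (trans Gs≡0 (sym (zeroʳ (Z s))))))

    positive-root : ∃ (IsPositiveRoot b)
    positive-root = proj₁ G-root , proj₁ (proj₂ G-root) , G-root⇒root (proj₁ G-root) (proj₂ (proj₂ G-root))

    root⇒F-root : ∀ s → IsPositiveRoot b s → F L s ≡ 0#
    root⇒F-root s (_ , lhs≡0) = trans (sym (lhs≡F s)) lhs≡0

    F-roots-≮ : ∀ s s′ → 0# < s → F L s ≡ 0# → F L s′ ≡ 0# → ¬ (s < s′)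
    F-roots-≮ s s′ 0<s Fs≡0 Fs′≡0 s<s′ = <-irrefl (trans Fs≡0 (sym Fs′≡0))
      (F-mono-< L Fin.zero (Fin.suc Fin.zero) rates-differ 0<s s<s′)

    roots-equal : ∀ s s′ → IsPositiveRoot b s → IsPositiveRoot b s′ → s ≡ s′
    roots-equal s s′ root root′ = ≤-antisym
      (≮⇒≥ (F-roots-≮ s′ s (proj₁ root′) (root⇒F-root s′ root′) (root⇒F-root s root)))
      (≮⇒≥ (F-roots-≮ s s′ (proj₁ root) (root⇒F-root s root) (root⇒F-root s′ root′)))

    unique-root : ∃! _≡_ (IsPositiveRoot b)
    unique-root = proj₁ positive-root , proj₂ positive-root , λ {s} root → roots-equal (proj₁ positive-root) s (proj₂ positive-root) root

  -- A root is positive by definition, and the default is `0#`.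
  sᵣ-nonneg : ∀ b → 0# ≤ sᵣ b
  sᵣ-nonneg b = choose-elim {P = IsPositiveRoot b} (0# ≤_) ≤-refl (λ _ root → <⇒≤ (proj₁ root))

  -- Weighted enumeration.

  sumOver : ∀ {A : Set} → (A → ℝ) → List A → ℝ
  sumOver f []       = 0#
  sumOver f (x ∷ xs) = f x + sumOver f xs

  sumOver-++ : ∀ {A : Set} (f : A → ℝ) xs ys → sumOver f (xs ++ ys) ≡ sumOver f xs + sumOver f ys
  sumOver-++ f []       ys = sym (+-identityˡ _)
  sumOver-++ f (x ∷ xs) ys = trans (cong (f x +_) (sumOver-++ f xs ys)) (sym (+-assoc _ _ _))

  sumOver-tabulate : ∀ {A : Set} (f : A → ℝ) {n} (h : Fin n → A) → sumOver f (tabulate h) ≡ sum (f ∘ h)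
  sumOver-tabulate f {zero}  h = refl
  sumOver-tabulate f {suc n} h = cong (f (h Fin.zero) +_) (sumOver-tabulate f (h ∘ Fin.suc))

  _≤?_ : ∀ x y → Dec (x ≤ y)
  x ≤? y = (x <? y) ⊎-dec (x ≟ y)

  -- Rankin's trick: a weight that is at least 1 on the elements counted dominates their indicator.
  length-filter≤sumOver : ∀ {A : Set} {P : A → Set} (P? : ∀ x → Dec (P x)) (f : A → ℝ) →
    (∀ x → 0# ≤ f x) → (∀ x → P x → 1# ≤ f x) → ∀ xs → fromℕ (length (filter P? xs)) ≤ sumOver f xs
  length-filter≤sumOver P? f 0≤f 1≤f []       = ≤-refl
  length-filter≤sumOver P? f 0≤f 1≤f (x ∷ xs) with P? x
  ... | yes Px = +-mono-≤ (1≤f x Px) (length-filter≤sumOver P? f 0≤f 1≤f xs)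
  ... | no _   = subst (_≤ f x + sumOver f xs) (+-identityˡ _)
    (+-mono-≤ (0≤f x) (length-filter≤sumOver P? f 0≤f 1≤f xs))

  ^-pos : ∀ {x} → 0# < x → ∀ n → 0# < x ^ n
  ^-pos 0<x zero    = 0<1
  ^-pos 0<x (suc n) = *-pos _ _ 0<x (^-pos 0<x n)

  ^-mono-≤ : ∀ {x y} → 0# ≤ x → x ≤ y → ∀ n → x ^ n ≤ y ^ n
  ^-mono-≤ 0≤x x≤y zero    = ≤-refl
  ^-mono-≤ 0≤x x≤y (suc n) = *-mono-≤ 0≤x (^-nonneg 0≤x n) x≤y (^-mono-≤ 0≤x x≤y n)

  1≤^ : ∀ {x} → 1# ≤ x → ∀ n → 1# ≤ x ^ n
  1≤^ 1≤x zero    = ≤-refl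
  1≤^ {x} 1≤x (suc n) = subst (_≤ x ^ suc n) (*-identityˡ 1#) (*-mono-≤ (<⇒≤ 0<1) (<⇒≤ 0<1) 1≤x (1≤^ 1≤x n))

  *-^ : ∀ x y n → (x * y) ^ n ≡ x ^ n * y ^ n
  *-^ x y zero    = sym (*-identityˡ 1#)
  *-^ x y (suc n) = trans (cong (x * y *_) (*-^ x y n))
    (solve 4 (λ x y u v → x :* y :* (u :* v) := x :* u :* (y :* v)) refl x y (x ^ n) (y ^ n))

  exp-^ : ∀ x n → exp x ^ n ≡ exp (fromℕ n * x)
  exp-^ x zero    = sym (trans (cong exp (zeroˡ x)) exp-0#)
  exp-^ x (suc n) = begin
    exp x * exp x ^ n             ≡⟨ cong (exp x *_) (exp-^ x n) ⟩
    exp x * exp (fromℕ n * x)     ≡⟨ sym (exp-+ x (fromℕ n * x)) ⟩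
    exp (x + fromℕ n * x)         ≡⟨ cong exp (solve 2 (λ x k → x :+ k :* x := (:1 :+ k) :* x) refl x (fromℕ n)) ⟩
    exp (fromℕ (suc n) * x)       ∎
    where open ≡-Reasoning

  search : (P : ℕ → Set) → ∀ n → P n → ¬ P 0 → ∃ λ m → ¬ P m × P (suc m)
  search P zero    P0   ¬P0 = contradiction P0 ¬P0
  search P (suc n) Psn  ¬P0 = [ (λ Pn → search P n Pn ¬P0) , (λ ¬Pn → n , ¬Pn , Psn) ]′ (decide (em {P n}))
    where
    decide : ∀ {A : Set} → Dec A → A ⊎ ¬ A
    decide (yes a) = inj₁ a
    decide (no ¬a) = inj₂ ¬a

  ceiling : ∀ {x} → 0# ≤ x → ∃ λ n → x < fromℕ n × fromℕ n ≤ x + 1#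
  ceiling {x} 0≤x = suc m , proj₂ (proj₂ found) , subst (fromℕ (suc m) ≤_) (+-comm 1# x)
    (+-mono-≤ (≤-refl {1#}) (≮⇒≥ (proj₁ (proj₂ found))))
    where
    found : ∃ λ m → ¬ (x < fromℕ m) × x < fromℕ (suc m)
    found = search (λ n → x < fromℕ n) (proj₁ (archimedean x)) (proj₂ (archimedean x)) (λ x<0 → <⇒≱ x<0 0≤x)
    m : ℕ
    m = proj₁ found

  -- With n nonzero digits in base n + 1: the numbers in 𝒩 whose digit product
  -- is at most e^Y are counted with weights as in Rankin's method, the others
  -- are q P with q small and P in a set of polylogarithmic size.

  module Counting (n′ : ℕ) (s : ℝ) (0≤s : 0# ≤ s) (e : ℝ) where

    n b : ℕ
    n = suc n′
    b = suc n

    open Dirichlet {n′} digitLog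

    L : ℝ
    L = log (fromℕ b)

    -- With e = 1 - α this is the choice of α, cleared of denominators.
    module _ (exponent : (1# + s) * L * (1# - e) ≡ L - φ s) where

      0<L : 0# < L
      0<L = 0<log-fromℕ n′

      0<1+s : 0# < 1# + s
      0<1+s = +-pos-nonneg 0<1 0≤s

      weight≤1 : ∀ i → weight s i ≤ 1#
      weight≤1 i = subst (weight s i ≤_) exp-0# (exp-mono-≤ (subst (_≤ 0#) (-‿distribˡ-* s (digitLog i))
        (-x≤0 (*-nonneg 0≤s (digitLog-nonneg i)))))

      φ≤L : φ s ≤ L
      φ≤L = exp-cancel-≤ (subst₂ _≤_ (sym (exp-φ s)) (sym (exp-log (0<suc n))) (begin
        Z s                       ≤⟨ sum-mono-≤ weight≤1 ⟩
        sum {n} (λ _ → 1#)        ≡⟨ trans (sum-const n 1#) (*-identityʳ (fromℕ n)) ⟩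
        fromℕ n                   ≤⟨ fromℕ-mono-≤ {n} {b} (ℕ.n≤1+n n) ⟩
        fromℕ b                   ∎))
        where open ≤-Reasoning

      1-e-nonneg : 0# ≤ 1# - e
      1-e-nonneg = *-cancelˡ-≤ (*-pos _ _ 0<1+s 0<L) (subst₂ _≤_ (sym (zeroʳ ((1# + s) * L))) (sym exponent) (x≤y⇒0≤y-x φ≤L))

      -- The two estimates agree digit by digit: y^s ζ^ℓ with y = b^((1-e)ℓ) on the left, the
      -- cofactor bound b^(eℓ) on the right.
      balance : s * (1# - e) * L + φ s ≡ e * L
      balance = trans (solve 4 (λ s e L p → s :* (:1 :- e) :* L :+ p := (:1 :+ s) :* L :* (:1 :- e) :- (L :- p) :+ e :* L) refl s e L (φ s))
        (trans (cong (λ z → z - (L - φ s) + e * L) exponent) (solve 4 (λ s e L p → (L :- p) :- (L :- p) :+ e :* L := e :* L) refl s e L (φ s)))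

      -- Allows b^ℓ to be replaced by the larger x in b^(eℓ), and makes `E` at least 1.
      e-nonneg : 0# ≤ e
      e-nonneg = *-cancelˡ-≤ 0<L (subst₂ _≤_ (sym (zeroʳ L)) (trans balance (*-comm e L))
        (+-nonneg (*-nonneg (*-nonneg 0≤s 1-e-nonneg) (<⇒≤ 0<L)) (φ-nonneg {n′} s)))

      logProduct : List (Fin n) → ℝ
      logProduct []      = 0#
      logProduct (d ∷ w) = digitLog d + logProduct w

      wordProduct-exp : ∀ w → fromℕ (wordProduct w) ≡ exp (logProduct w)
      wordProduct-exp []      = trans fromℕ-1 (sym exp-0#)
      wordProduct-exp (d ∷ w) = begin
        fromℕ (suc (toℕ d) ℕ.* wordProduct w)           ≡⟨ fromℕ-homo-* (suc (toℕ d)) (wordProduct w) ⟩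
        fromℕ (suc (toℕ d)) * fromℕ (wordProduct w)     ≡⟨ cong₂ _*_ (sym (exp-log (0<suc (toℕ d)))) (wordProduct-exp w) ⟩
        exp (digitLog d) * exp (logProduct w)           ≡⟨ sym (exp-+ _ _) ⟩
        exp (digitLog d + logProduct w)                 ∎
        where open ≡-Reasoning

      -- c times the product of the digits to the power - s.
      wordWeight : ℝ → List (Fin n) → ℝ
      wordWeight c w = c * exp (- s * logProduct w)

      wordWeight-∷ : ∀ c d w → wordWeight c (d ∷ w) ≡ weight s d * wordWeight c w
      wordWeight-∷ c d w = trans (cong (c *_) (trans (cong exp (distribˡ (- s) (digitLog d) (logProduct w))) (exp-+ _ _)))
        (solve 3 (λ c a b → c :* (a :* b) := a :* (c :* b)) refl c (weight s d) (exp (- s * logProduct w)))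

      wordWeight-[] : ∀ c → wordWeight c [] ≡ c
      wordWeight-[] c = trans (cong (c *_) (trans (cong exp (zeroʳ (- s))) exp-0#)) (*-identityʳ c)

      sumOver-cons : ∀ c d ws → sumOver (wordWeight c) (map (d ∷_) ws) ≡ weight s d * sumOver (wordWeight c) ws
      sumOver-cons c d []       = sym (zeroʳ (weight s d))
      sumOver-cons c d (w ∷ ws) = trans (cong₂ _+_ (wordWeight-∷ c d w) (sumOver-cons c d ws)) (sym (distribˡ _ _ _))

      sumOver-product : ∀ c ds ws → sumOver (wordWeight c) (cartesianProductWith _∷_ ds ws) ≡
        sumOver (weight s) ds * sumOver (wordWeight c) ws
      sumOver-product c []       ws = sym (zeroˡ _)
      sumOver-product c (d ∷ ds) ws = trans (sumOver-++ (wordWeight c) (map (d ∷_) ws) (cartesianProductWith _∷_ ds ws))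
        (trans (cong₂ _+_ (sumOver-cons c d ws) (sumOver-product c ds ws)) (sym (distribʳ _ _ _)))

      -- The weight is multiplicative in the digits, so the words of length k contribute c Z^k. As Z
      -- ≥ 1, each of the M + 1 lengths contributes at most c Z^M.
      sumOver-words : ∀ c → 0# ≤ c → ∀ M → sumOver (wordWeight c) (words n M) ≤ fromℕ (suc M) * (c * Z s ^ M)
      sumOver-words c 0≤c zero    = ≤-reflexive (trans (cong (_+ 0#) (wordWeight-[] c))
        (solve 1 (λ c → c :+ :0 := (:1 :+ :0) :* (c :* :1)) refl c))
      sumOver-words c 0≤c (suc M) = begin
        wordWeight c [] + sumOver (wordWeight c) (cartesianProductWith _∷_ (allFin n) (words n M))
          ≡⟨ cong₂ _+_ (wordWeight-[] c) (trans (sumOver-product c (allFin n) (words n M))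
               (cong (_* sumOver (wordWeight c) (words n M)) (sumOver-tabulate (weight s) id))) ⟩
        c + Z s * sumOver (wordWeight c) (words n M)
          ≤⟨ +-mono-≤ (≤-trans (≤-reflexive (sym (*-identityʳ c))) (*-monoˡ-≤ 0≤c (1≤^ (1≤Z {n′} s) (suc M))))
               (*-monoˡ-≤ (<⇒≤ (Z-pos s)) (sumOver-words c 0≤c M)) ⟩
        c * (Z s * Z s ^ M) + Z s * (fromℕ (suc M) * (c * Z s ^ M))
          ≡⟨ solve 4 (λ c z p k → c :* (z :* p) :+ z :* (k :* (c :* p)) := (:1 :+ k) :* (c :* (z :* p)))
               refl c (Z s) (Z s ^ M) (fromℕ (suc M)) ⟩
        fromℕ (2+ M) * (c * (Z s * Z s ^ M)) ∎
        where open ≤-Reasoning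

      module AtScale (ℓ : ℕ) where

        M : ℕ
        M = suc ℓ

        -- `Y` is log y for y = b^((1-e)ℓ), and `E` is b^(eℓ), the common size of both estimates.
        ℓ# Y E : ℝ
        ℓ# = fromℕ ℓ
        Y = (1# - e) * (ℓ# * L)
        E = exp (e * (ℓ# * L))

        exp-bL : ∀ k → fromℕ (b ℕ.^ k) ≡ exp (fromℕ k * L)
        exp-bL k = trans (fromℕ-homo-^ b k) (trans (cong (_^ k) (sym (exp-log (0<suc n)))) (exp-^ L k))

        1≤E : 1# ≤ E
        1≤E = subst (_≤ E) exp-0# (exp-mono-≤ (*-nonneg e-nonneg (*-nonneg (fromℕ-nonneg ℓ) (<⇒≤ 0<L))))

        -- A natural number above b^M / y = b E, which bounds the cofactors of digit products above
        -- y.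
        Q : ℕ
        Q = proj₁ (ceiling (<⇒≤ (exp-pos (L + e * (ℓ# * L)))))

        exp<Q : exp (L + e * (ℓ# * L)) < fromℕ Q
        exp<Q = proj₁ (proj₂ (ceiling (<⇒≤ (exp-pos (L + e * (ℓ# * L))))))

        Q≤ : fromℕ Q ≤ 2# * (fromℕ b * E)
        Q≤ = begin
          fromℕ Q                              ≤⟨ proj₂ (proj₂ (ceiling (<⇒≤ (exp-pos (L + e * (ℓ# * L)))))) ⟩
          exp (L + e * (ℓ# * L)) + 1#          ≡⟨ cong (_+ 1#) exp≡ ⟩
          fromℕ b * E + 1#                     ≤⟨ +-mono-≤ (≤-refl {fromℕ b * E}) 1≤ ⟩
          fromℕ b * E + fromℕ b * E            ≡⟨ solve 1 (λ x → x :+ x := :2 :* x) refl (fromℕ b * E) ⟩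
          2# * (fromℕ b * E)                   ∎
          where
          open ≤-Reasoning
          exp≡ : exp (L + e * (ℓ# * L)) ≡ fromℕ b * E
          exp≡ = trans (exp-+ L (e * (ℓ# * L))) (cong (_* E) (exp-log (0<suc n)))
          1≤ : 1# ≤ fromℕ b * E
          1≤ = subst (_≤ fromℕ b * E) (*-identityˡ 1#) (*-mono-≤ (<⇒≤ 0<1) (<⇒≤ 0<1)
            (subst (_≤ fromℕ b) fromℕ-1 (fromℕ-mono-≤ {1} {b} (s≤s z≤n))) 1≤E)

        -- This is y^s.
        rankin : ℝ
        rankin = exp (s * Y)

        -- The filter tests the weight (y / P)^s instead of the digit product P. For s > 0 it
        -- selects P ≤ y; for s = 0 it keeps every word.
        smallProduct : List ℕ
        smallProduct = map value (filter (λ w → 1# ≤? wordWeight rankin w) (words n M))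

        largeProduct : List ℕ
        largeProduct = cartesianProductWith ℕ._*_ (upTo Q) (smooth n M)

        length-small : fromℕ (length smallProduct) ≤ fromℕ (suc M) * (Z s * E)
        length-small = begin
          fromℕ (length smallProduct)         ≡⟨ cong fromℕ (List.length-map value (filter (λ w → 1# ≤? wordWeight rankin w) (words n M))) ⟩
          fromℕ (length (filter (λ w → 1# ≤? wordWeight rankin w) (words n M)))
            ≤⟨ length-filter≤sumOver (λ w → 1# ≤? wordWeight rankin w) (wordWeight rankin) (λ w → *-nonneg (<⇒≤ (exp-pos (s * Y))) (<⇒≤ (exp-pos (- s * logProduct w)))) (λ _ → id) (words n M) ⟩
          sumOver (wordWeight rankin) (words n M) ≤⟨ sumOver-words rankin (<⇒≤ (exp-pos (s * Y))) M ⟩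
          fromℕ (suc M) * (rankin * (Z s * Z s ^ ℓ)) ≡⟨ cong (fromℕ (suc M) *_) (trans
             (solve 3 (λ r z p → r :* (z :* p) := z :* (r :* p)) refl rankin (Z s) (Z s ^ ℓ)) (cong (Z s *_) rankin*Z^ℓ)) ⟩
          fromℕ (suc M) * (Z s * E)           ∎
          where
          open ≤-Reasoning
          rankin*Z^ℓ : rankin * Z s ^ ℓ ≡ E
          rankin*Z^ℓ = begin-equality
            rankin * Z s ^ ℓ                 ≡⟨ cong (λ z → rankin * z ^ ℓ) (sym (exp-φ s)) ⟩
            rankin * exp (φ s) ^ ℓ           ≡⟨ cong (rankin *_) (exp-^ (φ s) ℓ) ⟩
            exp (s * Y) * exp (ℓ# * φ s)     ≡⟨ sym (exp-+ (s * Y) (ℓ# * φ s)) ⟩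
            exp (s * Y + ℓ# * φ s)           ≡⟨ cong exp (solve 5 (λ s a l L p → s :* (a :* (l :* L)) :+ l :* p := l :* (s :* a :* L :+ p)) refl s (1# - e) ℓ# L (φ s)) ⟩
            exp (ℓ# * (s * (1# - e) * L + φ s)) ≡⟨ cong (λ z → exp (ℓ# * z)) balance ⟩
            exp (ℓ# * (e * L))               ≡⟨ cong exp (solve 3 (λ l e L → l :* (e :* L) := e :* (l :* L)) refl ℓ# e L) ⟩
            E                                ∎

        length-large : fromℕ (length largeProduct) ≤ 2# * (fromℕ b * E) * fromℕ (suc M) ^ n
        length-large = begin
          fromℕ (length largeProduct)         ≡⟨ cong fromℕ (trans (length-cartesianProductWith ℕ._*_ (upTo Q) (smooth n M))
                                                   (cong₂ ℕ._*_ (List.length-upTo Q) (length-smooth n M))) ⟩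
          fromℕ (Q ℕ.* suc M ℕ.^ n)           ≡⟨ trans (fromℕ-homo-* Q (suc M ℕ.^ n)) (cong (fromℕ Q *_) (fromℕ-homo-^ (suc M) n)) ⟩
          fromℕ Q * fromℕ (suc M) ^ n         ≤⟨ *-monoʳ-≤ (^-nonneg (fromℕ-nonneg (suc M)) n) Q≤ ⟩
          2# * (fromℕ b * E) * fromℕ (suc M) ^ n ∎
          where open ≤-Reasoning

        module _ {x : ℝ} (x<b^M : x < fromℕ (b ℕ.^ M)) where

          word-length : ∀ (w : List (Fin n)) → fromℕ (value w) ≤ x → length w ℕ.≤ M
          word-length []      _       = z≤n
          word-length (d ∷ w) value≤x = ℕ.≰⇒> λ M≤len → <⇒≱ x<b^M
            (≤-trans (fromℕ-mono-≤ {b ℕ.^ M} {value (d ∷ w)} (ℕ.≤-trans (ℕ.^-monoʳ-≤ b M≤len) (base^length≤value d w))) value≤x)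

          covered-by-word : ∀ (w : List (Fin n)) {N} → value w ≡ N → wordProduct w ∣ⁿ N → fromℕ N ≤ x →
            N ∈ smallProduct ++ largeProduct
          covered-by-word w refl (divides q N≡qP) N≤x = [ large , small ]′ (<-≤-total Y (logProduct w))
            where
            len≤M : length w ℕ.≤ M
            len≤M = word-length w N≤x
            small : logProduct w ≤ Y → value w ∈ smallProduct ++ largeProduct
            small logP≤Y = ∈-++⁺ˡ (∈-map⁺ value (∈-filter⁺ (λ w → 1# ≤? wordWeight rankin w) (∈-words M w len≤M) 1≤weight))
              where
              1≤weight : 1# ≤ wordWeight rankin w
              1≤weight = subst₂ _≤_ exp-0# (exp-+ (s * Y) (- s * logProduct w)) (exp-mono-≤
                (subst (0# ≤_) (solve 3 (λ s y p → s :* (y :- p) := s :* y :+ :- s :* p) refl s Y (logProduct w))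
                  (*-nonneg 0≤s (x≤y⇒0≤y-x logP≤Y))))
            large : Y < logProduct w → value w ∈ smallProduct ++ largeProduct
            large Y<logP = ∈-++⁺ʳ smallProduct (subst (_∈ largeProduct) (sym N≡qP)
              (∈-cartesianProductWith⁺ ℕ._*_ (∈-upTo⁺ (fromℕ-cancel-< {q} {Q} q<Q)) (wordProduct∈smooth M w len≤M)))
              where
              open ≤-Reasoning
              q<Q : fromℕ q < fromℕ Q
              -- From q P ≤ x < b^M = y (b E), where y is replaced by the larger digit product P;
              -- then P cancels.
              q<Q = *-cancelˡ-< (exp-pos (logProduct w)) (begin-strict
                exp (logProduct w) * fromℕ q                  ≡⟨ cong (_* fromℕ q) (sym (wordProduct-exp w)) ⟩
                fromℕ (wordProduct w) * fromℕ q               ≡⟨ trans (*-comm _ _) (trans (sym (fromℕ-homo-* q (wordProduct w))) (cong fromℕ (sym N≡qP))) ⟩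
                fromℕ (value w)                               ≤⟨ N≤x ⟩
                x                                             <⟨ x<b^M ⟩
                fromℕ (b ℕ.^ M)                               ≡⟨ exp-bL M ⟩
                exp ((1# + ℓ#) * L)                           ≡⟨ cong exp (solve 3 (λ l e L → (:1 :+ l) :* L := (:1 :- e) :* (l :* L) :+ (L :+ e :* (l :* L))) refl ℓ# e L) ⟩
                exp (Y + (L + e * (ℓ# * L)))                  <⟨ exp-mono-< (+-monoˡ-< Y (logProduct w) _ Y<logP) ⟩
                exp (logProduct w + (L + e * (ℓ# * L)))       ≡⟨ exp-+ (logProduct w) _ ⟩
                exp (logProduct w) * exp (L + e * (ℓ# * L))   <⟨ *-monoˡ-< (exp-pos (logProduct w)) exp<Q ⟩
                exp (logProduct w) * fromℕ Q                  ∎)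

          covered : ∀ {N} → 𝒩 b x N → N ∈ smallProduct ++ largeProduct
          covered (0<N , N≤x , P∣N) = let (w , value≡ , P∣N) = divisible⇒word n′ 0<N P∣N in
            covered-by-word w value≡ P∣N N≤x

          card-bound : ∀ k → HasCard (𝒩 b x) k → fromℕ k ≤ (Z s + 2# * fromℕ b) * (fromℕ (suc M) ^ n * E)
          card-bound k (ns , unique , ns⇔ , refl) = begin
            fromℕ (length ns)
              ≤⟨ fromℕ-mono-≤ {length ns} {length (smallProduct ++ largeProduct)} (unique-⊆⇒length≤ unique (λ {N} N∈ns → covered (Equivalence.to (ns⇔ N) N∈ns))) ⟩
            fromℕ (length (smallProduct ++ largeProduct))
              ≡⟨ trans (cong fromℕ (List.length-++ smallProduct)) (fromℕ-homo-+ (length smallProduct) (length largeProduct)) ⟩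
            fromℕ (length smallProduct) + fromℕ (length largeProduct)
              ≤⟨ +-mono-≤ length-small length-large ⟩
            m * (Z s * E) + 2# * (fromℕ b * E) * m ^ n
              ≤⟨ +-mono-≤ (*-monoʳ-≤ (*-nonneg (<⇒≤ (Z-pos s)) (≤-trans (<⇒≤ 0<1) 1≤E)) m≤m^n) ≤-refl ⟩
            m ^ n * (Z s * E) + 2# * (fromℕ b * E) * m ^ n
              ≡⟨ solve 4 (λ p z e b → p :* (z :* e) :+ :2 :* (b :* e) :* p := (z :+ :2 :* b) :* (p :* e)) refl (m ^ n) (Z s) E (fromℕ b) ⟩
            (Z s + 2# * fromℕ b) * (m ^ n * E) ∎
            where
            open ≤-Reasoning
            m : ℝ
            m = fromℕ (suc M)
            m≤m^n : m ≤ m ^ n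
            m≤m^n = subst (_≤ m ^ n) (*-identityʳ m) (*-monoˡ-≤ (fromℕ-nonneg (suc M))
              (1≤^ (subst (_≤ m) fromℕ-1 (fromℕ-mono-≤ {1} {suc M} (s≤s z≤n))) n′))

  -- Growth.

  -- The inequality u ≤ e^(a u) / a, with a = c / N, is raised to the power N = n + 1. The shift by
  -- 2 is that of `suc M` against ℓ.
  polynomial≤exp : ∀ n c → 0# < c → ∃ λ C → 0# < C × (∀ k → fromℕ (2+ k) ^ suc n ≤ C * exp (c * fromℕ k))
  polynomial≤exp n c 0<c = C , 0<C , bound
    where
    open ≤-Reasoning
    N a C : ℝ
    N = fromℕ (suc n)
    a = c / N
    C = (a ⁻¹) ^ suc n * exp (c * 2#)
    0<a : 0# < a
    0<a = /-pos 0<c (0<suc n)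
    0<C : 0# < C
    0<C = *-pos _ _ (^-pos (⁻¹-pos 0<a) (suc n)) (exp-pos (c * 2#))
    linear : ∀ u → u ≤ a ⁻¹ * exp (a * u)
    linear u = *-cancelˡ-≤ 0<a (begin
      a * u                      ≤⟨ ≤-by 1# (<⇒≤ 0<1) (+-comm 1# (a * u)) ⟩
      1# + a * u                 ≤⟨ 1+x≤exp (a * u) ⟩
      exp (a * u)                ≡⟨ sym (*-identityˡ _) ⟩
      1# * exp (a * u)           ≡⟨ cong (_* exp (a * u)) (sym (⁻¹-inverse a (>⇒≢ 0<a))) ⟩
      a * a ⁻¹ * exp (a * u)     ≡⟨ *-assoc a (a ⁻¹) (exp (a * u)) ⟩
      a * (a ⁻¹ * exp (a * u))   ∎)
    bound : ∀ k → fromℕ (2+ k) ^ suc n ≤ C * exp (c * fromℕ k)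
    bound k = begin
      u ^ suc n                                   ≤⟨ ^-mono-≤ (fromℕ-nonneg (2+ k)) (linear u) (suc n) ⟩
      (a ⁻¹ * exp (a * u)) ^ suc n                ≡⟨ *-^ (a ⁻¹) (exp (a * u)) (suc n) ⟩
      (a ⁻¹) ^ suc n * exp (a * u) ^ suc n        ≡⟨ cong ((a ⁻¹) ^ suc n *_) exponent ⟩
      (a ⁻¹) ^ suc n * (exp (c * 2#) * exp (c * fromℕ k)) ≡⟨ sym (*-assoc ((a ⁻¹) ^ suc n) (exp (c * 2#)) (exp (c * fromℕ k))) ⟩
      C * exp (c * fromℕ k)                       ∎
      where
      u : ℝ
      u = fromℕ (2+ k)
      exponent : exp (a * u) ^ suc n ≡ exp (c * 2#) * exp (c * fromℕ k)
      exponent = begin-equality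
        exp (a * u) ^ suc n                 ≡⟨ exp-^ (a * u) (suc n) ⟩
        exp (N * (a * u))                   ≡⟨ cong exp (trans (sym (*-assoc N a u)) (cong (_* u) (/-cancel c (>⇒≢ (0<suc n))))) ⟩
        exp (c * (1# + (1# + fromℕ k)))     ≡⟨ cong exp (solve 2 (λ c k → c :* (:1 :+ (:1 :+ k)) := c :* :2 :+ c :* k) refl c (fromℕ k)) ⟩
        exp (c * 2# + c * fromℕ k)          ≡⟨ exp-+ (c * 2#) (c * fromℕ k) ⟩
        exp (c * 2#) * exp (c * fromℕ k)    ∎

  -- The o(1) in the form of one bound for each δ. The added `1#` keeps the logarithm of the
  -- left-hand side meaningful where f vanishes, and later makes the inequality for f strict.
  GrowthExponent≤ : (ℝ → ℝ) → ℝ → Set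
  GrowthExponent≤ f θ = ∀ δ → 0# < δ → ∃ λ C → 0# < C ×
    (∀ x → 1# ≤ x → f x + 1# ≤ C * exp ((θ + δ) * log x))

  module _ (n′ : ℕ) (s : ℝ) (0≤s : 0# ≤ s) (e : ℝ) where

    open Counting n′ s 0≤s e using (n; b; L; module AtScale; 0<L; e-nonneg)
    open Dirichlet {n′} digitLog

    𝒩-growth : (1# + s) * L * (1# - e) ≡ L - φ s → GrowthExponent≤ (λ x → fromℕ (# (𝒩 b x))) e
    𝒩-growth exponent δ 0<δ = A * C + 1# , +-pos (*-pos _ _ 0<A 0<C) 0<1 , bound
      where
      open ≤-Reasoning
      0<L′ : 0# < L
      0<L′ = 0<L exponent
      poly : ∃ λ C → 0# < C × (∀ k → fromℕ (2+ k) ^ n ≤ C * exp (δ * L * fromℕ k))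
      poly = polynomial≤exp n′ (δ * L) (*-pos _ _ 0<δ 0<L′)
      A C : ℝ
      A = Z s + 2# * fromℕ b
      C = proj₁ poly
      0<C : 0# < C
      0<C = proj₁ (proj₂ poly)
      0<A : 0# < A
      0<A = +-pos (Z-pos s) (*-pos _ _ 0<2 (0<suc n))
      0≤e+δ : 0# ≤ e + δ
      0≤e+δ = +-nonneg (e-nonneg exponent) (<⇒≤ 0<δ)
      bound : ∀ x → 1# ≤ x → fromℕ (# (𝒩 b x)) + 1# ≤ (A * C + 1#) * exp ((e + δ) * log x)
      bound x 1≤x = begin
        fromℕ (# (𝒩 b x)) + 1#             ≤⟨ +-mono-≤ #≤ 1≤T ⟩
        A * (fromℕ (2+ ℓ) ^ n * E) + T       ≤⟨ +-mono-≤ (*-monoˡ-≤ (<⇒≤ 0<A) (*-monoʳ-≤ (<⇒≤ (exp-pos (e * (fromℕ ℓ * L)))) (proj₂ (proj₂ poly) ℓ))) ≤-refl ⟩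
        A * (C * exp (δ * L * fromℕ ℓ) * E) + T ≡⟨ cong (λ z → A * z + T) (trans (*-assoc C _ E) (cong (C *_) (trans (sym (exp-+ _ _))
                                                  (cong exp (solve 4 (λ d L l e → d :* L :* l :+ e :* (l :* L) := (e :+ d) :* (l :* L)) refl δ L (fromℕ ℓ) e))))) ⟩
        A * (C * T) + T                      ≡⟨ solve 3 (λ a c t → a :* (c :* t) :+ t := (a :* c :+ :1) :* t) refl A C T ⟩
        (A * C + 1#) * T                     ≤⟨ *-monoˡ-≤ (<⇒≤ (+-pos (*-pos _ _ 0<A 0<C) 0<1)) (exp-mono-≤ (*-monoˡ-≤ 0≤e+δ ℓL≤logx)) ⟩
        (A * C + 1#) * exp ((e + δ) * log x) ∎
        where
        0<x : 0# < x
        0<x = <-≤-trans 0<1 1≤x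
        power : ∀ k → fromℕ (b ℕ.^ k) ≡ exp (fromℕ k * L)
        power k = AtScale.exp-bL exponent k k
        enough : ∃ λ k → log x / L < fromℕ k
        enough = archimedean (log x / L)
        x<b^enough : x < fromℕ (b ℕ.^ proj₁ enough)
        x<b^enough = subst₂ _<_ (trans (cong exp (trans (*-comm _ L) (/-cancel (log x) (>⇒≢ 0<L′)))) (exp-log 0<x)) (sym (power (proj₁ enough)))
          (exp-mono-< (*-monoʳ-< 0<L′ (proj₂ enough)))
        -- This ℓ has b^ℓ ≤ x < b^(ℓ+1); the search is started by x ≥ 1 = b^0.
        scale : ∃ λ ℓ → ¬ (x < fromℕ (b ℕ.^ ℓ)) × x < fromℕ (b ℕ.^ suc ℓ)
        scale = search (λ k → x < fromℕ (b ℕ.^ k)) (proj₁ enough) x<b^enough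
          (λ x<1 → <⇒≱ x<1 (subst (_≤ x) (sym fromℕ-1) 1≤x))
        ℓ : ℕ
        ℓ = proj₁ scale
        E T : ℝ
        E = exp (e * (fromℕ ℓ * L))
        T = exp ((e + δ) * (fromℕ ℓ * L))
        ℓL≤logx : fromℕ ℓ * L ≤ log x
        ℓL≤logx = exp-cancel-≤ (subst₂ _≤_ (power ℓ) (sym (exp-log 0<x)) (≮⇒≥ (proj₁ (proj₂ scale))))
        1≤T : 1# ≤ T
        1≤T = subst (_≤ T) exp-0# (exp-mono-≤ (*-nonneg 0≤e+δ (*-nonneg (fromℕ-nonneg ℓ) (<⇒≤ 0<L′))))
        #≤ : fromℕ (# (𝒩 b x)) ≤ A * (fromℕ (2+ ℓ) ^ n * E)
        -- Finiteness of 𝒩 b x need not be shown: # would be 0 otherwise.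
        #≤ = choose-elim {default = 0} {P = HasCard (𝒩 b x)} (λ k → fromℕ k ≤ A * (fromℕ (2+ ℓ) ^ n * E))
          (*-nonneg (<⇒≤ 0<A) (*-nonneg (^-nonneg (fromℕ-nonneg (2+ ℓ)) n) (<⇒≤ (exp-pos (e * (fromℕ ℓ * L))))))
          (AtScale.card-bound exponent ℓ (proj₂ (proj₂ scale)))

  -- From growth bounds to x^(θ + o(1)).

  -- The growth is bounded from above only; cutting the excess of the exponent off at 0 makes an
  -- upper bound enough for ε to tend to 0.
  positivePart : ℝ → ℝ
  positivePart y = [ (λ _ → y) , (λ _ → 0#) ]′ (<-≤-total 0# y)

  positivePart-nonneg : ∀ y → 0# ≤ positivePart y
  positivePart-nonneg y with <-≤-total 0# y
  ... | inj₁ 0<y = <⇒≤ 0<y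
  ... | inj₂ _   = ≤-refl

  ≤positivePart : ∀ y → y ≤ positivePart y
  ≤positivePart y with <-≤-total 0# y
  ... | inj₁ _   = ≤-refl
  ... | inj₂ y≤0 = y≤0

  positivePart≤ : ∀ {y c} → 0# ≤ c → y ≤ c → positivePart y ≤ c
  positivePart≤ {y} 0≤c y≤c with <-≤-total 0# y
  ... | inj₁ _ = y≤c
  ... | inj₂ _ = 0≤c

  -- ε is the amount by which the actual exponent log (f + 1) / log x exceeds θ, so the inequality
  -- holds by construction, and the growth bounds serve only to show that ε tends to 0.
  growth⇒o1 : ∀ (f : ℝ → ℝ) θ → (∀ x → 0# ≤ f x) → GrowthExponent≤ f θ → f <x^[ θ +o1]
  growth⇒o1 f θ 0≤f growth = ε , ε→0 , 2# , bound
    where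
    open ≤-Reasoning
    quotient ε : ℝ → ℝ
    quotient x = log (f x + 1#) / log x - θ
    ε x = positivePart (quotient x)

    0<f+1 : ∀ x → 0# < f x + 1#
    0<f+1 x = subst (0# <_) (+-comm 1# (f x)) (+-pos-nonneg 0<1 (0≤f x))

    0<log : ∀ {x} → 2# ≤ x → 0# < log x
    0<log {x} 2≤x = subst (_< log x) log-1# (log-mono-< 0<1 (<-≤-trans (<-by 1# 0<1 refl) 2≤x))

    bound : ∀ x → 2# ≤ x → f x < x ^ʳ (θ + ε x)
    bound x 2≤x = begin-strict
      f x                          <⟨ <-by 1# 0<1 refl ⟩
      f x + 1#                     ≡⟨ sym (exp-log (0<f+1 x)) ⟩
      exp (log (f x + 1#))         ≤⟨ exp-mono-≤ (begin
        log (f x + 1#)               ≡⟨ sym (/-cancel (log (f x + 1#)) (>⇒≢ (0<log 2≤x))) ⟩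
        log x * (log (f x + 1#) / log x) ≡⟨ solve 3 (λ l q t → l :* q := (t :+ (q :- t)) :* l) refl (log x) (log (f x + 1#) / log x) θ ⟩
        (θ + quotient x) * log x     ≤⟨ *-monoʳ-≤ (<⇒≤ (0<log 2≤x)) (+-mono-≤ (≤-refl {θ}) (≤positivePart (quotient x))) ⟩
        (θ + ε x) * log x            ∎) ⟩
      exp ((θ + ε x) * log x)      ∎

    ε→0 : TendsTo0AtInfinity ε
    ε→0 δ 0<δ = X , λ x X≤x → subst (_< δ) (sym (0≤x⇒∣x∣≡x (positivePart-nonneg (quotient x))))
      (≤-<-trans (positivePart≤ (<⇒≤ (half-pos 0<δ)) (quotient≤ x X≤x)) (half-< 0<δ))
      where
      -- A quarter of δ goes to the growth bound and another to its constant, which leaves δ/2,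
      -- strictly below δ.
      δ′ : ℝ
      δ′ = half (half δ)
      0<δ′ : 0# < δ′
      0<δ′ = half-pos (half-pos 0<δ)
      C : ℝ
      C = proj₁ (growth δ′ 0<δ′)
      0<C : 0# < C
      0<C = proj₁ (proj₂ (growth δ′ 0<δ′))
      -- Beyond X the constant C is absorbed by x^δ′.
      X : ℝ
      X = exp (log C / δ′) + 2#
      quotient≤ : ∀ x → X ≤ x → quotient x ≤ half δ
      quotient≤ x X≤x = ≤-by (θ + half δ - log (f x + 1#) / log x) (x≤y⇒0≤y-x (*-cancelˡ-≤ 0<logx (begin
        log x * (log (f x + 1#) / log x)  ≡⟨ /-cancel (log (f x + 1#)) (>⇒≢ 0<logx) ⟩
        log (f x + 1#)                    ≤⟨ exp-cancel-≤ (begin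
          exp (log (f x + 1#))              ≡⟨ exp-log (0<f+1 x) ⟩
          f x + 1#                          ≤⟨ proj₂ (proj₂ (growth δ′ 0<δ′)) x 1≤x ⟩
          C * exp ((θ + δ′) * log x)        ≡⟨ cong (_* exp ((θ + δ′) * log x)) (sym (exp-log 0<C)) ⟩
          exp (log C) * exp ((θ + δ′) * log x) ≤⟨ *-monoʳ-≤ (<⇒≤ (exp-pos ((θ + δ′) * log x))) (exp-mono-≤ logC≤) ⟩
          exp (δ′ * log x) * exp ((θ + δ′) * log x) ≡⟨ sym (exp-+ _ _) ⟩
          exp (δ′ * log x + (θ + δ′) * log x) ≡⟨ cong exp (trans (solve 3 (λ d l t → d :* l :+ (t :+ d) :* l := l :* (t :+ (d :+ d))) refl δ′ (log x) θ)
                                                   (cong (λ z → log x * (θ + z)) (half-double (half δ)))) ⟩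
          exp (log x * (θ + half δ))        ∎) ⟩
        log x * (θ + half δ)              ∎)))
        (solve 3 (λ t h q → h := q :- t :+ (t :+ h :- q)) refl θ (half δ) (log (f x + 1#) / log x))
        where
        2≤x : 2# ≤ x
        2≤x = ≤-trans (≤-by (exp (log C / δ′)) (<⇒≤ (exp-pos (log C / δ′))) (+-comm (exp (log C / δ′)) 2#)) X≤x
        1≤x : 1# ≤ x
        1≤x = ≤-trans (≤-by 1# (<⇒≤ 0<1) refl) 2≤x
        0<logx : 0# < log x
        0<logx = 0<log 2≤x
        logC≤ : log C ≤ δ′ * log x
        logC≤ = subst (_≤ δ′ * log x) (/-cancel (log C) (>⇒≢ 0<δ′)) (*-monoˡ-≤ (<⇒≤ 0<δ′)
          (exp-cancel-≤ (subst (exp (log C / δ′) ≤_) (sym (exp-log (<-≤-trans 0<1 1≤x)))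
            (≤-trans (≤-by 2# (<⇒≤ 0<2) refl) X≤x))))

  𝒩-o1 : ∀ n′ s (0≤s : 0# ≤ s) e → let open Dirichlet {n′} digitLog; L = log (fromℕ (2+ n′)) in
    (1# + s) * L * (1# - e) ≡ L - φ s → (λ x → fromℕ (# (𝒩 (2+ n′) x))) <x^[ e +o1]
  𝒩-o1 n′ s 0≤s e exponent = growth⇒o1 (λ x → fromℕ (# (𝒩 (2+ n′) x))) e
    (λ x → fromℕ-nonneg (# (𝒩 (2+ n′) x))) (𝒩-growth n′ s 0≤s e exponent)

  -- Base three, and the bases from four on.

  -- At s = 0 all weights are 1 and `Z` counts the two nonzero digits, which makes the exponent log
  -- 2 / log 3.
  base-3 : (λ x → fromℕ (# (𝒩 3 x))) <x^[ η 3 +o1]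
  base-3 = 𝒩-o1 1 0# ≤-refl (η 3) (subst (λ e → (1# + 0#) * L * (1# - e) ≡ L - φ 0#) (sym η-3) (begin
    (1# + 0#) * L * (1# - log (fromℕ 2) / L)  ≡⟨ solve 2 (λ L q → (:1 :+ :0) :* L :* (:1 :- q) := L :- L :* q) refl L (log (fromℕ 2) / L) ⟩
    L - L * (log (fromℕ 2) / L)               ≡⟨ cong (λ z → L - z) (/-cancel (log (fromℕ 2)) (>⇒≢ 0<log3)) ⟩
    L - log (fromℕ 2)                         ≡⟨ cong (λ z → L - log z) (sym Z-at-0) ⟩
    L - φ 0#                                  ∎))
    where
    open ≡-Reasoning
    open Dirichlet {1} digitLog
    L : ℝ
    L = log (fromℕ 3)
    η-3 : η 3 ≡ log (fromℕ 2) / L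
    η-3 = refl
    0<log3 : 0# < L
    0<log3 = 0<log-fromℕ 1

  module _ (k : ℕ) where

    open Dirichlet {2+ k} digitLog

    exponent-≥4 : ∀ s e → 0# ≤ s →
      e ≡ 1# + 1# / ((1# + s) * log (fromℕ (2+ (2+ k)))) * log (ζ (2+ (2+ k)) s / fromℕ (2+ (2+ k))) →
      (1# + s) * log (fromℕ (2+ (2+ k))) * (1# - e) ≡ log (fromℕ (2+ (2+ k))) - φ s
    exponent-≥4 s e 0≤s e≡ = begin
      K * (1# - e)                                      ≡⟨ cong (λ z → K * (1# - z)) e≡ ⟩
      K * (1# - (1# + 1# / K * log (ζ (2+ (2+ k)) s / fromℕ (2+ (2+ k)))))
        ≡⟨ cong (λ z → K * (1# - (1# + 1# / K * log (z / fromℕ (2+ (2+ k)))))) ζ≡Z ⟩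
      K * (1# - (1# + 1# / K * log (Z s / fromℕ (2+ (2+ k)))))
        ≡⟨ cong (λ z → K * (1# - (1# + 1# / K * z))) (log-/ (Z-pos s) (0<suc (suc (2+ k)))) ⟩
      K * (1# - (1# + 1# / K * (φ s - L)))              ≡⟨ solve 4 (λ d i p L → d :* (:1 :- (:1 :+ i :* (p :- L))) := d :* i :* (L :- p)) refl K (1# / K) (φ s) L ⟩
      K * (1# / K) * (L - φ s)                          ≡⟨ cong (_* (L - φ s)) (/-cancel 1# (>⇒≢ 0<K)) ⟩
      1# * (L - φ s)                                    ≡⟨ *-identityˡ (L - φ s) ⟩
      L - φ s                                           ∎
      where
      open ≡-Reasoning
      ζ≡Z : ζ (2+ (2+ k)) s ≡ Z s
      ζ≡Z = refl
      L K : ℝ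
      L = log (fromℕ (2+ (2+ k)))
      K = (1# + s) * L
      0<K : 0# < K
      0<K = *-pos _ _ (+-pos-nonneg 0<1 0≤s) (0<log-fromℕ (2+ k))

    base-≥4 : (λ x → fromℕ (# (𝒩 (2+ (2+ k)) x))) <x^[ η (2+ (2+ k)) +o1]
    base-≥4 = 𝒩-o1 (2+ k) (sᵣ (2+ (2+ k))) (sᵣ-nonneg (2+ (2+ k))) (η (2+ (2+ k)))
      (exponent-≥4 (sᵣ (2+ (2+ k))) (η (2+ (2+ k))) (sᵣ-nonneg (2+ (2+ k))) refl)

theorem2p2 : (𝓡 : RealNumbers) → let open Analysis 𝓡 in
    (b : ℕ) → 3 ℕ.≤ b →
    (4 ℕ.≤ b → ∃! _≡_ (IsPositiveRoot b)) ×
    ((λ x → fromℕ (# (𝒩 b x))) <x^[ η b +o1])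
theorem2p2 𝓡 (suc zero)             (s≤s ())
theorem2p2 𝓡 (suc (suc zero))       (s≤s (s≤s ()))
theorem2p2 𝓡 (suc (suc (suc zero))) _ =
  (λ 4≤3 → contradiction 4≤3 (ℕ.<-irrefl refl)) , Proof.base-3 𝓡
theorem2p2 𝓡 (2+ (2+ k))            _ =
  (λ _ → Proof.PositiveRoot.unique-root 𝓡 k) , Proof.base-≥4 𝓡 k
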